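{- Let $n\ge1$ and let $\mathcal{A}^{\mathrm{pc}}$ be a cluster algebra of type $A_n$ with principal coefficients at a seed $\Sigma$. Then the Newton polytope of any cluster variable, written as a Laurent polynomial in the cluster and frozen variables of $\Sigma$, is saturated and empty.
   Context: Concretely, fix a convex $(n+3)$-gon and a triangulation $T$ of it (a maximal set of $n$ pairwise non-crossing diagonals); the seeds of a type $A_n$ cluster algebra are indexed by triangulations, and $\Sigma=\Sigma_T$ has cluster $(w_\tau)_{\tau\in T}$. The cluster algebra with principal coefficients at $\Sigma_T$ (in the sense of Fomin–Zelevinsky) has frozen variables $(y_\tau)_{\tau\in T}$ and extended exchange matrix $\binom{B(T)}{I_n}$, where $B(T)$ is the signed adjacency matrix of $T$ (in the sense of Fomin–Shapiro–Thurston). Its cluster variables $w_\gamma$ are indexed by the diagonals $\gamma$ of the polygon, and each is a Laurent polynomial in $w_\tau,y_\tau$ ($\tau\in T$), whose Newton polytope lies in $\mathbb{R}^T\times\mathbb{R}^T$. For a Laurent polynomial $f$, its support is the set of exponent vectors with nonzero coefficient and its Newton polytope is the convex hull of its support; the Newton polytope is saturated if every lattice point in it lies in the support, and empty if every lattice point in it is a vertex. -}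

module Defs where

open import Data.Nat as ℕ using (ℕ; zero; suc)
open import Data.Integer as ℤ using (ℤ; +_; -[1+_]; 0ℤ; 1ℤ)
open import Data.Rational as ℚ using (ℚ; 0ℚ; 1ℚ)
open import Data.Fin as Fin using (Fin; _↑ˡ_; _↑ʳ_; toℕ)
import Data.Vec as Vec
open Vec using (Vec)
import Data.Vec.Properties as VecP
import Data.List as List
open List using (List; []; _∷_)
open import Data.List.Relation.Unary.All using (All)
open import Data.Product using (Σ; ∃; ∃-syntax; _×_; _,_; proj₁; proj₂)
open import Data.Bool using (Bool; true; false; if_then_else_; _∨_)
open import Relation.Nullary using (¬_; Dec; yes; no; does)
open import Relation.Binary.PropositionalEquality using (_≡_; _≢_)

-- Laurent polynomials over ℤ in m variables.
-- An exponent vector is an element of ℤ^m; a Laurent polynomial is a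
-- finite formal sum of terms (coefficient, exponent vector).  Two such
-- sums are equal iff all coefficients agree.

Exp : ℕ → Set
Exp m = Vec ℤ m

_≟E_ : ∀ {m} → (a b : Exp m) → Dec (a ≡ b)
_≟E_ = VecP.≡-dec ℤ._≟_

Laurent : ℕ → Set
Laurent m = List (ℤ × Exp m)

coeff : ∀ {m} → Laurent m → Exp m → ℤ
coeff [] e = 0ℤ
coeff ((c , a) ∷ L) e = if does (a ≟E e) then c ℤ.+ coeff L e else coeff L e

_≈L_ : ∀ {m} → Laurent m → Laurent m → Set
L ≈L M = ∀ e → coeff L e ≡ coeff M e

_+L_ : ∀ {m} → Laurent m → Laurent m → Laurent m
L +L M = L List.++ M

_*L_ : ∀ {m} → Laurent m → Laurent m → Laurent m
L *L M = List.concatMap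
  (λ { (c , a) → List.map (λ { (d , b) → (c ℤ.* d , Vec.zipWith ℤ._+_ a b) }) M }) L

monomial : ∀ {m} → Exp m → Laurent m
monomial a = (1ℤ , a) ∷ []

oneL : ∀ {m} → Laurent m
oneL = monomial (Vec.replicate _ 0ℤ)

_^L_ : ∀ {m} → Laurent m → ℕ → Laurent m
L ^L zero = oneL
L ^L suc k = L *L (L ^L k)

prodL : ∀ {m n} → (Fin n → Laurent m) → Laurent m
prodL {n = n} f = List.foldr (λ i acc → f i *L acc) oneL (List.allFin n)

unitE : ∀ {m} → Fin m → Exp m
unitE i = Vec.tabulate (λ j → if does (j Fin.≟ i) then 1ℤ else 0ℤ)

Support : ∀ {m} → Laurent m → Exp m → Set
Support f e = coeff f e ≢ 0ℤ

toℚv : ∀ {m} → Exp m → Vec ℚ m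
toℚv = Vec.map (λ z → z ℚ./ 1)

sumℚ : ∀ {m} → List (ℚ × Exp m) → ℚ
sumℚ = List.foldr (λ p acc → proj₁ p ℚ.+ acc) 0ℚ

combo : ∀ {m} → List (ℚ × Exp m) → Vec ℚ m
combo {m} = List.foldr
  (λ p acc → Vec.zipWith ℚ._+_ (Vec.map (proj₁ p ℚ.*_) (toℚv (proj₂ p))) acc)
  (Vec.replicate m 0ℚ)

InNewton : ∀ {m} → Laurent m → Vec ℚ m → Set
InNewton {m} f q = ∃[ ws ]
  ( All (λ p → Support f (proj₂ p) × (0ℚ ℚ.≤ proj₁ p)) ws
  × sumℚ ws ≡ 1ℚ
  × combo ws ≡ q )

dot : ∀ {m} → Vec ℚ m → Vec ℚ m → ℚ
dot u v = Vec.foldr _ ℚ._+_ 0ℚ (Vec.zipWith ℚ._*_ u v)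

IsVertex : ∀ {m} → Laurent m → Vec ℚ m → Set
IsVertex {m} f q = InNewton f q ×
  ∃[ c ] (∀ r → InNewton f r → r ≢ q → dot c r ℚ.< dot c q)

Saturated : ∀ {m} → Laurent m → Set
Saturated f = ∀ p → InNewton f (toℚv p) → Support f p

EmptyPolytope : ∀ {m} → Laurent m → Set
EmptyPolytope f = ∀ p → InNewton f (toℚv p) → IsVertex f (toℚv p)

Matrix : ℕ → Set
Matrix n = Fin n → Fin n → ℤ

pos : ℤ → ℤ
pos (+ k) = + k
pos -[1+ k ] = 0ℤ

mutB : ∀ {n} → Fin n → Matrix n → Matrix n
mutB k B i j =
  if does (i Fin.≟ k) ∨ does (j Fin.≟ k) then ℤ.- B i j
  else B i j ℤ.+ pos (B i k) ℤ.* pos (B k j)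
             ℤ.- pos (ℤ.- B i k) ℤ.* pos (ℤ.- B k j)

-- mutation at k of the coefficient rows C (row i of C is row n+i of the
-- extended exchange matrix), using the principal part B
mutC : ∀ {n} → Fin n → Matrix n → Matrix n → Matrix n
mutC k B C i j =
  if does (j Fin.≟ k) then ℤ.- C i j
  else C i j ℤ.+ pos (C i k) ℤ.* pos (B k j)
             ℤ.- pos (ℤ.- C i k) ℤ.* pos (ℤ.- B k j)

idMatrix : ∀ {n} → Matrix n
idMatrix i j = if does (i Fin.≟ j) then 1ℤ else 0ℤ

posℕ : ℤ → ℕ
posℕ (+ k) = k
posℕ -[1+ k ] = 0

-- Cluster algebra with principal coefficients of rank n.
-- Ambient Laurent ring: variables w_1..w_n (cluster of the initial seed)
-- and y_1..y_n (frozen); exponents live in ℤ^(n+n).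

wVar : ∀ {n} → Fin n → Laurent (n ℕ.+ n)
wVar {n} i = monomial (unitE (i ↑ˡ n))

yVar : ∀ {n} → Fin n → Laurent (n ℕ.+ n)
yVar {n} i = monomial (unitE (n ↑ʳ i))

Cluster : ℕ → Set
Cluster n = Fin n → Laurent (n ℕ.+ n)

exchRHS : ∀ {n} → Cluster n → Matrix n → Matrix n → Fin n → Laurent (n ℕ.+ n)
exchRHS x B C k =
  (prodL (λ i → x i ^L posℕ (B i k)) *L prodL (λ i → yVar i ^L posℕ (C i k)))
  +L
  (prodL (λ i → x i ^L posℕ (ℤ.- B i k)) *L prodL (λ i → yVar i ^L posℕ (ℤ.- C i k)))

update : ∀ {n} → Cluster n → Fin n → Laurent (n ℕ.+ n) → Cluster n
update x k z i = if does (i Fin.≟ k) then z else x i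

-- Seeds (cluster, B, C) reachable by mutation from the initial seed
-- (w, B₀, I) with principal coefficients.  The new cluster variable z
-- is the (unique) Laurent polynomial with z · x_k = exchange binomial.
data Reachable {n : ℕ} (B₀ : Matrix n) : Cluster n → Matrix n → Matrix n → Set where
  initial : Reachable B₀ wVar B₀ idMatrix
  mutate  : ∀ {x B C} → Reachable B₀ x B C → (k : Fin n) (z : Laurent (n ℕ.+ n)) →
            (z *L x k) ≈L exchRHS x B C k →
            Reachable B₀ (update x k z) (mutB k B) (mutC k B C)

IsClusterVariable : ∀ {n} → Matrix n → Laurent (n ℕ.+ n) → Set
IsClusterVariable {n} B₀ f =
  ∃[ x ] ∃[ B ] ∃[ C ] (Reachable B₀ x B C × ∃[ i ] (x i ≈L f))

linA : (n : ℕ) → Matrix n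
linA n i j =
  if does (toℕ j ℕ.≟ suc (toℕ i)) then 1ℤ
  else if does (toℕ i ℕ.≟ suc (toℕ j)) then ℤ.- 1ℤ
  else 0ℤ

mutSeq : ∀ {n} → List (Fin n) → Matrix n → Matrix n
mutSeq [] B = B
mutSeq (k ∷ ks) B = mutSeq ks (mutB k B)

IsTypeA : (n : ℕ) → Matrix n → Set
IsTypeA n B = ∃[ ks ] (∀ i j → B i j ≡ mutSeq ks (linA n) i j)

-- The cluster variable of a diagonal γ has support contained in
-- { (g + B₀ e , e) : e ∈ {0,1}ⁿ } for a fixed vector g, so its Newton polytope projects
-- injectively to a subpolytope of the unit cube spanned by vertices of the cube, which is
-- both saturated and empty.
--
-- To locate the support, order the exponents by a linear functional and then
-- lexicographically.  The leading coefficient of a cluster variable is always positive, so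
-- the maximum of the functional over the support follows a tropical recursion along
-- mutations.  For the functional −yⱼ the recursion is constantly 0 because c and −c are
-- never both positive.  For the grading wᵣ − Σ B₀ᵣⱼ yⱼ both terms of the exchange
-- binomial agree.  For yⱼ the recursion computes the number of crossings of γ with the
-- initial diagonal τⱼ, which is 0 or 1: seeds are modelled by triangulations, the rows of
-- the extended exchange matrix by signed adjacencies and by shear coordinates of
-- elementary laminations, and the exchange relation becomes the tropical Ptolemy relation.
module Submission where

open import Defs
open import Data.Nat as ℕ using (ℕ; zero; suc; z≤n; s≤s; _<_)
import Data.Nat.Properties as ℕₚ
open import Data.Integer as ℤ using (ℤ; 0ℤ; 1ℤ; -1ℤ; _+_; _*_; _-_; -_; _⊔_)
import Data.Integer.Properties as ℤₚ
open import Data.Integer.Tactic.RingSolver using (solve-∀)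
open import Data.Rational as ℚ using (ℚ; 0ℚ; 1ℚ)
import Data.Rational.Properties as ℚₚ
open import Data.Rational.Solver using (module +-*-Solver)
import Data.Rational.Unnormalised as ℚᵘ
import Data.Rational.Unnormalised.Properties as ℚᵘₚ
open import Data.Bool using (Bool; T; true; false; if_then_else_; _∧_; _∨_)
open import Data.Bool.Properties using (T?; T-∧; T-∨; ∧-zeroʳ; ∨-zeroʳ)
open import Data.Fin as Fin using (Fin; zero; suc; toℕ; _↑ˡ_; _↑ʳ_)
open import Data.Fin.Patterns using (0F; 1F; 2F; 3F; 4F)
import Data.Fin.Properties as Finₚ
open import Data.List as List using (List; []; _∷_; _++_; map; foldr; length)
open import Data.List.Relation.Unary.All as All using (All; []; _∷_)
open import Data.Vec as Vec using (Vec; []; _∷_; lookup; replicate; tabulate; zipWith)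
open import Data.Vec.Properties using (lookup∘tabulate; lookup-map; lookup-replicate; lookup-++ˡ; lookup-++ʳ; map-cong; map-id)
open import Data.Product using (∃-syntax; _×_; _,_; proj₁; proj₂)
open import Data.Sum using (_⊎_; inj₁; inj₂; [_,_])
open import Data.Empty using (⊥)
open import Data.Unit using (tt)
open import Function using (_∘_; id)
open import Function.Bundles using (Equivalence)
open import Algebra.Properties.AbelianGroup ℤₚ.+-0-abelianGroup using (∙-cancelʳ)
open import Algebra.Properties.Semiring.Sum ℤₚ.+-*-semiring using (sum; sum-cong-≗; ∑-distrib-+; *-distribˡ-sum)
open import Relation.Nullary using (¬_; Dec; yes; no; does; contradiction)
open import Relation.Nullary.Decidable using (dec-true; dec-false; toWitness; _→-dec_; _×-dec_; _⊎-dec_)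
open import Relation.Binary using (Tri; tri<; tri≈; tri>)
open import Relation.Binary.PropositionalEquality using (_≡_; _≢_; refl; sym; trans; cong; cong₂; subst; subst₂; module ≡-Reasoning)

-- A new cluster variable `z` is given only by the equation `z *L x k ≈L exchRHS x B C k`, so its
-- support has to be found by division. Leading terms survive division, since they multiply and ℤ
-- has no zero divisors; they survive sums because both leading coefficients are positive. One total
-- order per functional thus takes the place of an explicit expansion formula for cluster variables.
-- Bounding a few functionals is enough: a lattice point of the Newton polytope obeys the same
-- inequalities as the support, so its y-part is itself a vertex of the cube, and a functional that
-- singles out this vertex can reach its value there only if the point was already in the support.
-- The geometry is reduced to finite checks. A fixed chord sorts the vertices into five positions,
-- on which crossings, shear coordinates and adjacencies depend; each local identity about four or
-- five vertices in cyclic order becomes a statement about `Fin 5`, decided by enumeration.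
-- Triangulations enter through the fan, whose adjacency matrix is `linA`; flips along a mutation
-- sequence lead to one for `B₀`.

private variable
  dim n : ℕ

-- Leading terms of Laurent polynomials

infixl 6 _⊕_ _⊖_
infix 4 _≺_

_⊕_ _⊖_ : Exp dim → Exp dim → Exp dim
_⊕_ = zipWith _+_
_⊖_ = zipWith _-_

⊕-⊖ : (a b : Exp dim) → (a ⊕ b) ⊖ a ≡ b
⊕-⊖ [] [] = refl
⊕-⊖ (x ∷ a) (y ∷ b) = cong₂ _∷_ (eq x y) (⊕-⊖ a b)
  where
  eq : ∀ x y → x + y - x ≡ y
  eq = solve-∀

⊖-⊕ : (e a : Exp dim) → a ⊕ (e ⊖ a) ≡ e
⊖-⊕ [] [] = refl
⊖-⊕ (x ∷ e) (y ∷ a) = cong₂ _∷_ (eq x y) (⊖-⊕ e a)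
  where
  eq : ∀ x y → y + (x - y) ≡ x
  eq = solve-∀

⊕-comm : (a b : Exp dim) → a ⊕ b ≡ b ⊕ a
⊕-comm [] [] = refl
⊕-comm (x ∷ a) (y ∷ b) = cong₂ _∷_ (ℤₚ.+-comm x y) (⊕-comm a b)

⟨_,_⟩ : Exp dim → Exp dim → ℤ
⟨ [] , [] ⟩ = 0ℤ
⟨ x ∷ v , y ∷ e ⟩ = x * y + ⟨ v , e ⟩

⟨⟩-⊕ : (v a b : Exp dim) → ⟨ v , a ⊕ b ⟩ ≡ ⟨ v , a ⟩ + ⟨ v , b ⟩
⟨⟩-⊕ [] [] [] = refl
⟨⟩-⊕ (x ∷ v) (y ∷ a) (z ∷ b) = trans (cong (x * (y + z) +_) (⟨⟩-⊕ v a b)) (eq x y z ⟨ v , a ⟩ ⟨ v , b ⟩)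
  where
  eq : ∀ x y z s t → x * (y + z) + (s + t) ≡ (x * y + s) + (x * z + t)
  eq = solve-∀

⟨⟩-zero : (v : Exp dim) → ⟨ v , replicate _ 0ℤ ⟩ ≡ 0ℤ
⟨⟩-zero [] = refl
⟨⟩-zero (x ∷ v) = trans (cong₂ _+_ (ℤₚ.*-zeroʳ x) (⟨⟩-zero v)) refl

⟨⟩-tabulate-zero : (v : Exp dim) → ⟨ v , tabulate (λ _ → 0ℤ) ⟩ ≡ 0ℤ
⟨⟩-tabulate-zero [] = refl
⟨⟩-tabulate-zero (x ∷ v) = trans (cong₂ _+_ (ℤₚ.*-zeroʳ x) (⟨⟩-tabulate-zero v)) refl

⟨⟩-unitE : (v : Exp dim) (i : Fin dim) → ⟨ v , unitE i ⟩ ≡ lookup v i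
⟨⟩-unitE (x ∷ v) zero = trans (cong₂ _+_ (ℤₚ.*-identityʳ x) (⟨⟩-tabulate-zero v)) (ℤₚ.+-identityʳ x)
⟨⟩-unitE (x ∷ v) (suc i) = trans (cong₂ _+_ (ℤₚ.*-zeroʳ x) (⟨⟩-unitE v i)) (ℤₚ.+-identityˡ _)

coeff-here : ∀ c (a : Exp dim) L → coeff ((c , a) ∷ L) a ≡ c + coeff L a
coeff-here c a L rewrite dec-true (a ≟E a) refl = refl

coeff-there : ∀ c {a e : Exp dim} L → a ≢ e → coeff ((c , a) ∷ L) e ≡ coeff L e
coeff-there c {a} {e} L a≢e rewrite dec-false (a ≟E e) a≢e = refl

coeff-++ : (L M : Laurent dim) (e : Exp dim) → coeff (L ++ M) e ≡ coeff L e + coeff M e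
coeff-++ [] M e = sym (ℤₚ.+-identityˡ _)
coeff-++ ((c , a) ∷ L) M e with a ≟E e
... | yes _ = trans (cong (c +_) (coeff-++ L M e)) (sym (ℤₚ.+-assoc c _ _))
... | no _ = coeff-++ L M e

-- A list may repeat an exponent and its terms may cancel, so products are expressed through a
-- linear functional of the formal sum, whose value depends on the coefficients alone.
pairing : (Exp dim → ℤ) → Laurent dim → ℤ
pairing φ [] = 0ℤ
pairing φ ((c , a) ∷ L) = c * φ a + pairing φ L

-- Multiplication by a single term translates the coefficients. The map is a variable `h` known
-- pointwise, because the pattern-matching lambda inside `_*L_` has no name to refer to.
coeff-shift : ∀ c (a : Exp dim) {h : ℤ × Exp dim → ℤ × Exp dim} → (∀ d b → h (d , b) ≡ (c * d , a ⊕ b)) →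
  ∀ M e → coeff (map h M) e ≡ c * coeff M (e ⊖ a)
coeff-shift c a h≡ [] e = sym (ℤₚ.*-zeroʳ c)
coeff-shift c a {h} h≡ ((d , b) ∷ M) e rewrite h≡ d b with b ≟E (e ⊖ a)
... | yes refl rewrite ⊖-⊕ e a =
  trans (coeff-here (c * d) e (map h M))
    (trans (cong (c * d +_) (coeff-shift c a h≡ M e)) (sym (ℤₚ.*-distribˡ-+ c d _)))
... | no b≢ = trans (coeff-there (c * d) (map h M) (λ eq → b≢ (trans (sym (⊕-⊖ a b)) (cong (_⊖ a) eq))))
    (coeff-shift c a h≡ M e)

coeff-*L : (L M : Laurent dim) (e : Exp dim) → coeff (L *L M) e ≡ pairing (λ a → coeff M (e ⊖ a)) L
coeff-*L [] M e = refl
coeff-*L ((c , a) ∷ L) M e =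
  trans (coeff-++ (map _ M) (L *L M) e)
    (cong₂ _+_ (coeff-shift c a (λ _ _ → refl) M e) (coeff-*L L M e))

remove : Exp dim → Laurent dim → Laurent dim
remove a [] = []
remove a ((c , b) ∷ L) = if does (b ≟E a) then remove a L else (c , b) ∷ remove a L

pairing-remove : ∀ (φ : Exp dim → ℤ) (a : Exp dim) L → pairing φ L ≡ coeff L a * φ a + pairing φ (remove a L)
pairing-remove φ a [] = sym (trans (ℤₚ.+-identityʳ _) (ℤₚ.*-zeroˡ (φ a)))
pairing-remove φ a ((c , b) ∷ L) with b ≟E a
... | yes refl = trans (cong (c * φ b +_) (pairing-remove φ b L)) (eq c (φ b) (coeff L b) _)
  where
  eq : ∀ c f l r → c * f + (l * f + r) ≡ (c + l) * f + r
  eq = solve-∀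
... | no _ = trans (cong (c * φ b +_) (pairing-remove φ a L)) (eq (c * φ b) (coeff L a * φ a) _)
  where
  eq : ∀ x y z → x + (y + z) ≡ y + (x + z)
  eq = solve-∀

coeff-remove-≢ : ∀ {a x : Exp dim} L → x ≢ a → coeff (remove a L) x ≡ coeff L x
coeff-remove-≢ [] x≢a = refl
coeff-remove-≢ {a = a} {x} ((c , b) ∷ L) x≢a with b ≟E a
... | yes refl = trans (coeff-remove-≢ L x≢a) (sym (coeff-there c L (x≢a ∘ sym)))
... | no _ with b ≟E x
...   | yes _ = cong (c +_) (coeff-remove-≢ L x≢a)
...   | no _ = coeff-remove-≢ L x≢a

coeff-remove-≡ : ∀ (a : Exp dim) L → coeff (remove a L) a ≡ 0ℤ
coeff-remove-≡ a [] = refl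
coeff-remove-≡ a ((c , b) ∷ L) with b ≟E a
... | yes _ = coeff-remove-≡ a L
... | no b≢a = trans (coeff-there c (remove a L) b≢a) (coeff-remove-≡ a L)

length-remove : ∀ (a : Exp dim) L → length (remove a L) ℕ.≤ length L
length-remove a [] = z≤n
length-remove a ((c , b) ∷ L) with b ≟E a
... | yes _ = ℕₚ.m≤n⇒m≤1+n (length-remove a L)
... | no _ = s≤s (length-remove a L)

coeff-remove-* : ∀ (φ : Exp dim → ℤ) (a : Exp dim) L → (∀ x → x ≢ a → coeff L x * φ x ≡ 0ℤ) →
  ∀ x → coeff (remove a L) x * φ x ≡ 0ℤ
coeff-remove-* φ a L h x with x ≟E a
... | yes refl = trans (cong (_* φ a) (coeff-remove-≡ a L)) (ℤₚ.*-zeroˡ (φ a))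
... | no x≢a = trans (cong (_* φ x) (coeff-remove-≢ L x≢a)) (h x x≢a)

-- Like terms are collected one exponent at a time. `remove b L` is no subterm of `L`, so the
-- recursion runs on a bound `N` for the length.
pairing-zero : ∀ (φ : Exp dim → ℤ) (L : Laurent dim) → (∀ x → coeff L x * φ x ≡ 0ℤ) → pairing φ L ≡ 0ℤ
pairing-zero φ L = go (length L) L ℕₚ.≤-refl
  where
  go : ∀ N L → length L ℕ.≤ N → (∀ x → coeff L x * φ x ≡ 0ℤ) → pairing φ L ≡ 0ℤ
  go N [] _ h = refl
  go (suc N) L@((c , b) ∷ L′) (s≤s l) h = begin
    pairing φ L                                 ≡⟨ pairing-remove φ b L ⟩
    coeff L b * φ b + pairing φ (remove b L)    ≡⟨ cong₂ _+_ (h b) rest ⟩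
    0ℤ                                          ∎
    where
    open ≡-Reasoning
    -- The head is removed too, which is what makes the length drop.
    remove-head : remove b L ≡ remove b L′
    remove-head rewrite dec-true (b ≟E b) refl = refl
    rest : pairing φ (remove b L) ≡ 0ℤ
    rest = go N (remove b L)
      (subst (λ R → length R ℕ.≤ N) (sym remove-head) (ℕₚ.≤-trans (length-remove b L′) l))
      (coeff-remove-* φ b L (λ x _ → h x))

pairing-single : ∀ (φ : Exp dim → ℤ) (a : Exp dim) L → (∀ x → x ≢ a → coeff L x * φ x ≡ 0ℤ) →
  pairing φ L ≡ coeff L a * φ a
pairing-single φ a L h = begin
  pairing φ L                               ≡⟨ pairing-remove φ a L ⟩
  coeff L a * φ a + pairing φ (remove a L)  ≡⟨ cong (coeff L a * φ a +_) (pairing-zero φ (remove a L) (coeff-remove-* φ a L h)) ⟩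
  coeff L a * φ a + 0ℤ                      ≡⟨ ℤₚ.+-identityʳ _ ⟩
  coeff L a * φ a                           ∎
  where open ≡-Reasoning

-- Lexicographic orders and leading exponents.

_≺_ : Vec ℤ dim → Vec ℤ dim → Set
[] ≺ [] = ⊥
(x ∷ a) ≺ (y ∷ b) = x ℤ.< y ⊎ (x ≡ y × a ≺ b)

≺-irrefl : (a : Vec ℤ dim) → ¬ a ≺ a
≺-irrefl (x ∷ a) (inj₁ x<x) = ℤₚ.<-irrefl refl x<x
≺-irrefl (x ∷ a) (inj₂ (_ , a≺a)) = ≺-irrefl a a≺a

≺-trans : (a b c : Vec ℤ dim) → a ≺ b → b ≺ c → a ≺ c
≺-trans [] [] [] ()
≺-trans (_ ∷ _) (_ ∷ _) (_ ∷ _) (inj₁ p) (inj₁ q) = inj₁ (ℤₚ.<-trans p q)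
≺-trans (_ ∷ _) (_ ∷ _) (_ ∷ _) (inj₁ p) (inj₂ (refl , _)) = inj₁ p
≺-trans (_ ∷ _) (_ ∷ _) (_ ∷ _) (inj₂ (refl , _)) (inj₁ q) = inj₁ q
≺-trans (_ ∷ a) (_ ∷ b) (_ ∷ c) (inj₂ (refl , p)) (inj₂ (refl , q)) = inj₂ (refl , ≺-trans a b c p q)

≺-cmp : (a b : Vec ℤ dim) → a ≺ b ⊎ a ≡ b ⊎ b ≺ a
≺-cmp [] [] = inj₂ (inj₁ refl)
≺-cmp (x ∷ a) (y ∷ b) with ℤₚ.<-cmp x y
... | tri< p _ _ = inj₁ (inj₁ p)
... | tri> _ _ p = inj₂ (inj₂ (inj₁ p))
... | tri≈ _ refl _ with ≺-cmp a b
...   | inj₁ p = inj₁ (inj₂ (refl , p))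
...   | inj₂ (inj₁ refl) = inj₂ (inj₁ refl)
...   | inj₂ (inj₂ p) = inj₂ (inj₂ (inj₂ (refl , p)))

≺-monoˡ : (a b c : Vec ℤ dim) → a ≺ c → a ⊕ b ≺ c ⊕ b
≺-monoˡ [] [] [] ()
≺-monoˡ (_ ∷ _) (y ∷ _) (_ ∷ _) (inj₁ p) = inj₁ (ℤₚ.+-monoˡ-< y p)
≺-monoˡ (_ ∷ a) (_ ∷ b) (_ ∷ c) (inj₂ (refl , p)) = inj₂ (refl , ≺-monoˡ a b c p)

positive-factor : ∀ x y → 0ℤ ℤ.< y → 0ℤ ℤ.< x * y → 0ℤ ℤ.< x
positive-factor x y 0<y 0<xy with ℤₚ.<-cmp 0ℤ x
... | tri< p _ _ = p
... | tri≈ _ refl _ = contradiction 0<xy (ℤₚ.<-irrefl refl)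
... | tri> _ _ x<0 = contradiction 0<xy (ℤₚ.<-asym
  (ℤₚ.*-monoʳ-<-pos y {{ℤ.positive 0<y}} x<0))

positive-* : ∀ x y → 0ℤ ℤ.< x → 0ℤ ℤ.< y → 0ℤ ℤ.< x * y
positive-* x y 0<x 0<y = ℤₚ.*-monoʳ-<-pos y {{ℤ.positive 0<y}} 0<x

module Leading {dim : ℕ} (v : Exp dim) where

  infix 4 _⊏_

  -- With the value of `v` in front, a single lexicographic comparison first compares `v` and then
  -- breaks ties. The result is a total order invariant under translation, so every nonzero
  -- polynomial has a unique leading exponent.
  key : Exp dim → Vec ℤ (suc dim)
  key a = ⟨ v , a ⟩ ∷ a

  _⊏_ : Exp dim → Exp dim → Set
  a ⊏ b = key a ≺ key b

  ⊏-irrefl : ∀ a → ¬ a ⊏ a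
  ⊏-irrefl a = ≺-irrefl (key a)

  ⊏-trans : ∀ {a b c} → a ⊏ b → b ⊏ c → a ⊏ c
  ⊏-trans {a} {b} {c} = ≺-trans (key a) (key b) (key c)

  ⊏⇒≤ : ∀ {a b} → a ⊏ b → ⟨ v , a ⟩ ℤ.≤ ⟨ v , b ⟩
  ⊏⇒≤ (inj₁ p) = ℤₚ.<⇒≤ p
  ⊏⇒≤ (inj₂ (p , _)) = ℤₚ.≤-reflexive p

  ⊏-cmp : ∀ a b → a ⊏ b ⊎ a ≡ b ⊎ b ⊏ a
  ⊏-cmp a b with ≺-cmp (key a) (key b)
  ... | inj₁ p = inj₁ p
  ... | inj₂ (inj₁ eq) = inj₂ (inj₁ (cong Vec.tail eq))
  ... | inj₂ (inj₂ p) = inj₂ (inj₂ p)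

  ⊏-monoˡ : ∀ {a c} b → a ⊏ c → a ⊕ b ⊏ c ⊕ b
  ⊏-monoˡ {a} {c} b p rewrite ⟨⟩-⊕ v a b | ⟨⟩-⊕ v c b = ≺-monoˡ (key a) (key b) (key c) p

  ⊏-monoʳ : ∀ a {b c} → b ⊏ c → a ⊕ b ⊏ a ⊕ c
  ⊏-monoʳ a {b} {c} p rewrite ⊕-comm a b | ⊕-comm a c = ⊏-monoˡ a p

  -- Addition is strictly monotone in both arguments: if neither summand exceeds its bound, the sum
  -- stays strictly below unless both bounds are attained. Hence just one pair of exponents
  -- contributes to the leading coefficient of a product.
  ⊏-split : ∀ a b x y → ¬ x ⊕ y ⊏ a ⊕ b → a ⊏ x ⊎ b ⊏ y ⊎ (x ≡ a × y ≡ b)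
  ⊏-split a b x y ¬p with ⊏-cmp a x | ⊏-cmp b y
  ... | inj₁ p | _ = inj₁ p
  ... | _ | inj₁ q = inj₂ (inj₁ q)
  ... | inj₂ (inj₁ refl) | inj₂ (inj₁ refl) = inj₂ (inj₂ (refl , refl))
  ... | inj₂ (inj₁ refl) | inj₂ (inj₂ q) = contradiction (⊏-monoʳ a q) ¬p
  ... | inj₂ (inj₂ p) | inj₂ (inj₁ refl) = contradiction (⊏-monoˡ b p) ¬p
  ... | inj₂ (inj₂ p) | inj₂ (inj₂ q) = contradiction (⊏-trans (⊏-monoˡ y p) (⊏-monoʳ a q)) ¬p

  Top : Laurent dim → Exp dim → Set
  Top f a = ∀ e → a ⊏ e → coeff f e ≡ 0ℤ

  private
    zero-term : ∀ {f g a b} → Top f a → Top g b → ∀ e x → a ⊏ x ⊎ b ⊏ e ⊖ x →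
      coeff f x * coeff g (e ⊖ x) ≡ 0ℤ
    zero-term {g = g} tf tg e x (inj₁ p) = trans (cong (_* coeff g (e ⊖ x)) (tf x p)) (ℤₚ.*-zeroˡ (coeff g (e ⊖ x)))
    zero-term {f = f} tf tg e x (inj₂ p) = trans (cong (coeff f x *_) (tg (e ⊖ x) p)) (ℤₚ.*-zeroʳ (coeff f x))

  top-* : ∀ {f g a b} → Top f a → Top g b → Top (f *L g) (a ⊕ b)
  top-* {f} {g} {a} {b} tf tg e p = trans (coeff-*L f g e) (pairing-zero _ f (λ x → zero-term {f} {g} tf tg e x (split x)))
    where
    split : ∀ x → a ⊏ x ⊎ b ⊏ e ⊖ x
    split x with ⊏-split a b x (e ⊖ x)
      (λ q → ⊏-irrefl e (⊏-trans (subst (_⊏ a ⊕ b) (⊖-⊕ e x) q) p))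
    ... | inj₁ q = inj₁ q
    ... | inj₂ (inj₁ q) = inj₂ q
    ... | inj₂ (inj₂ (refl , eq)) =
      contradiction (subst (a ⊕ b ⊏_) (trans (sym (⊖-⊕ e a)) (cong (a ⊕_) eq)) p) (⊏-irrefl (a ⊕ b))

  coeff-top-* : ∀ {f g a b} → Top f a → Top g b → coeff (f *L g) (a ⊕ b) ≡ coeff f a * coeff g b
  coeff-top-* {f} {g} {a} {b} tf tg = begin
    coeff (f *L g) (a ⊕ b)                 ≡⟨ coeff-*L f g (a ⊕ b) ⟩
    pairing φ f                            ≡⟨ pairing-single φ a f (λ x x≢a → zero-term {f} {g} tf tg (a ⊕ b) x (split x x≢a)) ⟩
    coeff f a * coeff g ((a ⊕ b) ⊖ a)      ≡⟨ cong (λ e → coeff f a * coeff g e) (⊕-⊖ a b) ⟩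
    coeff f a * coeff g b                  ∎
    where
    open ≡-Reasoning
    φ : Exp dim → ℤ
    φ x = coeff g ((a ⊕ b) ⊖ x)
    split : ∀ x → x ≢ a → a ⊏ x ⊎ b ⊏ (a ⊕ b) ⊖ x
    split x x≢a with ⊏-split a b x ((a ⊕ b) ⊖ x)
      (λ q → ⊏-irrefl (a ⊕ b) (subst (_⊏ a ⊕ b) (⊖-⊕ (a ⊕ b) x) q))
    ... | inj₁ q = inj₁ q
    ... | inj₂ (inj₁ q) = inj₂ q
    ... | inj₂ (inj₂ (x≡a , _)) = contradiction x≡a x≢a

  coeff-exponents : ∀ {P : Exp dim → Set} L → All P (map proj₂ L) → ∀ e → coeff L e ≡ 0ℤ ⊎ P e
  coeff-exponents [] [] e = inj₁ refl
  coeff-exponents ((c , a) ∷ L) (p ∷ ps) e with a ≟E e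
  ... | yes refl = inj₂ p
  ... | no _ = coeff-exponents L ps e

  -- An exponent not listed in `f` has coefficient zero, so it suffices to search the finite list
  -- for the largest exponent whose coefficient does not cancel.
  exists-top : ∀ f → (∀ e → coeff f e ≡ 0ℤ) ⊎ ∃[ a ] (coeff f a ≢ 0ℤ × Top f a)
  exists-top f with go (map proj₂ f)
    where
    Z : Exp dim → Set
    Z e = coeff f e ≡ 0ℤ
    go : ∀ es → All Z es ⊎ ∃[ a ] (coeff f a ≢ 0ℤ × All (λ e → a ⊏ e → Z e) es)
    go [] = inj₁ []
    go (x ∷ es) with coeff f x ℤ.≟ 0ℤ | go es
    ... | yes z | inj₁ zs = inj₁ (z ∷ zs)
    ... | yes z | inj₂ (a , nz , zs) = inj₂ (a , nz , (λ _ → z) ∷ zs)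
    ... | no nz | inj₁ zs = inj₂ (x , nz , (λ p → contradiction p (⊏-irrefl x)) ∷ All.map (λ z _ → z) zs)
    ... | no nz | inj₂ (a , nz′ , zs) with ⊏-cmp a x
    ...   | inj₁ p = inj₂ (x , nz , (λ q → contradiction q (⊏-irrefl x)) ∷ All.map (λ h q → h (⊏-trans p q)) zs)
    ...   | inj₂ (inj₁ refl) = inj₂ (a , nz′ , (λ q → contradiction q (⊏-irrefl a)) ∷ zs)
    ...   | inj₂ (inj₂ p) = inj₂ (a , nz′ , (λ q → contradiction (⊏-trans p q) (⊏-irrefl x)) ∷ zs)
  ... | inj₁ zs = inj₁ vanish
    where
    vanish : ∀ e → coeff f e ≡ 0ℤ
    vanish e with coeff-exponents f zs e
    ... | inj₁ z = z
    ... | inj₂ z = z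
  ... | inj₂ (a , nz , zs) = inj₂ (a , nz , top)
    where
    top : Top f a
    top e p with coeff-exponents f zs e
    ... | inj₁ z = z
    ... | inj₂ z = z p

  -- Positivity is part of the invariant because it excludes cancellation in the exchange binomial.
  -- The index records the value of `v` and hides the exponent, since only these values obey a
  -- tropical recursion.
  record Lead (f : Laurent dim) (M : ℤ) : Set where
    constructor lead
    field
      exponent : Exp dim
      positive : 0ℤ ℤ.< coeff f exponent
      top      : Top f exponent
      value    : ⟨ v , exponent ⟩ ≡ M

  lead-bound : ∀ {f M} → Lead f M → ∀ e → Support f e → ⟨ v , e ⟩ ℤ.≤ M
  lead-bound (lead a _ top refl) e nz = ℤₚ.≮⇒≥ (λ p → nz (top e (inj₁ p)))

  lead-cong : ∀ {f g M} → f ≈L g → Lead f M → Lead g M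
  lead-cong f≈g (lead a pos top eq) =
    lead a (subst (0ℤ ℤ.<_) (f≈g a) pos) (λ e p → trans (sym (f≈g e)) (top e p)) eq

  lead-monomial : ∀ a → Lead (monomial a) ⟨ v , a ⟩
  lead-monomial a = lead a
    (subst (0ℤ ℤ.<_) (sym (coeff-here 1ℤ a [])) (ℤ.+<+ (s≤s z≤n)))
    (λ e p → coeff-there 1ℤ {a} {e} [] (λ { refl → ⊏-irrefl a p }))
    refl

  lead-one : Lead oneL 0ℤ
  lead-one = subst (Lead oneL) (⟨⟩-zero v) (lead-monomial _)

  lead-* : ∀ {f g M N} → Lead f M → Lead g N → Lead (f *L g) (M + N)
  lead-* {f} {g} (lead a pa ta refl) (lead b pb tb refl) = lead (a ⊕ b)
    (subst (0ℤ ℤ.<_) (sym (coeff-top-* {f} {g} ta tb)) (positive-* _ _ pa pb))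
    (top-* {f} {g} ta tb)
    (⟨⟩-⊕ v a b)

  lead-^ : ∀ {f M} k → Lead f M → Lead (f ^L k) (ℤ.+ k * M)
  lead-^ {M = M} zero l = lead-one
  lead-^ {f} {M} (suc k) l = subst (Lead (f ^L suc k)) (eq (ℤ.+ k) M) (lead-* {f} l (lead-^ k l))
    where
    eq : ∀ k M → M + k * M ≡ (1ℤ + k) * M
    eq = solve-∀

  lead-+ : ∀ {f g M N} → Lead f M → Lead g N → Lead (f +L g) (M ⊔ N)
  lead-+ {f} {g} (lead a pa ta refl) (lead b pb tb refl) with ⊏-cmp a b
  ... | inj₁ a⊏b = lead b
    (subst (0ℤ ℤ.<_) (sym (trans (coeff-++ f g b) (trans (cong (_+ coeff g b) (ta b a⊏b)) (ℤₚ.+-identityˡ _)))) pb)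
    (λ e p → trans (coeff-++ f g e) (cong₂ _+_ (ta e (⊏-trans a⊏b p)) (tb e p)))
    (sym (ℤₚ.i≤j⇒i⊔j≡j (⊏⇒≤ a⊏b)))
  -- The two leading terms collide here; positivity keeps their sum from vanishing.
  ... | inj₂ (inj₁ refl) = lead a
    (subst (0ℤ ℤ.<_) (sym (coeff-++ f g a)) (ℤₚ.+-mono-< pa pb))
    (λ e p → trans (coeff-++ f g e) (cong₂ _+_ (ta e p) (tb e p)))
    (sym (ℤₚ.⊔-idem _))
  ... | inj₂ (inj₂ b⊏a) = lead a
    (subst (0ℤ ℤ.<_) (sym (trans (coeff-++ f g a) (trans (cong (coeff f a +_) (tb a b⊏a)) (ℤₚ.+-identityʳ _)))) pa)
    (λ e p → trans (coeff-++ f g e) (cong₂ _+_ (ta e p) (tb e (⊏-trans b⊏a p))))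
    (sym (ℤₚ.i≥j⇒i⊔j≡i (⊏⇒≤ b⊏a)))

  -- The leading term of `z` is forced by the equation. `z` is nonzero because `r` is; its leading
  -- exponent `b` satisfies `b ⊕ a ≡ c`, since a smaller sum would make the leading coefficient of
  -- `r` vanish and a larger one would make a product of nonzero integers vanish. The sign follows
  -- by cancelling a positive factor.
  lead-÷ : ∀ {z f r M N} → (z *L f) ≈L r → Lead f M → Lead r N → Lead z (N - M)
  lead-÷ {z} {f} {r} zf≈r (lead a pa ta refl) (lead c pc tc refl) with exists-top z
  ... | inj₁ z≈0 = contradiction pc (ℤₚ.<-irrefl (sym (begin
      coeff r c                               ≡⟨ sym (zf≈r c) ⟩
      coeff (z *L f) c                        ≡⟨ coeff-*L z f c ⟩
      pairing (λ x → coeff f (c ⊖ x)) z       ≡⟨ pairing-zero _ z (λ x → trans (cong (_* coeff f (c ⊖ x)) (z≈0 x)) (ℤₚ.*-zeroˡ (coeff f (c ⊖ x)))) ⟩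
      0ℤ                                      ∎)))
    where open ≡-Reasoning
  ... | inj₂ (b , nz , tb) with ⊏-cmp (b ⊕ a) c
  ...   | inj₁ p = contradiction pc (ℤₚ.<-irrefl (sym (trans (sym (zf≈r c)) (top-* {z} {f} tb ta c p))))
  ...   | inj₂ (inj₂ p) = contradiction (trans (sym (coeff-top-* {z} {f} tb ta)) (trans (zf≈r (b ⊕ a)) (tc (b ⊕ a) p))) ba≢0
    where
    ba≢0 : coeff z b * coeff f a ≢ 0ℤ
    ba≢0 eq with ℤₚ.i*j≡0⇒i≡0∨j≡0 (coeff z b) eq
    ... | inj₁ zb = nz zb
    ... | inj₂ fa = ℤₚ.<-irrefl (sym fa) pa
  ...   | inj₂ (inj₁ refl) = lead b
    (positive-factor _ _ pa (subst (0ℤ ℤ.<_) (trans (sym (zf≈r (b ⊕ a))) (coeff-top-* {z} {f} tb ta)) pc))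
    (tb)
    (sym (trans (cong (_- ⟨ v , a ⟩) (⟨⟩-⊕ v b a)) (eq ⟨ v , b ⟩ ⟨ v , a ⟩)))
    where
    eq : ∀ x y → x + y - y ≡ x
    eq = solve-∀

-- The tropical recursion and the grading

sum-zero : (f : Fin n → ℤ) → (∀ i → f i ≡ 0ℤ) → sum f ≡ 0ℤ
sum-zero {zero} f h = refl
sum-zero {suc n} f h = cong₂ _+_ (h zero) (sum-zero (f ∘ suc) (h ∘ suc))

sum-single : (k : Fin n) (t : Fin n → ℤ) → (∀ i → i ≢ k → t i ≡ 0ℤ) → sum t ≡ t k
sum-single zero t h =
  trans (cong (t zero +_) (sum-zero (t ∘ suc) (λ i → h (suc i) λ ()))) (ℤₚ.+-identityʳ _)
sum-single (suc k) t h =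
  trans (cong₂ _+_ (h zero λ ()) (sum-single k (t ∘ suc) (λ i i≢k → h (suc i) λ { refl → i≢k refl })))
    (ℤₚ.+-identityˡ _)

posℕ-pos : ∀ z → ℤ.+ posℕ z ≡ pos z
posℕ-pos (ℤ.+ _) = refl
posℕ-pos ℤ.-[1+ _ ] = refl

pos-pos : ∀ z → pos z - pos (- z) ≡ z
pos-pos ℤ.+0 = refl
pos-pos ℤ.+[1+ k ] = ℤₚ.+-identityʳ _
pos-pos ℤ.-[1+ k ] = refl

module _ {dim : ℕ} (v : Exp dim) where
  open Leading v

  lead-prod : {f : Fin n → Laurent dim} {M : Fin n → ℤ} → (∀ i → Lead (f i) (M i)) → Lead (prodL f) (sum M)
  lead-prod {n} {f} {M} h = go n id
    where
    -- `allFin n` is `tabulate id`; the recursion has to pass through general tabulating functions.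
    go : ∀ k (g : Fin k → Fin n) →
      Lead (foldr (λ i acc → f i *L acc) oneL (List.tabulate g)) (sum (M ∘ g))
    go zero g = lead-one
    go (suc k) g = lead-* {f (g zero)} (h (g zero)) (go k (g ∘ suc))

-- Entries of mutated matrices and values of the basic functionals.

mutB-row : ∀ k (B : Matrix n) j → mutB k B k j ≡ - B k j
mutB-row k B j rewrite dec-true (k Fin.≟ k) refl = refl

mutB-column : ∀ k (B : Matrix n) i → mutB k B i k ≡ - B i k
mutB-column k B i rewrite dec-true (k Fin.≟ k) refl | ∨-zeroʳ (does (i Fin.≟ k)) = refl

mutB-else : ∀ k (B : Matrix n) {i j} → i ≢ k → j ≢ k →
  mutB k B i j ≡ B i j + pos (B i k) * pos (B k j) - pos (- B i k) * pos (- B k j)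
mutB-else k B {i} {j} i≢k j≢k rewrite dec-false (i Fin.≟ k) i≢k | dec-false (j Fin.≟ k) j≢k = refl

mutC-column : ∀ k (B C : Matrix n) i → mutC k B C i k ≡ - C i k
mutC-column k B C i rewrite dec-true (k Fin.≟ k) refl = refl

mutC-else : ∀ k (B C : Matrix n) i {j} → j ≢ k →
  mutC k B C i j ≡ C i j + pos (C i k) * pos (B k j) - pos (- C i k) * pos (- B k j)
mutC-else k B C i {j} j≢k rewrite dec-false (j Fin.≟ k) j≢k = refl

negate : Exp n → Exp n
negate = Vec.map (-_)

⟨⟩-negate : (v e : Exp n) → ⟨ negate v , e ⟩ ≡ - ⟨ v , e ⟩
⟨⟩-negate [] [] = refl
⟨⟩-negate (x ∷ v) (y ∷ e) = trans (cong (- x * y +_) (⟨⟩-negate v e)) (eq x y ⟨ v , e ⟩)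
  where
  eq : ∀ x y s → - x * y + - s ≡ - (x * y + s)
  eq = solve-∀

lookup-unitE-≡ : (i : Fin n) → lookup (unitE i) i ≡ 1ℤ
lookup-unitE-≡ i = trans (lookup∘tabulate _ i) (cong (if_then 1ℤ else 0ℤ) (dec-true (i Fin.≟ i) refl))

lookup-unitE-≢ : {i j : Fin n} → j ≢ i → lookup (unitE i) j ≡ 0ℤ
lookup-unitE-≢ {i = i} {j} j≢i =
  trans (lookup∘tabulate _ j) (cong (if_then 1ℤ else 0ℤ) (dec-false (j Fin.≟ i) j≢i))

idMatrix-≡ : (i : Fin n) → idMatrix i i ≡ 1ℤ
idMatrix-≡ i = cong (if_then 1ℤ else 0ℤ) (dec-true (i Fin.≟ i) refl)

idMatrix-≢ : {i j : Fin n} → i ≢ j → idMatrix i j ≡ 0ℤ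
idMatrix-≢ {i = i} {j} i≢j = cong (if_then 1ℤ else 0ℤ) (dec-false (i Fin.≟ j) i≢j)

↑ˡ≢↑ʳ : (i j : Fin n) → i ↑ˡ n ≢ n ↑ʳ j
↑ˡ≢↑ʳ {n} i j eq with trans (sym (Finₚ.splitAt-↑ˡ n i n)) (trans (cong (Fin.splitAt n) eq) (Finₚ.splitAt-↑ʳ n n j))
... | ()

module Tropical (n : ℕ) where

  -- The maximum of `v` on one monomial of the exchange binomial: `b` and `c` are column k of the
  -- two blocks of the extended exchange matrix, with sign + for one monomial and - for the other.
  tropicalTerm : Exp (n ℕ.+ n) → (Fin n → ℤ) → (b c : Fin n → ℤ) → ℤ
  tropicalTerm v M b c = sum (λ i → pos (b i) * M i) + sum (λ j → pos (c j) * lookup v (n ↑ʳ j))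

  tropicalMutate : Exp (n ℕ.+ n) → (Fin n → ℤ) → Matrix n → Matrix n → Fin n → ℤ
  tropicalMutate v M B C k =
    tropicalTerm v M (λ i → B i k) (λ j → C j k) ⊔ tropicalTerm v M (λ i → - B i k) (λ j → - C j k) - M k

  module _ (v : Exp (n ℕ.+ n)) where
    open Leading v

    lead-term : {x : Cluster n} {M : Fin n → ℤ} → (∀ i → Lead (x i) (M i)) → (b c : Fin n → ℤ) →
      Lead (prodL (λ i → x i ^L posℕ (b i)) *L prodL (λ i → yVar i ^L posℕ (c i))) (tropicalTerm v M b c)
    lead-term {x} {M} h b c = lead-* {prodL (λ i → x i ^L posℕ (b i))}
      (lead-prod v (λ i → subst (λ k → Lead (x i ^L posℕ (b i)) (k * M i)) (posℕ-pos (b i)) (lead-^ (posℕ (b i)) (h i))))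
      (lead-prod v (λ j → subst (λ k → Lead (yVar j ^L posℕ (c j)) (k * lookup v (n ↑ʳ j))) (posℕ-pos (c j)) (lead-^ (posℕ (c j)) (lead-y j))))
      where
      lead-y : ∀ j → Lead (yVar j) (lookup v (n ↑ʳ j))
      lead-y j = subst (Lead (yVar j)) (⟨⟩-unitE v (n ↑ʳ j)) (lead-monomial _)

    lead-mutate : {x : Cluster n} {M : Fin n → ℤ} {B C : Matrix n} → (∀ i → Lead (x i) (M i)) →
      ∀ k z → (z *L x k) ≈L exchRHS x B C k → Lead z (tropicalMutate v M B C k)
    lead-mutate {x} {M} {B} {C} h k z eq = lead-÷ {z} {x k} eq (h k)
      (lead-+ {prodL (λ i → x i ^L posℕ (B i k)) *L prodL (λ i → yVar i ^L posℕ (C i k))}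
        (lead-term h (λ i → B i k) (λ j → C j k)) (lead-term h (λ i → - B i k) (λ j → - C j k)))

    lead-wVar : ∀ i → Lead (wVar i) (lookup v (i ↑ˡ n))
    lead-wVar i = subst (Lead (wVar i)) (⟨⟩-unitE v (i ↑ˡ n)) (lead-monomial _)

  update-elim : {x : Cluster n} {k : Fin n} {z : Laurent (n ℕ.+ n)} (P : Fin n → Laurent (n ℕ.+ n) → Set) →
    P k z → (∀ i → i ≢ k → P i (x i)) → ∀ i → P i (update x k z i)
  update-elim {k = k} P pz px i with i Fin.≟ k
  ... | yes refl = pz
  ... | no i≢k = px i i≢k

  yE : Fin n → Exp (n ℕ.+ n)
  yE j = unitE (n ↑ʳ j)

  sum-yE : (j : Fin n) (c : Fin n → ℤ) → sum (λ j′ → c j′ * lookup (yE j) (n ↑ʳ j′)) ≡ c j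
  sum-yE j c = trans
    (sum-single j _ (λ i i≢j → trans (cong (c i *_) (lookup-unitE-≢ (i≢j ∘ Finₚ.↑ʳ-injective n i j))) (ℤₚ.*-zeroʳ (c i))))
    (trans (cong (c j *_) (lookup-unitE-≡ (n ↑ʳ j))) (ℤₚ.*-identityʳ (c j)))

  sum-negate : (v : Exp (n ℕ.+ n)) (c : Fin n → ℤ) →
    sum (λ j → c j * lookup (negate v) (n ↑ʳ j)) ≡ - sum (λ j → c j * lookup v (n ↑ʳ j))
  sum-negate v c = trans
    (sum-cong-≗ (λ j → trans (cong (c j *_) (lookup-map (n ↑ʳ j) (-_) v)) (eq (c j) (lookup v (n ↑ʳ j)))))
    (trans (sym (*-distribˡ-sum ℤ.-1ℤ (λ j → c j * lookup v (n ↑ʳ j)))) (ℤₚ.-1*i≡-i _))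
    where
    eq : ∀ x y → x * - y ≡ ℤ.-1ℤ * (x * y)
    eq = solve-∀

  tropicalTerm-negate : ∀ (v : Exp (n ℕ.+ n)) M b c →
    tropicalTerm (negate v) (λ i → - M i) b c ≡ - tropicalTerm v M b c
  tropicalTerm-negate v M b c = trans
    (cong₂ _+_
      (trans (sum-cong-≗ (λ i → eq (pos (b i)) (M i)))
        (trans (sym (*-distribˡ-sum ℤ.-1ℤ (λ i → pos (b i) * M i))) (ℤₚ.-1*i≡-i (sum (λ i → pos (b i) * M i)))))
      (sum-negate v (pos ∘ c)))
    (sym (ℤₚ.neg-distrib-+ (sum (λ i → pos (b i) * M i)) (sum (λ j → pos (c j) * lookup v (n ↑ʳ j)))))
    where
    eq : ∀ x y → x * - y ≡ ℤ.-1ℤ * (x * y)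
    eq = solve-∀

  -- In the language of F-polynomials: they are polynomials that no yⱼ divides.
  lead-y-lower : {B₀ : Matrix n} {x : Cluster n} {B C : Matrix n} → Reachable B₀ x B C →
    ∀ j i → Leading.Lead (negate (yE j)) (x i) 0ℤ
  lead-y-lower initial j i = subst (Leading.Lead _ (wVar i))
    (trans (lookup-map (i ↑ˡ n) (-_) (yE j)) (cong (-_) (lookup-unitE-≢ (↑ˡ≢↑ʳ i j))))
    (lead-wVar (negate (yE j)) i)
  lead-y-lower (mutate {x} {B} {C} r k z eq) j = update-elim {x} {k} {z} (λ _ f → Leading.Lead (negate (yE j)) f 0ℤ)
    (subst (Leading.Lead _ z) value (lead-mutate (negate (yE j)) {x} {λ _ → 0ℤ} {B} {C} (lead-y-lower r j) k z eq))
    (λ i _ → lead-y-lower r j i)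
    where
    term : ∀ b (c : Fin n → ℤ) → tropicalTerm (negate (yE j)) (λ _ → 0ℤ) b c ≡ - pos (c j)
    term b c = trans
      (cong₂ _+_ (sum-zero (λ i → pos (b i) * 0ℤ) (λ i → ℤₚ.*-zeroʳ (pos (b i)))) (trans (sum-negate (yE j) (pos ∘ c)) (cong (-_) (sum-yE j (pos ∘ c)))))
      (ℤₚ.+-identityˡ _)
    -- One of pos c and pos (- c) always vanishes.
    min-zero : ∀ c → (- pos c) ⊔ (- pos (- c)) - 0ℤ ≡ 0ℤ
    min-zero ℤ.+0 = refl
    min-zero ℤ.+[1+ _ ] = refl
    min-zero ℤ.-[1+ _ ] = refl
    value : tropicalMutate (negate (yE j)) (λ _ → 0ℤ) B C k ≡ 0ℤ
    value = trans (cong₂ (λ s t → s ⊔ t - 0ℤ) (term (λ i → B i k) (λ j′ → C j′ k)) (term (λ i → - B i k) (λ j′ → - C j′ k))) (min-zero (C j k))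

-- The g-vector grading.

module Grading {n : ℕ} (B₀ : Matrix n) (r : Fin n) where

  open Tropical n

  -- Coordinate `r` of the g-vector grading: wᵢ has degree the i-th unit vector and yⱼ has degree
  -- minus column j of `B₀`, which makes yⱼ ∏ wᵢ^(B₀ᵢⱼ) homogeneous of degree 0.
  gradE : Exp (n ℕ.+ n)
  gradE = tabulate (idMatrix r) Vec.++ tabulate (λ j → - B₀ r j)

  -- The degree of the quotient of the two monomials in the exchange binomial at `k`; it vanishes
  -- exactly when they have equal degree.
  balance : Matrix n → Matrix n → (Fin n → ℤ) → Fin n → ℤ
  balance B C g k = sum (λ i → B i k * g i) + sum (λ j → C j k * lookup gradE (n ↑ʳ j))

  -- Leading values `g i` and `- g i` for opposite functionals say that the maximum and the minimum
  -- agree, so `x i` is homogeneous of degree `g i`. The balance is carried along to keep the next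
  -- exchange homogeneous.
  Graded : Cluster n → Matrix n → Matrix n → Set
  Graded x B C = ∃[ g ] ((∀ i → Leading.Lead gradE (x i) (g i))
    × (∀ i → Leading.Lead (negate gradE) (x i) (- g i)) × (∀ k → balance B C g k ≡ 0ℤ))

  lookup-gradE-w : ∀ i → lookup gradE (i ↑ˡ n) ≡ idMatrix r i
  lookup-gradE-w i = trans (lookup-++ˡ (tabulate (idMatrix r)) _ i) (lookup∘tabulate _ i)

  lookup-gradE-y : ∀ j → lookup gradE (n ↑ʳ j) ≡ - B₀ r j
  lookup-gradE-y j = trans (lookup-++ʳ (tabulate (idMatrix r)) _ j) (lookup∘tabulate _ j)

  graded-initial : Graded wVar B₀ idMatrix
  graded-initial = idMatrix r
    , (λ i → subst (Leading.Lead gradE (wVar i)) (lookup-gradE-w i) (lead-wVar gradE i))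
    , (λ i → subst (Leading.Lead _ (wVar i))
        (trans (lookup-map (i ↑ˡ n) (-_) gradE) (cong (-_) (lookup-gradE-w i))) (lead-wVar (negate gradE) i))
    , λ k → trans (cong₂ _+_ (w-part k) (y-part k)) (ℤₚ.+-inverseʳ (B₀ r k))
    where
    w-part : ∀ k → sum (λ i → B₀ i k * idMatrix r i) ≡ B₀ r k
    w-part k = trans
      (sum-single r _ (λ i i≢r → trans (cong (B₀ i k *_) (idMatrix-≢ (i≢r ∘ sym))) (ℤₚ.*-zeroʳ (B₀ i k))))
      (trans (cong (B₀ r k *_) (idMatrix-≡ r)) (ℤₚ.*-identityʳ _))
    y-part : ∀ k → sum (λ j → idMatrix j k * lookup gradE (n ↑ʳ j)) ≡ - B₀ r k
    y-part k = trans
      (sum-single k _ (λ j j≢k → trans (cong (_* lookup gradE (n ↑ʳ j)) (idMatrix-≢ j≢k)) (ℤₚ.*-zeroˡ (lookup gradE (n ↑ʳ j)))))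
      (trans (cong₂ _*_ (idMatrix-≡ k) (lookup-gradE-y k)) (ℤₚ.*-identityˡ _))

  -- The shape of a weighted column sum after matrix mutation: the old column, the two mutation
  -- terms, and a slot `d` for what happens in row k.
  sum-linear : ∀ (p q : ℤ) (a b c d : Fin n → ℤ) →
    sum (λ i → a i + p * b i - q * c i + d i) ≡ sum a + p * sum b - q * sum c + sum d
  sum-linear p q a b c d = begin
    sum (λ i → a i + p * b i - q * c i + d i)
      ≡⟨ sum-cong-≗ (λ i → cong (λ t → a i + p * b i + t + d i) (ℤₚ.neg-distribˡ-* q (c i))) ⟩
    sum (λ i → a i + p * b i + - q * c i + d i)
      ≡⟨ ∑-distrib-+ (λ i → a i + p * b i + - q * c i) d ⟩
    sum (λ i → a i + p * b i + - q * c i) + sum d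
      ≡⟨ cong (_+ sum d) (∑-distrib-+ (λ i → a i + p * b i) (λ i → - q * c i)) ⟩
    sum (λ i → a i + p * b i) + sum (λ i → - q * c i) + sum d
      ≡⟨ cong₂ (λ s t → s + t + sum d) (∑-distrib-+ a (λ i → p * b i)) (sym (*-distribˡ-sum (- q) c)) ⟩
    sum a + sum (λ i → p * b i) + - q * sum c + sum d
      ≡⟨ cong₂ (λ s t → sum a + s + t + sum d) (sym (*-distribˡ-sum p b)) (sym (ℤₚ.neg-distribˡ-* q (sum c))) ⟩
    sum a + p * sum b - q * sum c + sum d ∎
    where open ≡-Reasoning

  graded-mutate : ∀ {x B C} → Graded x B C → ∀ k → B k k ≡ 0ℤ → ∀ z → (z *L x k) ≈L exchRHS x B C k →
    Graded (update x k z) (mutB k B) (mutC k B C)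
  graded-mutate {x} {B} {C} (g , up , down , bal) k Bkk z eq = g′ , up′ , down′ , bal′
    where
    h : Fin n → ℤ
    h j = lookup gradE (n ↑ʳ j)
    P N : ℤ
    P = tropicalTerm gradE g (λ i → B i k) (λ j → C j k)
    N = tropicalTerm gradE g (λ i → - B i k) (λ j → - C j k)
    g′ : Fin n → ℤ
    g′ i = if does (i Fin.≟ k) then P - g k else g i
    g′-k : g′ k ≡ P - g k
    g′-k rewrite dec-true (k Fin.≟ k) refl = refl
    g′-≢ : ∀ {i} → i ≢ k → g′ i ≡ g i
    g′-≢ {i} i≢k rewrite dec-false (i Fin.≟ k) i≢k = refl
    -- Termwise `pos b - pos (- b)` is `b`, so the two degrees differ by the balance at `k`.
    P≡N : P ≡ N
    P≡N = ℤₚ.i-j≡0⇒i≡j P N (trans diff (bal k))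
      where
      part : ∀ (b f : Fin n → ℤ) → sum (λ i → b i * f i) ≡ sum (λ i → pos (b i) * f i) - sum (λ i → pos (- b i) * f i)
      part b f = trans (sum-cong-≗ (λ i → trans (cong (_* f i) (sym (pos-pos (b i)))) (e (pos (b i)) (pos (- b i)) (f i))))
        (trans (sum-linear 0ℤ 1ℤ (λ i → pos (b i) * f i) (λ _ → 0ℤ) (λ i → pos (- b i) * f i) (λ _ → 0ℤ))
          (trans (cong (_+_ (sum (λ i → pos (b i) * f i) + 0ℤ * sum {n} (λ _ → 0ℤ) - 1ℤ * sum (λ i → pos (- b i) * f i))) (sum-zero {n} (λ _ → 0ℤ) (λ _ → refl))) (e′ (sum (λ i → pos (b i) * f i)) (sum {n} (λ _ → 0ℤ)) (sum (λ i → pos (- b i) * f i)))))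
        where
        e : ∀ x y z → (x - y) * z ≡ x * z + 0ℤ * 0ℤ - 1ℤ * (y * z) + 0ℤ
        e = solve-∀
        e′ : ∀ x z y → x + 0ℤ * z - 1ℤ * y + 0ℤ ≡ x - y
        e′ = solve-∀
      e : ∀ a b c d → a + b - (c + d) ≡ (a - c) + (b - d)
      e = solve-∀
      diff : P - N ≡ balance B C g k
      diff = trans (e (sum (λ i → pos (B i k) * g i)) _ (sum (λ i → pos (- B i k) * g i)) _)
        (sym (cong₂ _+_ (part (λ i → B i k) g) (part (λ j → C j k) h)))
    up′ : ∀ i → Leading.Lead gradE (update x k z i) (g′ i)
    up′ = update-elim (λ i f → Leading.Lead gradE f (g′ i))
      (subst (Leading.Lead gradE z) (trans (cong (_- g k) max) (sym g′-k)) (lead-mutate gradE {x} {g} {B} {C} up k z eq))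
      (λ i i≢k → subst (Leading.Lead gradE (x i)) (sym (g′-≢ i≢k)) (up i))
      where
      max : P ⊔ N ≡ P
      max = trans (cong (P ⊔_) (sym P≡N)) (ℤₚ.⊔-idem P)
    down′ : ∀ i → Leading.Lead (negate gradE) (update x k z i) (- g′ i)
    down′ = update-elim (λ i f → Leading.Lead (negate gradE) f (- g′ i))
      (subst (Leading.Lead (negate gradE) z) (trans (cong (_- - g k) max) (trans (e P (g k)) (cong (-_) (sym g′-k))))
        (lead-mutate (negate gradE) {x} {λ i → - g i} {B} {C} down k z eq))
      (λ i i≢k → subst (Leading.Lead (negate gradE) (x i)) (cong (-_) (sym (g′-≢ i≢k))) (down i))
      where
      max : tropicalTerm (negate gradE) (λ i → - g i) (λ i → B i k) (λ j → C j k)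
          ⊔ tropicalTerm (negate gradE) (λ i → - g i) (λ i → - B i k) (λ j → - C j k) ≡ - P
      max = trans (cong₂ _⊔_ (tropicalTerm-negate gradE g (λ i → B i k) (λ j → C j k))
        (trans (tropicalTerm-negate gradE g (λ i → - B i k) (λ j → - C j k)) (cong (-_) (sym P≡N)))) (ℤₚ.⊔-idem (- P))
      e : ∀ p q → - p - - q ≡ - (p - q)
      e = solve-∀
    bal-k : balance (mutB k B) (mutC k B C) g′ k ≡ 0ℤ
    bal-≢ : ∀ j → j ≢ k → balance (mutB k B) (mutC k B C) g′ j ≡ 0ℤ
    bal′ : ∀ j → balance (mutB k B) (mutC k B C) g′ j ≡ 0ℤ
    bal′ j = by-cases (j Fin.≟ k)
      where
      by-cases : Dec (j ≡ k) → balance (mutB k B) (mutC k B C) g′ j ≡ 0ℤ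
      by-cases (yes refl) = bal-k
      by-cases (no j≢k) = bal-≢ j j≢k
    bal-k = begin
      balance (mutB k B) (mutC k B C) g′ k
        ≡⟨ cong₂ _+_ (trans (sum-cong-≗ w-term) (sym (*-distribˡ-sum ℤ.-1ℤ (λ i → B i k * g i))))
             (trans (sum-cong-≗ y-term) (sym (*-distribˡ-sum ℤ.-1ℤ (λ i → C i k * h i)))) ⟩
      ℤ.-1ℤ * sum (λ i → B i k * g i) + ℤ.-1ℤ * sum (λ i → C i k * h i)
        ≡⟨ sym (ℤₚ.*-distribˡ-+ ℤ.-1ℤ (sum (λ i → B i k * g i)) (sum (λ i → C i k * h i))) ⟩
      ℤ.-1ℤ * balance B C g k
        ≡⟨ cong (ℤ.-1ℤ *_) (bal k) ⟩
      0ℤ ∎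
      where
      open ≡-Reasoning
      e : ∀ x y → - x * y ≡ ℤ.-1ℤ * (x * y)
      e = solve-∀
      w-term : ∀ i → mutB k B i k * g′ i ≡ ℤ.-1ℤ * (B i k * g i)
      w-term i with i Fin.≟ k
      ... | yes refl rewrite Bkk = refl
      ... | no _ rewrite dec-true (k Fin.≟ k) refl = e (B i k) (g i)
      y-term : ∀ i → mutC k B C i k * h i ≡ ℤ.-1ℤ * (C i k * h i)
      y-term i = trans (cong (_* h i) (mutC-column k B C i)) (e (C i k) (h i))
    bal-≢ j j≢k = begin
      balance (mutB k B) (mutC k B C) g′ j
        ≡⟨ cong₂ _+_
             (trans (sum-cong-≗ w-term) (sum-linear p q (λ i → B i j * g i) (λ i → pos (B i k) * g i) (λ i → pos (- B i k) * g i) δ))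
             (trans (sum-cong-≗ y-term) (sum-linear p q (λ i → C i j * h i) (λ i → pos (C i k) * h i) (λ i → pos (- C i k) * h i) (λ _ → 0ℤ))) ⟩
      _
        ≡⟨ regroup (sum (λ i → B i j * g i)) (sum (λ i → C i j * h i)) (sum (λ i → pos (B i k) * g i))
             (sum (λ i → pos (C i k) * h i)) (sum (λ i → pos (- B i k) * g i)) (sum (λ i → pos (- C i k) * h i))
             p q (sum δ) (sum {n} (λ _ → 0ℤ)) ⟩
      balance B C g j + p * P - q * N + sum δ + sum {n} (λ _ → 0ℤ)
        ≡⟨ cong₂ (λ s t → balance B C g j + p * P - q * s + t + sum {n} (λ _ → 0ℤ)) (sym P≡N) sum-δ ⟩
      balance B C g j + p * P - q * P + - B k j * P + sum {n} (λ _ → 0ℤ)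
        ≡⟨ cong₂ (λ s t → s + p * P - q * P + - B k j * P + t) (bal j) (sum-zero {n} (λ _ → 0ℤ) (λ _ → refl)) ⟩
      0ℤ + p * P - q * P + - B k j * P + 0ℤ
        ≡⟨ cong (λ b → 0ℤ + p * P - q * P + - b * P + 0ℤ) (sym (pos-pos (B k j))) ⟩
      0ℤ + p * P - q * P + - (p - q) * P + 0ℤ
        ≡⟨ cancel p q P ⟩
      0ℤ ∎
      where
      open ≡-Reasoning
      p q : ℤ
      p = pos (B k j)
      q = pos (- B k j)
      -- Row k changes sign while its degree becomes `P - g k`. Compared with the generic formula
      -- this leaves the surplus `- B k j * P`, which cancels the contribution `(p - q) * P` of the
      -- other rows.
      δ : Fin n → ℤ
      δ i = if does (i Fin.≟ k) then - B k j * P else 0ℤ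
      sum-δ : sum δ ≡ - B k j * P
      sum-δ = trans (sum-single k δ (λ i i≢k → cong (if_then - B k j * P else 0ℤ) (dec-false (i Fin.≟ k) i≢k)))
        (cong (if_then - B k j * P else 0ℤ) (dec-true (k Fin.≟ k) refl))
      cancel : ∀ p q P → 0ℤ + p * P - q * P + - (p - q) * P + 0ℤ ≡ 0ℤ
      cancel = solve-∀
      regroup : ∀ a a′ b b′ c c′ p q d d′ →
        (a + p * b - q * c + d) + (a′ + p * b′ - q * c′ + d′) ≡ (a + a′) + p * (b + b′) - q * (c + c′) + d + d′
      regroup = solve-∀
      expand : ∀ b x p y q g → (b + x * p - y * q) * g ≡ b * g + p * (x * g) - q * (y * g) + 0ℤ
      expand = solve-∀
      expand-k : ∀ b P g p q → - b * (P - g) ≡ b * g + p * (0ℤ * g) - q * (0ℤ * g) + - b * P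
      expand-k = solve-∀
      w-term : ∀ i → mutB k B i j * g′ i ≡ B i j * g i + p * (pos (B i k) * g i) - q * (pos (- B i k) * g i) + δ i
      w-term i with i Fin.≟ k
      ... | yes refl rewrite Bkk = expand-k (B k j) P (g k) p q
      ... | no i≢k rewrite dec-false (j Fin.≟ k) j≢k = expand (B i j) (pos (B i k)) p (pos (- B i k)) q (g i)
      y-term : ∀ i → mutC k B C i j * h i ≡ C i j * h i + p * (pos (C i k) * h i) - q * (pos (- C i k) * h i) + 0ℤ
      y-term i = trans (cong (_* h i) (mutC-else k B C i j≢k)) (expand (C i j) (pos (C i k)) p (pos (- C i k)) q (h i))

-- Newton polytopes

ι : ℤ → ℚ
ι z = z ℚ./ 1

-- Division in ℚ normalises by a gcd that does not compute on a variable `z`. Arithmetic with `ι`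
-- therefore passes through unnormalised fractions, where the denominator is literally 1.
toℚᵘ-ι : ∀ z → ℚ.toℚᵘ (ι z) ℚᵘ.≃ ℚᵘ.mkℚᵘ z 0
toℚᵘ-ι z = ℚₚ.toℚᵘ-fromℚᵘ (ℚᵘ.mkℚᵘ z 0)

ι-+ : ∀ x y → ι (x + y) ≡ ι x ℚ.+ ι y
ι-+ x y = ℚₚ.toℚᵘ-injective (ℚᵘₚ.≃-trans (toℚᵘ-ι (x + y))
  (ℚᵘₚ.≃-sym (ℚᵘₚ.≃-trans (ℚₚ.toℚᵘ-homo-+ (ι x) (ι y))
    (ℚᵘₚ.≃-trans (ℚᵘₚ.+-cong (toℚᵘ-ι x) (toℚᵘ-ι y)) (ℚᵘ.*≡* (eq x y))))))
  where
  eq : ∀ x y → (x * 1ℤ + y * 1ℤ) * 1ℤ ≡ (x + y) * 1ℤ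
  eq = solve-∀

ι-* : ∀ x y → ι (x * y) ≡ ι x ℚ.* ι y
ι-* x y = ℚₚ.toℚᵘ-injective (ℚᵘₚ.≃-trans (toℚᵘ-ι (x * y))
  (ℚᵘₚ.≃-sym (ℚᵘₚ.≃-trans (ℚₚ.toℚᵘ-homo-* (ι x) (ι y))
    (ℚᵘₚ.≃-trans (ℚᵘₚ.*-cong (toℚᵘ-ι x) (toℚᵘ-ι y)) (ℚᵘ.*≡* refl)))))

ι-mono-≤ : ∀ {x y} → x ℤ.≤ y → ι x ℚ.≤ ι y
ι-mono-≤ {x} {y} p = ℚₚ.toℚᵘ-cancel-≤
  (ℚᵘₚ.≤-respˡ-≃ (ℚᵘₚ.≃-sym (toℚᵘ-ι x)) (ℚᵘₚ.≤-respʳ-≃ (ℚᵘₚ.≃-sym (toℚᵘ-ι y))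
    (ℚᵘ.*≤* (ℤₚ.*-monoʳ-≤-nonNeg 1ℤ p))))

ι-mono-< : ∀ {x y} → x ℤ.< y → ι x ℚ.< ι y
ι-mono-< {x} {y} p = ℚₚ.toℚᵘ-cancel-<
  (ℚᵘₚ.<-respˡ-≃ (ℚᵘₚ.≃-sym (toℚᵘ-ι x)) (ℚᵘₚ.<-respʳ-≃ (ℚᵘₚ.≃-sym (toℚᵘ-ι y))
    (ℚᵘ.*<* (ℤₚ.*-monoʳ-<-pos 1ℤ p))))

ι-cancel-≤ : ∀ {x y} → ι x ℚ.≤ ι y → x ℤ.≤ y
ι-cancel-≤ p = ℤₚ.≮⇒≥ (λ q → ℚₚ.<-irrefl refl (ℚₚ.<-≤-trans (ι-mono-< q) p))

dot-ι : (v e : Exp dim) → dot (toℚv v) (toℚv e) ≡ ι ⟨ v , e ⟩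
dot-ι [] [] = refl
dot-ι (x ∷ v) (y ∷ e) = trans (cong₂ ℚ._+_ (sym (ι-* x y)) (dot-ι v e)) (sym (ι-+ (x * y) ⟨ v , e ⟩))

dot-zero : (c : Vec ℚ dim) → dot c (replicate dim 0ℚ) ≡ 0ℚ
dot-zero [] = refl
dot-zero (x ∷ c) = cong₂ ℚ._+_ (ℚₚ.*-zeroʳ x) (dot-zero c)

dot-+ : (c u v : Vec ℚ dim) → dot c (zipWith ℚ._+_ u v) ≡ dot c u ℚ.+ dot c v
dot-+ [] [] [] = refl
dot-+ (x ∷ c) (y ∷ u) (z ∷ v) = trans
  (cong₂ ℚ._+_ (ℚₚ.*-distribˡ-+ x y z) (dot-+ c u v))
  (eq (x ℚ.* y) (x ℚ.* z) (dot c u) (dot c v))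
  where
  open +-*-Solver
  eq : ∀ a b c d → (a ℚ.+ b) ℚ.+ (c ℚ.+ d) ≡ (a ℚ.+ c) ℚ.+ (b ℚ.+ d)
  eq = solve 4 (λ a b c d → (a :+ b) :+ (c :+ d) := (a :+ c) :+ (b :+ d)) refl

dot-scale : ∀ w (c u : Vec ℚ dim) → dot c (Vec.map (w ℚ.*_) u) ≡ w ℚ.* dot c u
dot-scale w [] [] = sym (ℚₚ.*-zeroʳ w)
dot-scale w (x ∷ c) (y ∷ u) = trans
  (cong₂ ℚ._+_ (eq x w y) (dot-scale w c u)) (sym (ℚₚ.*-distribˡ-+ w (x ℚ.* y) (dot c u)))
  where
  eq : ∀ x w y → x ℚ.* (w ℚ.* y) ≡ w ℚ.* (x ℚ.* y)
  eq x w y = trans (sym (ℚₚ.*-assoc x w y)) (trans (cong (ℚ._* y) (ℚₚ.*-comm x w)) (ℚₚ.*-assoc w x y))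

scale-+ : ∀ w s (u : Vec ℚ dim) →
  zipWith ℚ._+_ (Vec.map (w ℚ.*_) u) (Vec.map (s ℚ.*_) u) ≡ Vec.map ((w ℚ.+ s) ℚ.*_) u
scale-+ w s [] = refl
scale-+ w s (x ∷ u) = cong₂ _∷_ (sym (ℚₚ.*-distribʳ-+ x w s)) (scale-+ w s u)

scale-zero : (u v : Vec ℚ dim) → zipWith ℚ._+_ (Vec.map (0ℚ ℚ.*_) u) v ≡ v
scale-zero [] [] = refl
scale-zero (x ∷ u) (y ∷ v) =
  cong₂ _∷_ (trans (cong (ℚ._+ y) (ℚₚ.*-zeroˡ x)) (ℚₚ.+-identityˡ y)) (scale-zero u v)

scale-one : (u : Vec ℚ dim) → Vec.map (1ℚ ℚ.*_) u ≡ u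
scale-one u = trans (map-cong ℚₚ.*-identityˡ u) (map-id u)

scale-none : (u : Vec ℚ dim) → replicate dim 0ℚ ≡ Vec.map (0ℚ ℚ.*_) u
scale-none [] = refl
scale-none (x ∷ u) = cong₂ _∷_ (sym (ℚₚ.*-zeroˡ x)) (scale-none u)

Weights : Laurent dim → List (ℚ × Exp dim) → Set
Weights f = All (λ p → Support f (proj₂ p) × (0ℚ ℚ.≤ proj₁ p))

dot-∷ : ∀ (c : Exp dim) w e ws → dot (toℚv c) (combo ((w , e) ∷ ws)) ≡ w ℚ.* ι ⟨ c , e ⟩ ℚ.+ dot (toℚv c) (combo ws)
dot-∷ c w e ws = trans (dot-+ (toℚv c) (Vec.map (w ℚ.*_) (toℚv e)) (combo ws))
  (cong (ℚ._+ dot (toℚv c) (combo ws)) (trans (dot-scale w (toℚv c) (toℚv e)) (cong (w ℚ.*_) (dot-ι c e))))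

-- The weights are not assumed to sum to 1, so that the tail of a combination is again an instance;
-- this accounts for the factor `sumℚ ws`.
combo-bound : ∀ (f : Laurent dim) (v : Exp dim) K → (∀ e → Support f e → ⟨ v , e ⟩ ℤ.≤ K) →
  ∀ ws → Weights f ws → dot (toℚv v) (combo ws) ℚ.≤ sumℚ ws ℚ.* ι K
combo-bound f v K h [] [] = ℚₚ.≤-reflexive (trans (dot-zero (toℚv v)) (sym (ℚₚ.*-zeroˡ (ι K))))
combo-bound f v K h ((w , e) ∷ ws) ((se , 0≤w) ∷ ps) = begin
  dot (toℚv v) (combo ((w , e) ∷ ws))              ≡⟨ dot-∷ v w e ws ⟩
  w ℚ.* ι ⟨ v , e ⟩ ℚ.+ dot (toℚv v) (combo ws)    ≤⟨ ℚₚ.+-mono-≤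
    (ℚₚ.*-monoˡ-≤-nonNeg w {{ℚ.nonNegative 0≤w}} (ι-mono-≤ (h e se))) (combo-bound f v K h ws ps) ⟩
  w ℚ.* ι K ℚ.+ sumℚ ws ℚ.* ι K                    ≡⟨ sym (ℚₚ.*-distribʳ-+ (ι K) w (sumℚ ws)) ⟩
  (w ℚ.+ sumℚ ws) ℚ.* ι K                          ∎
  where open ℚₚ.≤-Reasoning

newton-bound : ∀ (f : Laurent dim) (v : Exp dim) K → (∀ e → Support f e → ⟨ v , e ⟩ ℤ.≤ K) →
  ∀ p → InNewton f (toℚv p) → ⟨ v , p ⟩ ℤ.≤ K
newton-bound f v K h p (ws , ps , s≡1 , c≡p) = ι-cancel-≤ (begin
  ι ⟨ v , p ⟩                ≡⟨ sym (dot-ι v p) ⟩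
  dot (toℚv v) (toℚv p)      ≡⟨ cong (dot (toℚv v)) (sym c≡p) ⟩
  dot (toℚv v) (combo ws)    ≤⟨ combo-bound f v K h ws ps ⟩
  sumℚ ws ℚ.* ι K            ≡⟨ trans (cong (ℚ._* ι K) s≡1) (ℚₚ.*-identityˡ (ι K)) ⟩
  ι K                        ∎)
  where open ℚₚ.≤-Reasoning

-- One positive weight on a support point other than `p` makes the inequality strict for good.
-- Otherwise all positive weight sits at `p`, and then either there is none or it certifies that `p`
-- lies in the support. Membership of `p` in the support is thus an outcome rather than an
-- assumption, as saturation requires.
combo-dichotomy : ∀ (f : Laurent dim) (c p : Exp dim) → (∀ e → Support f e → e ≡ p ⊎ ⟨ c , e ⟩ ℤ.< ⟨ c , p ⟩) →
  ∀ ws → Weights f ws →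
  dot (toℚv c) (combo ws) ℚ.< sumℚ ws ℚ.* ι ⟨ c , p ⟩
  ⊎ (combo ws ≡ Vec.map (sumℚ ws ℚ.*_) (toℚv p) × (sumℚ ws ≡ 0ℚ ⊎ Support f p))
combo-dichotomy f c p h [] [] = inj₂ (scale-none (toℚv p) , inj₁ refl)
combo-dichotomy f c p h ((w , e) ∷ ws) ((se , 0≤w) ∷ ps) = cases (ℚₚ.<-cmp 0ℚ w) (h e se) (combo-dichotomy f c p h ws ps)
  where
  D K : ℚ
  D = dot (toℚv c) (combo ws)
  K = ι ⟨ c , p ⟩
  IH : Set
  IH = dot (toℚv c) (combo ws) ℚ.< sumℚ ws ℚ.* K
    ⊎ (combo ws ≡ Vec.map (sumℚ ws ℚ.*_) (toℚv p) × (sumℚ ws ≡ 0ℚ ⊎ Support f p))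
  bound : ∀ e → Support f e → ⟨ c , e ⟩ ℤ.≤ ⟨ c , p ⟩
  bound e se with h e se
  ... | inj₁ refl = ℤₚ.≤-refl
  ... | inj₂ lt = ℤₚ.<⇒≤ lt
  strict : w ℚ.* ι ⟨ c , e ⟩ ℚ.+ dot (toℚv c) (combo ws) ℚ.< w ℚ.* K ℚ.+ sumℚ ws ℚ.* K →
    dot (toℚv c) (combo ((w , e) ∷ ws)) ℚ.< (w ℚ.+ sumℚ ws) ℚ.* K
  strict = subst₂ ℚ._<_ (sym (dot-∷ c w e ws)) (sym (ℚₚ.*-distribʳ-+ K w (sumℚ ws)))
  Goal : Set
  Goal = dot (toℚv c) (combo ((w , e) ∷ ws)) ℚ.< (w ℚ.+ sumℚ ws) ℚ.* K
    ⊎ (combo ((w , e) ∷ ws) ≡ Vec.map ((w ℚ.+ sumℚ ws) ℚ.*_) (toℚv p) × (w ℚ.+ sumℚ ws ≡ 0ℚ ⊎ Support f p))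
  cases : Tri (0ℚ ℚ.< w) (0ℚ ≡ w) (w ℚ.< 0ℚ) → e ≡ p ⊎ ⟨ c , e ⟩ ℤ.< ⟨ c , p ⟩ → IH → Goal
  cases (tri> _ _ w<0) _ _ = contradiction (ℚₚ.<-≤-trans w<0 0≤w) (ℚₚ.<-irrefl refl)
  cases (tri≈ _ 0≡w _) _ (inj₁ lt) = inj₁ (strict (subst (λ w → w ℚ.* ι ⟨ c , e ⟩ ℚ.+ D ℚ.< w ℚ.* K ℚ.+ sumℚ ws ℚ.* K) 0≡w
    (subst₂ (λ s t → s ℚ.+ D ℚ.< t ℚ.+ sumℚ ws ℚ.* K) (sym (ℚₚ.*-zeroˡ (ι ⟨ c , e ⟩))) (sym (ℚₚ.*-zeroˡ K)) (ℚₚ.+-monoʳ-< 0ℚ lt))))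
  cases (tri≈ _ 0≡w _) _ (inj₂ (eq , z)) = inj₂ (subst
    (λ w → zipWith ℚ._+_ (Vec.map (w ℚ.*_) (toℚv e)) (combo ws) ≡ Vec.map ((w ℚ.+ sumℚ ws) ℚ.*_) (toℚv p)
      × (w ℚ.+ sumℚ ws ≡ 0ℚ ⊎ Support f p)) 0≡w
    ( trans (scale-zero (toℚv e) (combo ws)) (subst (λ s → combo ws ≡ Vec.map (s ℚ.*_) (toℚv p)) (sym (ℚₚ.+-identityˡ (sumℚ ws))) eq)
    , [ (λ s≡0 → inj₁ (trans (ℚₚ.+-identityˡ (sumℚ ws)) s≡0)) , inj₂ ] z))
  cases (tri< 0<w _ _) (inj₁ refl) (inj₁ lt) = inj₁ (strict (ℚₚ.+-monoʳ-< (w ℚ.* K) lt))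
  cases (tri< 0<w _ _) (inj₁ refl) (inj₂ (eq , _)) =
    inj₂ (trans (cong (zipWith ℚ._+_ (Vec.map (w ℚ.*_) (toℚv p))) eq) (scale-+ w (sumℚ ws) (toℚv p)) , inj₂ se)
  cases (tri< 0<w _ _) (inj₂ lt) _ = inj₁ (strict (ℚₚ.+-mono-<-≤
    (ℚₚ.*-monoʳ-<-pos w {{ℚ.positive 0<w}} (ι-mono-< lt)) (combo-bound f c ⟨ c , p ⟩ bound ws ps)))

pointwise-dichotomy : (c e p : Exp dim) → (∀ i → lookup c i * lookup e i ℤ.≤ lookup c i * lookup p i) →
  (∀ i → lookup c i * lookup e i ≡ lookup c i * lookup p i) ⊎ ⟨ c , e ⟩ ℤ.< ⟨ c , p ⟩
pointwise-dichotomy [] [] [] h = inj₁ λ ()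
pointwise-dichotomy (x ∷ c) (y ∷ e) (z ∷ p) h with x * y ℤ.≟ x * z | pointwise-dichotomy c e p (h ∘ suc)
... | yes eq | inj₁ eqs = inj₁ λ { zero → eq ; (suc i) → eqs i }
... | yes eq | inj₂ lt = inj₂ (ℤₚ.+-mono-≤-< (ℤₚ.≤-reflexive eq) lt)
... | no neq | inj₁ eqs = inj₂ (ℤₚ.+-mono-<-≤ (ℤₚ.≤∧≢⇒< (h zero) neq) (ℤₚ.≤-reflexive (all-≡ c e p eqs)))
  where
  all-≡ : ∀ {dim} (c e p : Exp dim) → (∀ i → lookup c i * lookup e i ≡ lookup c i * lookup p i) → ⟨ c , e ⟩ ≡ ⟨ c , p ⟩
  all-≡ [] [] [] _ = refl
  all-≡ (_ ∷ c) (_ ∷ e) (_ ∷ p) eqs = cong₂ _+_ (eqs zero) (all-≡ c e p (eqs ∘ suc))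
... | no neq | inj₂ lt = inj₂ (ℤₚ.+-mono-≤-< (h zero) lt)

-- The functional with entries 2pⱼ − 1 = ±1 is maximised over the cube {0,1}ⁿ exactly at p.
sgn : ℤ → ℤ
sgn z = z + z - 1ℤ

Bit : ℤ → Set
Bit z = 0ℤ ℤ.≤ z × z ℤ.≤ 1ℤ

bit-cases : ∀ {z} → Bit z → z ≡ 0ℤ ⊎ z ≡ 1ℤ
bit-cases {ℤ.+ 0} _ = inj₁ refl
bit-cases {ℤ.+ 1} _ = inj₂ refl
bit-cases {ℤ.+ (suc (suc _))} (_ , ℤ.+≤+ (s≤s ()))

sgn-≤ : ∀ {x y} → Bit x → Bit y → sgn y * x ℤ.≤ sgn y * y
sgn-≤ bx by with bit-cases bx | bit-cases by
... | inj₁ refl | inj₁ refl = ℤₚ.≤-refl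
... | inj₁ refl | inj₂ refl = ℤ.+≤+ z≤n
... | inj₂ refl | inj₁ refl = ℤ.-≤+
... | inj₂ refl | inj₂ refl = ℤₚ.≤-refl

sgn-≡ : ∀ {x y} → Bit x → Bit y → sgn y * x ≡ sgn y * y → x ≡ y
sgn-≡ bx by eq with bit-cases bx | bit-cases by
... | inj₁ refl | inj₁ refl = refl
... | inj₂ refl | inj₂ refl = refl
sgn-≡ bx by () | inj₁ refl | inj₂ refl
sgn-≡ bx by () | inj₂ refl | inj₁ refl

lookup-ext : {u v : Vec ℤ dim} → (∀ i → lookup u i ≡ lookup v i) → u ≡ v
lookup-ext {u = []} {[]} h = refl
lookup-ext {u = x ∷ u} {y ∷ v} h = cong₂ _∷_ (h zero) (lookup-ext (h ∘ suc))

↑-elim : (P : Fin (dim ℕ.+ n) → Set) → (∀ i → P (i ↑ˡ n)) → (∀ j → P (dim ↑ʳ j)) → ∀ i → P i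
↑-elim {zero} P l r i = r i
↑-elim {suc dim} P l r zero = l zero
↑-elim {suc dim} P l r (suc i) = ↑-elim {dim} (P ∘ suc) (l ∘ suc) r i

⟨⟩-split : ∀ {k} (a : Vec ℤ dim) (b : Vec ℤ k) (e : Exp (dim ℕ.+ k)) →
  ⟨ a Vec.++ b , e ⟩ ≡ ⟨ a , Vec.take dim e ⟩ + ⟨ b , Vec.drop dim e ⟩
⟨⟩-split [] b e = sym (ℤₚ.+-identityˡ _)
⟨⟩-split (x ∷ a) b (y ∷ e) = trans (cong (x * y +_) (⟨⟩-split a b e)) (sym (ℤₚ.+-assoc (x * y) _ _))

⟨⟩-comm : (u v : Exp dim) → ⟨ u , v ⟩ ≡ ⟨ v , u ⟩
⟨⟩-comm [] [] = refl
⟨⟩-comm (x ∷ u) (y ∷ v) = cong₂ _+_ (ℤₚ.*-comm x y) (⟨⟩-comm u v)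

lookup-take : ∀ {k} (e : Vec ℤ (dim ℕ.+ k)) i → lookup (Vec.take dim e) i ≡ lookup e (i ↑ˡ k)
lookup-take (x ∷ e) zero = refl
lookup-take (x ∷ e) (suc i) = lookup-take e i

lookup-drop : ∀ {k} (e : Vec ℤ (dim ℕ.+ k)) i → lookup (Vec.drop dim e) i ≡ lookup e (dim ↑ʳ i)
lookup-drop {zero} e i = refl
lookup-drop {suc dim} (x ∷ e) i = lookup-drop {dim} e i

-- The inequalities satisfied by exponents and their consequences.

module Polytope {n : ℕ} (B₀ : Matrix n) (f : Laurent (n ℕ.+ n)) (g : Fin n → ℤ) where
  open Tropical n
  open Grading B₀ using (gradE)

  -- Each condition is a half-space `⟨ v , e ⟩ ≤ K`, with lower bounds written through negated
  -- functionals, so all of them extend from the support to the lattice points of its convex hull by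
  -- `newton-bound`.
  record Admissible (e : Exp (n ℕ.+ n)) : Set where
    field
      y-lower : ∀ j → ⟨ negate (yE j) , e ⟩ ℤ.≤ 0ℤ
      y-upper : ∀ j → ⟨ yE j , e ⟩ ℤ.≤ 1ℤ
      g-upper : ∀ r → ⟨ gradE r , e ⟩ ℤ.≤ g r
      g-lower : ∀ r → ⟨ negate (gradE r) , e ⟩ ℤ.≤ - g r

    y-bit : ∀ j → Bit (lookup e (n ↑ʳ j))
    y-bit j = subst Bit (trans (⟨⟩-comm (yE j) e) (⟨⟩-unitE e (n ↑ʳ j)))
      (ℤₚ.neg-cancel-≤ (subst (ℤ._≤ 0ℤ) (⟨⟩-negate (yE j) e) (y-lower j)) , y-upper j)

    g-degree : ∀ r → ⟨ gradE r , e ⟩ ≡ g r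
    g-degree r = ℤₚ.≤-antisym (g-upper r) (ℤₚ.neg-cancel-≤ (subst (ℤ._≤ - g r) (⟨⟩-negate (gradE r) e) (g-lower r)))

  open Admissible

  -- The grading solves for the w-part: exponent r equals `g r` plus the pairing of row r of `B₀`
  -- with the y-part.
  admissible-≡ : ∀ {e p} → Admissible e → Admissible p →
    (∀ j → lookup e (n ↑ʳ j) ≡ lookup p (n ↑ʳ j)) → e ≡ p
  admissible-≡ {e} {p} ae ap eqs = lookup-ext (↑-elim (λ i → lookup e i ≡ lookup p i) w-part eqs)
    where
    drop-≡ : Vec.drop n e ≡ Vec.drop n p
    drop-≡ = lookup-ext (λ j → trans (lookup-drop {n} e j) (trans (eqs j) (sym (lookup-drop {n} p j))))
    ⟨id⟩ : ∀ r (u : Exp n) → ⟨ tabulate (idMatrix r) , u ⟩ ≡ lookup u r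
    ⟨id⟩ r u = trans (⟨⟩-comm (tabulate (idMatrix r)) u) (trans (cong ⟨ u ,_⟩ unit) (⟨⟩-unitE u r))
      where
      unit : tabulate (idMatrix r) ≡ unitE r
      unit = lookup-ext λ i → trans (lookup∘tabulate (idMatrix r) i) (flip i (i Fin.≟ r))
        where
        flip : ∀ i → Dec (i ≡ r) → idMatrix r i ≡ lookup (unitE r) i
        flip i (yes refl) = trans (idMatrix-≡ i) (sym (lookup-unitE-≡ i))
        flip i (no i≢r) = trans (idMatrix-≢ (i≢r ∘ sym)) (sym (lookup-unitE-≢ i≢r))
    w-part : ∀ r → lookup e (r ↑ˡ n) ≡ lookup p (r ↑ˡ n)
    w-part r = ∙-cancelʳ ⟨ b , Vec.drop n p ⟩ _ _ (begin
      lookup e (r ↑ˡ n) + ⟨ b , Vec.drop n p ⟩   ≡⟨ cong (λ u → lookup e (r ↑ˡ n) + ⟨ b , u ⟩) (sym drop-≡) ⟩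
      lookup e (r ↑ˡ n) + ⟨ b , Vec.drop n e ⟩   ≡⟨ sym (value e) ⟩
      ⟨ gradE r , e ⟩                            ≡⟨ trans (g-degree ae r) (sym (g-degree ap r)) ⟩
      ⟨ gradE r , p ⟩                            ≡⟨ value p ⟩
      lookup p (r ↑ˡ n) + ⟨ b , Vec.drop n p ⟩   ∎)
      where
      open ≡-Reasoning
      b : Exp n
      b = tabulate (λ j → - B₀ r j)
      value : ∀ e → ⟨ gradE r , e ⟩ ≡ lookup e (r ↑ˡ n) + ⟨ b , Vec.drop n e ⟩
      value e = trans (⟨⟩-split (tabulate (idMatrix r)) b e)
        (cong (_+ ⟨ b , Vec.drop n e ⟩) (trans (⟨id⟩ r (Vec.take n e)) (lookup-take e r)))

  witness : Exp (n ℕ.+ n) → Exp (n ℕ.+ n)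
  witness p = replicate n 0ℤ Vec.++ tabulate (λ j → sgn (lookup p (n ↑ʳ j)))

  -- The functional has weight 0 on the w-part, so attaining the maximum determines the y-part; the
  -- grading then determines the rest.
  witness-max : ∀ {e p} → Admissible e → Admissible p → e ≡ p ⊎ ⟨ witness p , e ⟩ ℤ.< ⟨ witness p , p ⟩
  witness-max {e} {p} ae ap with pointwise-dichotomy (witness p) e p (↑-elim _ w-≤ y-≤)
    where
    w-≤ : ∀ i → lookup (witness p) (i ↑ˡ n) * lookup e (i ↑ˡ n) ℤ.≤ lookup (witness p) (i ↑ˡ n) * lookup p (i ↑ˡ n)
    w-≤ i rewrite lookup-++ˡ (replicate n 0ℤ) (tabulate (λ j → sgn (lookup p (n ↑ʳ j)))) i | lookup-replicate i 0ℤ = ℤₚ.≤-refl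
    y-≤ : ∀ j → lookup (witness p) (n ↑ʳ j) * lookup e (n ↑ʳ j) ℤ.≤ lookup (witness p) (n ↑ʳ j) * lookup p (n ↑ʳ j)
    y-≤ j rewrite lookup-++ʳ (replicate n 0ℤ) (tabulate (λ j → sgn (lookup p (n ↑ʳ j)))) j
      | lookup∘tabulate (λ j → sgn (lookup p (n ↑ʳ j))) j = sgn-≤ (y-bit ae j) (y-bit ap j)
  ... | inj₂ lt = inj₂ lt
  ... | inj₁ eqs = inj₁ (admissible-≡ ae ap λ j → sgn-≡ (y-bit ae j) (y-bit ap j) (y-≡ j))
    where
    y-≡ : ∀ j → sgn (lookup p (n ↑ʳ j)) * lookup e (n ↑ʳ j) ≡ sgn (lookup p (n ↑ʳ j)) * lookup p (n ↑ʳ j)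
    y-≡ j = subst (λ c → c * lookup e (n ↑ʳ j) ≡ c * lookup p (n ↑ʳ j))
      (trans (lookup-++ʳ (replicate n 0ℤ) (tabulate (λ j → sgn (lookup p (n ↑ʳ j)))) j) (lookup∘tabulate _ j))
      (eqs (n ↑ʳ j))

  module _ (adm : ∀ e → Support f e → Admissible e) where

    newton-admissible : ∀ p → InNewton f (toℚv p) → Admissible p
    newton-admissible p i = record
      { y-lower = λ j → newton-bound f (negate (yE j)) 0ℤ (λ e s → y-lower (adm e s) j) p i
      ; y-upper = λ j → newton-bound f (yE j) 1ℤ (λ e s → y-upper (adm e s) j) p i
      ; g-upper = λ r → newton-bound f (gradE r) (g r) (λ e s → g-upper (adm e s) r) p i
      ; g-lower = λ r → newton-bound f (negate (gradE r)) (- g r) (λ e s → g-lower (adm e s) r) p i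
      }

    -- At `q = toℚv p` the strict inequality is absurd, which gives saturation; at any other `q` the
    -- equality is absurd, which makes `toℚv p` a vertex.
    newton-dichotomy : ∀ p → InNewton f (toℚv p) → ∀ q → InNewton f q →
      dot (toℚv (witness p)) q ℚ.< dot (toℚv (witness p)) (toℚv p) ⊎ (q ≡ toℚv p × Support f p)
    newton-dichotomy p i q (ws , ps , s≡1 , refl)
      with combo-dichotomy f (witness p) p (λ e s → witness-max (adm e s) (newton-admissible p i)) ws ps
    ... | inj₁ lt = inj₁ (subst (dot (toℚv (witness p)) (combo ws) ℚ.<_)
      (trans (cong (ℚ._* ι ⟨ witness p , p ⟩) s≡1) (trans (ℚₚ.*-identityˡ _) (sym (dot-ι (witness p) p)))) lt)
    ... | inj₂ (_ , inj₁ s≡0) = contradiction (trans (sym s≡1) s≡0) λ ()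
    ... | inj₂ (eq , inj₂ s) = inj₂ (trans eq (trans (cong (λ s → Vec.map (s ℚ.*_) (toℚv p)) s≡1) (scale-one (toℚv p))) , s)

    saturated : Saturated f
    saturated p i with newton-dichotomy p i (toℚv p) i
    ... | inj₁ lt = contradiction lt (ℚₚ.<-irrefl refl)
    ... | inj₂ (_ , s) = s

    emptyPolytope : EmptyPolytope f
    emptyPolytope p i = i , toℚv (witness p) , strict
      where
      strict : ∀ q → InNewton f q → q ≢ toℚv p → dot (toℚv (witness p)) q ℚ.< dot (toℚv (witness p)) (toℚv p)
      strict q iq q≢p with newton-dichotomy p i q iq
      ... | inj₁ lt = lt
      ... | inj₂ (q≡p , _) = contradiction q≡p q≢p

-- Chords of a polygon

-- Position of a vertex relative to a chord {lo < hi}: below lo, at lo, between, at hi, above hi.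
Position : Set
Position = Fin 5

-- The possible positions of vertices x < y. Distinct vertices may share an open region but not an
-- end of the chord, whence the two exceptions.
precedes : Position → Position → Bool
precedes 1F 1F = false
precedes 3F 3F = false
precedes X Y = Fin.toℕ X ℕ.≤ᵇ Fin.toℕ Y

chain₄ : (A B C D : Position) → Bool
chain₄ A B C D = precedes A B ∧ precedes B C ∧ precedes C D

cyclic₄ : (A B C D : Position) → Bool
cyclic₄ A B C D = chain₄ A B C D ∨ chain₄ B C D A ∨ chain₄ C D A B ∨ chain₄ D A B C

chain₅ : (A B C D E : Position) → Bool
chain₅ A B C D E = precedes A B ∧ chain₄ B C D E

cyclic₅ : (A B C D E : Position) → Bool
cyclic₅ A B C D E =
  chain₅ A B C D E ∨ chain₅ B C D E A ∨ chain₅ C D E A B ∨ chain₅ D E A B C ∨ chain₅ E A B C D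

inside outside : Position → Bool
inside 2F = true
inside _ = false
outside 0F = true
outside 4F = true
outside _ = false

crossing : Position → Position → ℤ
crossing X Y = if (inside X ∧ outside Y) ∨ (outside X ∧ inside Y) then 1ℤ else 0ℤ

coincidence : Position → Position → ℤ
coincidence 1F 3F = 1ℤ
coincidence 3F 1F = 1ℤ
coincidence _ _ = 0ℤ

-- The elementary lamination of the chord: both ends are moved so that lo and the
-- vertices strictly between lo and hi lie on one side, and all others on the other side.
bank : Position → Bool
bank 1F = true
bank 2F = true
bank _ = false

-- The quadrilateral P M Q U has diagonal PQ. The value is 1 if the lamination separates P, M from
-- Q, U, crossing the sides MQ and UP, and -1 if it separates U, P from M, Q, crossing PM and QU.
shearBits : Bool → Bool → Bool → Bool → ℤ
shearBits true true false false = 1ℤ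
shearBits false false true true = 1ℤ
shearBits true false false true = ℤ.-1ℤ
shearBits false true true false = ℤ.-1ℤ
shearBits _ _ _ _ = 0ℤ

shear : (P M Q U : Position) → ℤ
shear P M Q U = shearBits (bank P) (bank M) (bank Q) (bank U)

-- The Fomin-Shapiro-Thurston entry of the chord against the diagonal PQ: sides PM and QU count
-- positively, MQ and UP negatively.
adjacency : (P M Q U : Position) → ℤ
adjacency P M Q U = coincidence P M - coincidence M Q + coincidence Q U - coincidence U P

all₄? : {R : (P M Q U : Position) → Set} → (∀ P M Q U → Dec (R P M Q U)) → Dec (∀ P M Q U → R P M Q U)
all₄? R? = Finₚ.all? λ P → Finₚ.all? λ M → Finₚ.all? λ Q → Finₚ.all? λ U → R? P M Q U

-- Local identities checked by enumeration of positions.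

abstract
  -- X is the apex beyond the side PM. Flipping PQ to MU replaces the quadrilateral P X M Q around
  -- that side by P X M U; the correction is the mutation term for the matrix entry -1. The side MQ,
  -- with entry 1, is treated in `shear-side₂`.
  shear-side₁ : ∀ P X M Q U → T (cyclic₅ P X M Q U) →
    shear P X M U ≡ shear P X M Q - pos (- shear P M Q U)
  shear-side₁ = toWitness {a? = Finₚ.all? λ P → all₄? λ X M Q U → T? _ →-dec (_ ℤ.≟ _)} _

  shear-side₂ : ∀ M X Q U P → T (cyclic₅ M X Q U P) →
    shear M X Q U ≡ shear M X Q P + pos (shear P M Q U)
  shear-side₂ = toWitness {a? = Finₚ.all? λ M → all₄? λ X Q U P → T? _ →-dec (_ ℤ.≟ _)} _

  adjacency-side₁ : ∀ P X M Q U → T (cyclic₅ P X M Q U) → coincidence P Q ≡ 0ℤ → coincidence M U ≡ 0ℤ →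
    adjacency P X M U ≡ adjacency P X M Q - pos (- adjacency P M Q U)
  adjacency-side₁ = toWitness {a? = Finₚ.all? λ P → all₄? λ X M Q U →
    T? _ →-dec ((_ ℤ.≟ _) →-dec ((_ ℤ.≟ _) →-dec (_ ℤ.≟ _)))} _

  adjacency-side₂ : ∀ M X Q U P → T (cyclic₅ M X Q U P) → coincidence P Q ≡ 0ℤ → coincidence M U ≡ 0ℤ →
    adjacency M X Q U ≡ adjacency M X Q P + pos (adjacency P M Q U)
  adjacency-side₂ = toWitness {a? = Finₚ.all? λ M → all₄? λ X Q U P →
    T? _ →-dec ((_ ℤ.≟ _) →-dec ((_ ℤ.≟ _) →-dec (_ ℤ.≟ _)))} _

  pos-adjacency : ∀ P M Q U → T (cyclic₄ P M Q U) → pos (adjacency P M Q U) ≡ coincidence P M + coincidence Q U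
  pos-adjacency = toWitness {a? = all₄? λ P M Q U → T? _ →-dec (_ ℤ.≟ _)} _

  neg-adjacency : ∀ P M Q U → T (cyclic₄ P M Q U) → pos (- adjacency P M Q U) ≡ coincidence M Q + coincidence U P
  neg-adjacency = toWitness {a? = all₄? λ P M Q U → T? _ →-dec (_ ℤ.≟ _)} _

  tropicalPtolemy : ∀ P M Q U → T (cyclic₄ P M Q U) →
    ((crossing P M + crossing Q U) + pos (shear P M Q U)) ⊔ ((crossing M Q + crossing U P) + pos (- shear P M Q U))
      - crossing P Q ≡ crossing M U
  tropicalPtolemy = toWitness {a? = all₄? λ P M Q U → T? _ →-dec (_ ℤ.≟ _)} _

  -- A chord that crosses MU and none of the four sides can only run from P to Q.
  crossing-flip : ∀ P M Q U → T (cyclic₄ P M Q U) → crossing P M ≡ 0ℤ → crossing M Q ≡ 0ℤ →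
    crossing Q U ≡ 0ℤ → crossing U P ≡ 0ℤ → coincidence P Q ≡ 0ℤ → crossing M U ≡ 0ℤ
  crossing-flip = toWitness {a? = all₄? λ P M Q U → T? _ →-dec ((_ ℤ.≟ _) →-dec ((_ ℤ.≟ _) →-dec
    ((_ ℤ.≟ _) →-dec ((_ ℤ.≟ _) →-dec ((_ ℤ.≟ _) →-dec (_ ℤ.≟ _))))))} _

  -- Among the diagonals of a triangulation, the elementary lamination of one has shear coordinate 1
  -- on that one and 0 on the others: this is the identity block of principal coefficients.
  shear-initial : ∀ P M Q U → T (cyclic₄ P M Q U) → crossing P M ≡ 0ℤ → crossing M Q ≡ 0ℤ →
    crossing Q U ≡ 0ℤ → crossing U P ≡ 0ℤ → crossing P Q ≡ 0ℤ → shear P M Q U ≡ coincidence P Q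
  shear-initial = toWitness {a? = all₄? λ P M Q U → T? _ →-dec ((_ ℤ.≟ _) →-dec ((_ ℤ.≟ _) →-dec
    ((_ ℤ.≟ _) →-dec ((_ ℤ.≟ _) →-dec ((_ ℤ.≟ _) →-dec (_ ℤ.≟ _))))))} _

-- The conditions `lo < x` in the last two cases keep the five cases exclusive for arbitrary `lo`
-- and `hi`.
data PlaceView (lo hi x : ℕ) : Position → Set where
  below : x < lo → PlaceView lo hi x 0F
  at-lo : x ≡ lo → PlaceView lo hi x 1F
  between : lo < x → x < hi → PlaceView lo hi x 2F
  at-hi : lo < x → x ≡ hi → PlaceView lo hi x 3F
  above : lo < x → hi < x → PlaceView lo hi x 4F

abstract
  place : (lo hi x : ℕ) → Position
  place lo hi x with ℕₚ.<-cmp x lo | ℕₚ.<-cmp x hi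
  ... | tri< _ _ _ | _ = 0F
  ... | tri≈ _ _ _ | _ = 1F
  ... | tri> _ _ _ | tri< _ _ _ = 2F
  ... | tri> _ _ _ | tri≈ _ _ _ = 3F
  ... | tri> _ _ _ | tri> _ _ _ = 4F

  place-view : ∀ lo hi x → PlaceView lo hi x (place lo hi x)
  place-view lo hi x with ℕₚ.<-cmp x lo | ℕₚ.<-cmp x hi
  ... | tri< p _ _ | _ = below p
  ... | tri≈ _ p _ | _ = at-lo p
  ... | tri> _ _ p | tri< q _ _ = between p q
  ... | tri> _ _ p | tri≈ _ q _ = at-hi p q
  ... | tri> _ _ p | tri> _ _ q = above p q

place-unique : ∀ {lo hi x X Y} → PlaceView lo hi x X → PlaceView lo hi x Y → X ≡ Y
place-unique (below _) (below _) = refl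
place-unique (below p) (at-lo refl) = contradiction p (ℕₚ.<-irrefl refl)
place-unique (below p) (between q _) = contradiction p (ℕₚ.<-asym q)
place-unique (below p) (at-hi q _) = contradiction p (ℕₚ.<-asym q)
place-unique (below p) (above q _) = contradiction p (ℕₚ.<-asym q)
place-unique (at-lo refl) (below q) = contradiction q (ℕₚ.<-irrefl refl)
place-unique (at-lo _) (at-lo _) = refl
place-unique (at-lo refl) (between q _) = contradiction q (ℕₚ.<-irrefl refl)
place-unique (at-lo refl) (at-hi q _) = contradiction q (ℕₚ.<-irrefl refl)
place-unique (at-lo refl) (above q _) = contradiction q (ℕₚ.<-irrefl refl)
place-unique (between p _) (below q) = contradiction p (ℕₚ.<-asym q)
place-unique (between p _) (at-lo refl) = contradiction p (ℕₚ.<-irrefl refl)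
place-unique (between _ _) (between _ _) = refl
place-unique (between _ p) (at-hi _ refl) = contradiction p (ℕₚ.<-irrefl refl)
place-unique (between _ p) (above _ q) = contradiction p (ℕₚ.<-asym q)
place-unique (at-hi p _) (below q) = contradiction p (ℕₚ.<-asym q)
place-unique (at-hi p _) (at-lo refl) = contradiction p (ℕₚ.<-irrefl refl)
place-unique (at-hi _ refl) (between _ q) = contradiction q (ℕₚ.<-irrefl refl)
place-unique (at-hi _ _) (at-hi _ _) = refl
place-unique (at-hi _ refl) (above _ q) = contradiction q (ℕₚ.<-irrefl refl)
place-unique (above p _) (below q) = contradiction p (ℕₚ.<-asym q)
place-unique (above p _) (at-lo refl) = contradiction p (ℕₚ.<-irrefl refl)
place-unique (above _ p) (between _ q) = contradiction p (ℕₚ.<-asym q)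
place-unique (above _ p) (at-hi _ refl) = contradiction p (ℕₚ.<-irrefl refl)
place-unique (above _ _) (above _ _) = refl

place-mono : ∀ lo hi {x y} → x < y → T (precedes (place lo hi x) (place lo hi y))
place-mono lo hi {x} {y} x<y = go (place-view lo hi x) (place-view lo hi y)
  where
  go : ∀ {X Y} → PlaceView lo hi x X → PlaceView lo hi y Y → T (precedes X Y)
  go (below p) (below q) = tt
  go (below p) (at-lo q) = tt
  go (below p) (between q _) = tt
  go (below p) (at-hi q _) = tt
  go (below p) (above q _) = tt
  go (at-lo refl) (below q) = contradiction x<y (ℕₚ.<-asym q)
  go (at-lo refl) (at-lo refl) = contradiction x<y (ℕₚ.<-irrefl refl)
  go (at-lo _) (between _ _) = tt
  go (at-lo _) (at-hi _ _) = tt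
  go (at-lo _) (above _ _) = tt
  go (between p _) (below q) = contradiction (ℕₚ.<-trans p x<y) (ℕₚ.<-asym q)
  go (between p _) (at-lo refl) = contradiction x<y (ℕₚ.<-asym p)
  go (between _ _) (between _ _) = tt
  go (between _ _) (at-hi _ _) = tt
  go (between _ _) (above _ _) = tt
  go (at-hi p _) (below q) = contradiction (ℕₚ.<-trans p x<y) (ℕₚ.<-asym q)
  go (at-hi p _) (at-lo refl) = contradiction x<y (ℕₚ.<-asym p)
  go (at-hi _ refl) (between _ q) = contradiction x<y (ℕₚ.<-asym q)
  go (at-hi _ refl) (at-hi _ refl) = contradiction x<y (ℕₚ.<-irrefl refl)
  go (at-hi _ _) (above _ _) = tt
  go (above p _) (below q) = contradiction (ℕₚ.<-trans p x<y) (ℕₚ.<-asym q)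
  go (above p _) (at-lo refl) = contradiction x<y (ℕₚ.<-asym p)
  go (above _ p) (between _ q) = contradiction (ℕₚ.<-trans p x<y) (ℕₚ.<-asym q)
  go (above _ p) (at-hi _ refl) = contradiction x<y (ℕₚ.<-asym p)
  go (above _ _) (above _ _) = tt

-- Cyclic order of vertices.

Cyc₃ : (a b c : ℕ) → Set
Cyc₃ a b c = (a < b × b < c) ⊎ (b < c × c < a) ⊎ (c < a × a < b)

Cyc₄ : (a b c d : ℕ) → Set
Cyc₄ a b c d = (a < b × b < c × c < d) ⊎ (b < c × c < d × d < a) ⊎ (c < d × d < a × a < b) ⊎ (d < a × a < b × b < c)

Cyc₅ : (a b c d e : ℕ) → Set
Cyc₅ a b c d e = (a < b × b < c × c < d × d < e) ⊎ (b < c × c < d × d < e × e < a) ⊎ (c < d × d < e × e < a × a < b)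
  ⊎ (d < e × e < a × a < b × b < c) ⊎ (e < a × a < b × b < c × c < d)

rot₃ : ∀ {a b c} → Cyc₃ a b c → Cyc₃ b c a
rot₃ (inj₁ p) = inj₂ (inj₂ p)
rot₃ (inj₂ (inj₁ p)) = inj₁ p
rot₃ (inj₂ (inj₂ p)) = inj₂ (inj₁ p)

rot₄ : ∀ {a b c d} → Cyc₄ a b c d → Cyc₄ b c d a
rot₄ (inj₁ p) = inj₂ (inj₂ (inj₂ p))
rot₄ (inj₂ (inj₁ p)) = inj₁ p
rot₄ (inj₂ (inj₂ (inj₁ p))) = inj₂ (inj₁ p)
rot₄ (inj₂ (inj₂ (inj₂ p))) = inj₂ (inj₂ (inj₁ p))

private
  infixr 5 _∙_
  _∙_ : ∀ {a b c} → a < b → b < c → a < c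
  _∙_ = ℕₚ.<-trans

  loop : ∀ {a} {A : Set} → a < a → A
  loop p = contradiction p (ℕₚ.<-irrefl refl)

asym₃ : ∀ {a b c} → Cyc₃ a b c → ¬ Cyc₃ b a c
asym₃ (inj₁ (p , q)) (inj₁ (r , s)) = loop (p ∙ r)
asym₃ (inj₁ (p , q)) (inj₂ (inj₁ (r , s))) = loop (q ∙ s)
asym₃ (inj₁ (p , q)) (inj₂ (inj₂ (r , s))) = loop (p ∙ s)
asym₃ (inj₂ (inj₁ (p , q))) (inj₁ (r , s)) = loop (q ∙ s)
asym₃ (inj₂ (inj₁ (p , q))) (inj₂ (inj₁ (r , s))) = loop (p ∙ s)
asym₃ (inj₂ (inj₁ (p , q))) (inj₂ (inj₂ (r , s))) = loop (p ∙ r)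
asym₃ (inj₂ (inj₂ (p , q))) (inj₁ (r , s)) = loop (q ∙ r)
asym₃ (inj₂ (inj₂ (p , q))) (inj₂ (inj₁ (r , s))) = loop (p ∙ r)
asym₃ (inj₂ (inj₂ (p , q))) (inj₂ (inj₂ (r , s))) = loop (q ∙ s)

distinct₃ : ∀ {a b c} → Cyc₃ a b c → a ≢ b
distinct₃ (inj₁ (p , _)) refl = loop p
distinct₃ (inj₂ (inj₁ (p , q))) refl = loop (p ∙ q)
distinct₃ (inj₂ (inj₂ (_ , p))) refl = loop p

-- The two vertices lie on opposite sides of the chord ac.
apart : ∀ {a b c d} → Cyc₃ a b c → Cyc₃ a c d → b ≢ d
apart c₁ c₂ refl = asym₃ (rot₃ (rot₃ c₁)) c₂

-- Two triangles on opposite sides of their common edge pq form a quadrilateral with diagonal pq.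
glue : ∀ {p m q u} → Cyc₃ p m q → Cyc₃ p q u → Cyc₄ p m q u
glue (inj₁ (a , b)) (inj₁ (c , d)) = inj₁ (a , b , d)
glue (inj₁ (a , b)) (inj₂ (inj₁ (c , d))) = loop (a ∙ b ∙ c ∙ d)
glue (inj₁ (a , b)) (inj₂ (inj₂ (c , d))) = inj₂ (inj₂ (inj₂ (c , a , b)))
glue (inj₂ (inj₁ (a , b))) (inj₁ (c , d)) = loop (b ∙ c)
glue (inj₂ (inj₁ (a , b))) (inj₂ (inj₁ (c , d))) = inj₂ (inj₁ (a , c , d))
glue (inj₂ (inj₁ (a , b))) (inj₂ (inj₂ (c , d))) = loop (b ∙ d)
glue (inj₂ (inj₂ (a , b))) (inj₁ (c , d)) = loop (a ∙ c)
glue (inj₂ (inj₂ (a , b))) (inj₂ (inj₁ (c , d))) = inj₂ (inj₂ (inj₁ (c , d , b)))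
glue (inj₂ (inj₂ (a , b))) (inj₂ (inj₂ (c , d))) = loop (a ∙ d)

split₁ : ∀ {p m q u} → Cyc₄ p m q u → Cyc₃ p m q
split₁ (inj₁ (a , b , c)) = inj₁ (a , b)
split₁ (inj₂ (inj₁ (a , b , c))) = inj₂ (inj₁ (a , b ∙ c))
split₁ (inj₂ (inj₂ (inj₁ (a , b , c)))) = inj₂ (inj₂ (a ∙ b , c))
split₁ (inj₂ (inj₂ (inj₂ (a , b , c)))) = inj₁ (b , c)

split₂ : ∀ {p m q u} → Cyc₄ p m q u → Cyc₃ p q u
split₂ = rot₃ ∘ rot₃ ∘ split₁ ∘ rot₄ ∘ rot₄

module Distinct {p m q u : ℕ} (quad : Cyc₄ p m q u) where

  p≢m : p ≢ m
  p≢m = distinct₃ (split₁ quad)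

  p≢q : p ≢ q
  p≢q = distinct₃ (split₂ quad)

  m≢q : m ≢ q
  m≢q = distinct₃ (split₁ (rot₄ quad))

  m≢u : m ≢ u
  m≢u = distinct₃ (split₂ (rot₄ quad))

  q≢u : q ≢ u
  q≢u = distinct₃ (split₁ (rot₄ (rot₄ quad)))

  u≢p : u ≢ p
  u≢p = distinct₃ (split₁ (rot₄ (rot₄ (rot₄ quad))))

insert : ∀ {p x m q u} → Cyc₃ p x m → Cyc₄ p m q u → Cyc₅ p x m q u
insert (inj₁ (a , b)) (inj₁ (c , d , e)) = inj₁ (a , b , d , e)
insert (inj₁ (a , b)) (inj₂ (inj₁ (c , d , e))) = loop (a ∙ b ∙ c ∙ d ∙ e)
insert (inj₁ (a , b)) (inj₂ (inj₂ (inj₁ (c , d , e)))) = inj₂ (inj₂ (inj₂ (inj₁ (c , d , a , b))))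
insert (inj₁ (a , b)) (inj₂ (inj₂ (inj₂ (c , d , e)))) = inj₂ (inj₂ (inj₂ (inj₂ (c , a , b , e))))
insert (inj₂ (inj₁ (a , b))) (inj₁ (c , d , e)) = loop (b ∙ c)
insert (inj₂ (inj₁ (a , b))) (inj₂ (inj₁ (c , d , e))) = inj₂ (inj₁ (a , c , d , e))
insert (inj₂ (inj₁ (a , b))) (inj₂ (inj₂ (inj₁ (c , d , e)))) = loop (b ∙ e)
insert (inj₂ (inj₁ (a , b))) (inj₂ (inj₂ (inj₂ (c , d , e)))) = loop (b ∙ d)
insert (inj₂ (inj₂ (a , b))) (inj₁ (c , d , e)) = loop (a ∙ c)
insert (inj₂ (inj₂ (a , b))) (inj₂ (inj₁ (c , d , e))) = inj₂ (inj₂ (inj₁ (c , d , e , b)))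
insert (inj₂ (inj₂ (a , b))) (inj₂ (inj₂ (inj₁ (c , d , e)))) = loop (a ∙ e)
insert (inj₂ (inj₂ (a , b))) (inj₂ (inj₂ (inj₂ (c , d , e)))) = loop (a ∙ d)

infixr 6 _&_
_&_ : ∀ {x y} → T x → T y → T (x ∧ y)
p & q = Equivalence.from T-∧ (p , q)

left : ∀ {x y} → T x → T (x ∨ y)
left p = Equivalence.from T-∨ (inj₁ p)

right : ∀ {x y} → T y → T (x ∨ y)
right {x} p = Equivalence.from (T-∨ {x}) (inj₂ p)

module _ {f : ℕ → Position} (mono : ∀ {x y} → x < y → T (precedes (f x) (f y))) where

  cyclic₄-position : ∀ {a b c d} → Cyc₄ a b c d → T (cyclic₄ (f a) (f b) (f c) (f d))
  cyclic₄-position {a} {b} {c} {d} = go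
    where
    A = f a ; B = f b ; C = f c ; D = f d
    go : Cyc₄ a b c d → T (cyclic₄ A B C D)
    go (inj₁ (p , q , r)) = left (mono p & mono q & mono r)
    go (inj₂ (inj₁ (p , q , r))) = right {chain₄ A B C D} (left (mono p & mono q & mono r))
    go (inj₂ (inj₂ (inj₁ (p , q , r)))) = right {chain₄ A B C D} (right {chain₄ B C D A} (left (mono p & mono q & mono r)))
    go (inj₂ (inj₂ (inj₂ (p , q , r)))) =
      right {chain₄ A B C D} (right {chain₄ B C D A} (right {chain₄ C D A B} (mono p & mono q & mono r)))

  cyclic₅-position : ∀ {a b c d e} → Cyc₅ a b c d e → T (cyclic₅ (f a) (f b) (f c) (f d) (f e))
  cyclic₅-position {a} {b} {c} {d} {e} = go
    where
    A = f a ; B = f b ; C = f c ; D = f d ; E = f e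
    go : Cyc₅ a b c d e → T (cyclic₅ A B C D E)
    go (inj₁ (p , q , r , s)) = left (mono p & mono q & mono r & mono s)
    go (inj₂ (inj₁ (p , q , r , s))) = right {chain₅ A B C D E} (left (mono p & mono q & mono r & mono s))
    go (inj₂ (inj₂ (inj₁ (p , q , r , s)))) =
      right {chain₅ A B C D E} (right {chain₅ B C D E A} (left (mono p & mono q & mono r & mono s)))
    go (inj₂ (inj₂ (inj₂ (inj₁ (p , q , r , s))))) =
      right {chain₅ A B C D E} (right {chain₅ B C D E A} (right {chain₅ C D E A B} (left (mono p & mono q & mono r & mono s))))
    go (inj₂ (inj₂ (inj₂ (inj₂ (p , q , r , s))))) =
      right {chain₅ A B C D E} (right {chain₅ B C D E A} (right {chain₅ C D E A B} (right {chain₅ D E A B C} (mono p & mono q & mono r & mono s))))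

position : (s t x : ℕ) → Position
position s t = place (s ℕ.⊓ t) (s ℕ.⊔ t)

position-mono : ∀ s t {x y} → x < y → T (precedes (position s t x) (position s t y))
position-mono s t = place-mono (s ℕ.⊓ t) (s ℕ.⊔ t)

position₄ : ∀ s t {a b c d} → Cyc₄ a b c d → T (cyclic₄ (position s t a) (position s t b) (position s t c) (position s t d))
position₄ s t = cyclic₄-position {position s t} (position-mono s t)

position₅ : ∀ s t {a b c d e} → Cyc₅ a b c d e →
  T (cyclic₅ (position s t a) (position s t b) (position s t c) (position s t d) (position s t e))
position₅ s t = cyclic₅-position {position s t} (position-mono s t)

cross : (s t x y : ℕ) → ℤ
cross s t x y = crossing (position s t x) (position s t y)

same : (s t x y : ℕ) → ℤ
same s t x y = coincidence (position s t x) (position s t y)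

Same : (s t x y : ℕ) → Set
Same s t x y = (x ≡ s × y ≡ t) ⊎ (x ≡ t × y ≡ s)

position-comm : ∀ s t x → position s t x ≡ position t s x
position-comm s t x = cong₂ (λ lo hi → place lo hi x) (ℕₚ.⊓-comm s t) (ℕₚ.⊔-comm s t)

position-view : ∀ s t x → s ℕ.≤ t → PlaceView s t x (position s t x)
position-view s t x s≤t = subst₂ (λ lo hi → PlaceView lo hi x (position s t x))
  (ℕₚ.m≤n⇒m⊓n≡m s≤t) (ℕₚ.m≤n⇒m⊔n≡n s≤t) (place-view (s ℕ.⊓ t) (s ℕ.⊔ t) x)

position-≡ : ∀ {s t x X} → s < t → PlaceView s t x X → position s t x ≡ X
position-≡ {s} {t} {x} s<t v = place-unique (position-view s t x (ℕₚ.<⇒≤ s<t)) v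

crossing-comm : ∀ X Y → crossing X Y ≡ crossing Y X
crossing-comm = toWitness {a? = Finₚ.all? λ X → Finₚ.all? λ Y → _ ℤ.≟ _} _

crossing-≤1 : ∀ X Y → crossing X Y ℤ.≤ 1ℤ
crossing-≤1 = toWitness {a? = Finₚ.all? λ X → Finₚ.all? λ Y → _ ℤ.≤? _} _

coincidence-comm : ∀ X Y → coincidence X Y ≡ coincidence Y X
coincidence-comm = toWitness {a? = Finₚ.all? λ X → Finₚ.all? λ Y → _ ℤ.≟ _} _

cross-chord-comm : ∀ s t x y → cross s t x y ≡ cross t s x y
cross-chord-comm s t x y = cong₂ crossing (position-comm s t x) (position-comm s t y)

same-chord-comm : ∀ s t x y → same s t x y ≡ same t s x y
same-chord-comm s t x y = cong₂ coincidence (position-comm s t x) (position-comm s t y)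

cross-comm : ∀ s t x y → cross s t x y ≡ cross s t y x
cross-comm s t x y = crossing-comm (position s t x) (position s t y)

same-≡ : ∀ {s t x y} → s ≢ t → Same s t x y → same s t x y ≡ 1ℤ
same-≡ {s} {t} {x} {y} s≢t sm with ℕₚ.<-cmp s t
... | tri≈ _ s≡t _ = contradiction s≡t s≢t
... | tri< s<t _ _ = go sm
  where
  go : Same s t x y → same s t x y ≡ 1ℤ
  go (inj₁ (refl , refl)) = cong₂ coincidence (position-≡ s<t (at-lo refl)) (position-≡ s<t (at-hi s<t refl))
  go (inj₂ (refl , refl)) = cong₂ coincidence (position-≡ s<t (at-hi s<t refl)) (position-≡ s<t (at-lo refl))
... | tri> _ _ t<s = trans (same-chord-comm s t x y) (go sm)
  where
  go : Same s t x y → same t s x y ≡ 1ℤ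
  go (inj₁ (refl , refl)) = cong₂ coincidence (position-≡ t<s (at-hi t<s refl)) (position-≡ t<s (at-lo refl))
  go (inj₂ (refl , refl)) = cong₂ coincidence (position-≡ t<s (at-lo refl)) (position-≡ t<s (at-hi t<s refl))

swap-Same : ∀ {s t x y} → Same s t x y → Same t s x y
swap-Same (inj₁ p) = inj₂ p
swap-Same (inj₂ p) = inj₁ p

reverse-Same : ∀ {s t x y} → Same s t x y → Same s t y x
reverse-Same (inj₁ (p , q)) = inj₂ (q , p)
reverse-Same (inj₂ (p , q)) = inj₁ (q , p)

coincidence-≢ : ∀ {s t x y X Y} → ¬ Same s t x y → PlaceView s t x X → PlaceView s t y Y → coincidence X Y ≡ 0ℤ
coincidence-≢ ¬sm (at-lo p) (at-hi _ q) = contradiction (inj₁ (p , q)) ¬sm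
coincidence-≢ ¬sm (at-hi _ p) (at-lo q) = contradiction (inj₂ (p , q)) ¬sm
coincidence-≢ ¬sm (below _) _ = refl
coincidence-≢ ¬sm (between _ _) _ = refl
coincidence-≢ ¬sm (above _ _) _ = refl
coincidence-≢ ¬sm (at-lo _) (below _) = refl
coincidence-≢ ¬sm (at-lo _) (at-lo _) = refl
coincidence-≢ ¬sm (at-lo _) (between _ _) = refl
coincidence-≢ ¬sm (at-lo _) (above _ _) = refl
coincidence-≢ ¬sm (at-hi _ _) (below _) = refl
coincidence-≢ ¬sm (at-hi _ _) (between _ _) = refl
coincidence-≢ ¬sm (at-hi _ _) (at-hi _ _) = refl
coincidence-≢ ¬sm (at-hi _ _) (above _ _) = refl

same-≢ : ∀ {s t x y} → s ≢ t → ¬ Same s t x y → same s t x y ≡ 0ℤ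
same-≢ {s} {t} {x} {y} s≢t ¬sm with ℕₚ.<-cmp s t
... | tri≈ _ s≡t _ = contradiction s≡t s≢t
... | tri< s<t _ _ = coincidence-≢ ¬sm (position-view s t x (ℕₚ.<⇒≤ s<t)) (position-view s t y (ℕₚ.<⇒≤ s<t))
... | tri> _ _ t<s = trans (same-chord-comm s t x y)
  (coincidence-≢ (¬sm ∘ swap-Same) (position-view t s x (ℕₚ.<⇒≤ t<s)) (position-view t s y (ℕₚ.<⇒≤ t<s)))

-- `crossing` uses one chord as the frame for the ends of the other. In terms of cyclic order the
-- symmetry between the two chords becomes visible.
Separated : (s t x y : ℕ) → Set
Separated s t x y = Cyc₄ s x t y ⊎ Cyc₄ s y t x

cross-separated : ∀ {s t x y} → Separated s t x y → cross s t x y ≡ 1ℤ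
cross-separated {s} {t} {x} {y} = [ go , trans (cross-comm s t x y) ∘ go ]
  where
  value : ∀ {s t x y X Y} → s < t → PlaceView s t x X → PlaceView s t y Y → cross s t x y ≡ crossing X Y
  value s<t v w = cong₂ crossing (position-≡ s<t v) (position-≡ s<t w)
  go : ∀ {x y} → Cyc₄ s x t y → cross s t x y ≡ 1ℤ
  go (inj₁ (p , q , r)) = value (p ∙ q) (between p q) (above (p ∙ q ∙ r) r)
  go {x} {y} (inj₂ (inj₁ (p , q , r))) = trans (cross-chord-comm s t x y) (value (q ∙ r) (below p) (between q r))
  go {x} {y} (inj₂ (inj₂ (inj₁ (p , q , r)))) = trans (cross-chord-comm s t x y) (value (p ∙ q) (above (p ∙ q ∙ r) r) (between p q))
  go (inj₂ (inj₂ (inj₂ (p , q , r)))) = value (q ∙ r) (between q r) (below p)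

cross-view : ∀ {s t x y X Y} → PlaceView s t x X → PlaceView s t y Y →
  crossing X Y ≡ 0ℤ ⊎ Separated s t x y
cross-view (between p q) (below r) = inj₂ (inj₁ (inj₂ (inj₂ (inj₂ (r , p , q)))))
cross-view (between p q) (above _ r) = inj₂ (inj₁ (inj₁ (p , q , r)))
cross-view (below r) (between p q) = inj₂ (inj₂ (inj₂ (inj₂ (inj₂ (r , p , q)))))
cross-view (above _ r) (between p q) = inj₂ (inj₂ (inj₁ (p , q , r)))
cross-view (at-lo _) _ = inj₁ refl
cross-view (at-hi _ _) _ = inj₁ refl
cross-view (below _) (below _) = inj₁ refl
cross-view (below _) (at-lo _) = inj₁ refl
cross-view (below _) (at-hi _ _) = inj₁ refl
cross-view (below _) (above _ _) = inj₁ refl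
cross-view (above _ _) (below _) = inj₁ refl
cross-view (above _ _) (at-lo _) = inj₁ refl
cross-view (above _ _) (at-hi _ _) = inj₁ refl
cross-view (above _ _) (above _ _) = inj₁ refl
cross-view (between _ _) (at-lo _) = inj₁ refl
cross-view (between _ _) (at-hi _ _) = inj₁ refl
cross-view (between _ _) (between _ _) = inj₁ refl

swap-separated : ∀ {s t x y} → Separated s t x y → Separated t s x y
swap-separated (inj₁ c) = inj₂ (rot₄ (rot₄ c))
swap-separated (inj₂ c) = inj₁ (rot₄ (rot₄ c))

flip-separated : ∀ {s t x y} → Separated s t x y → Separated x y s t
flip-separated (inj₁ c) = inj₂ (rot₄ c)
flip-separated (inj₂ c) = inj₁ (rot₄ (rot₄ (rot₄ c)))

cross-cases : ∀ s t x y → cross s t x y ≡ 0ℤ ⊎ Separated s t x y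
cross-cases s t x y with ℕₚ.≤-total s t
... | inj₁ s≤t = cross-view (position-view s t x s≤t) (position-view s t y s≤t)
... | inj₂ t≤s with cross-view (position-view t s x t≤s) (position-view t s y t≤s)
...   | inj₁ z = inj₁ (trans (cross-chord-comm s t x y) z)
...   | inj₂ sep = inj₂ (swap-separated sep)

cross-unseparated : ∀ {s t x y} → ¬ Separated s t x y → cross s t x y ≡ 0ℤ
cross-unseparated {s} {t} {x} {y} ns with cross-cases s t x y
... | inj₁ z = z
... | inj₂ sep = contradiction sep ns

cross-symmetric : ∀ {s t x y} → cross x y s t ≡ 0ℤ → cross s t x y ≡ 0ℤ
cross-symmetric z = cross-unseparated λ sep → contradiction (trans (sym z) (cross-separated (flip-separated sep))) λ ()

common-end-unseparated : ∀ {s t y} → ¬ Separated s t s y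
common-end-unseparated (inj₁ c) = distinct₃ (split₁ c) refl
common-end-unseparated (inj₂ c) = distinct₃ (split₁ (rot₄ (rot₄ (rot₄ c)))) refl

cross-Same : ∀ {s t a b x y} → Same a b x y → cross s t x y ≡ cross s t a b
cross-Same (inj₁ (refl , refl)) = refl
cross-Same {s} {t} {a} {b} (inj₂ (refl , refl)) = cross-comm s t b a

same-first : ∀ {s t x y} → s ≢ t → x ≢ s → x ≢ t → same s t x y ≡ 0ℤ
same-first s≢t x≢s x≢t = same-≢ s≢t λ { (inj₁ (e , _)) → x≢s e ; (inj₂ (e , _)) → x≢t e }

same-second : ∀ {s t x y} → s ≢ t → y ≢ s → y ≢ t → same s t x y ≡ 0ℤ
same-second s≢t y≢s y≢t = same-≢ s≢t λ { (inj₁ (_ , e)) → y≢t e ; (inj₂ (_ , e)) → y≢s e }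

-- Triangulations and flips

Quaternary : Set
Quaternary = (P M Q U : Position) → ℤ

onQuad : Quaternary → (ℕ → Position) → (p m q u : ℕ) → ℤ
onQuad F f p m q u = F (f p) (f m) (f q) (f u)

-- The triangle to the right of x → y is the one to the left of y → x; with both apexes, the
-- quadrilateral is listed in the cyclic order that starts at x.
aroundDart : Quaternary → (ℕ → Position) → (ℕ → ℕ → ℕ) → (x y : ℕ) → ℤ
aroundDart F f A x y = onQuad F f x (A y x) y (A x y)

-- Makes a value independent of the direction of the diagonal, and lets the sides qu and up be
-- handled as pm and mq.
HalfTurn : Quaternary → Set
HalfTurn F = ∀ P M Q U → F P M Q U ≡ F Q U P M

around-half-turn : ∀ {F} → HalfTurn F → ∀ f A x y → aroundDart F f A x y ≡ aroundDart F f A y x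
around-half-turn h f A x y = h (f x) (f (A y x)) (f y) (f (A x y))

adjacency-half-turn : HalfTurn adjacency
adjacency-half-turn P M Q U = eq (coincidence P M) (coincidence M Q) (coincidence Q U) (coincidence U P)
  where
  eq : ∀ a b c d → a - b + c - d ≡ c - d + a - b
  eq = solve-∀

-- Here `x` is the apex beyond the side pm or mq. The corrections are those of matrix mutation when
-- the entry between the flipped diagonal and this side is -1 or 1.
SideRule : Quaternary → (ℕ → Position) → (p m q u : ℕ) → Set
SideRule F f p m q u =
  (∀ x → Cyc₃ p x m → onQuad F f p x m u ≡ onQuad F f p x m q - pos (- onQuad F f p m q u))
  × (∀ x → Cyc₃ m x q → onQuad F f m x q u ≡ onQuad F f m x q p + pos (onQuad F f p m q u))

record FlipRule (F : Quaternary) (f : ℕ → Position) (p m q u : ℕ) : Set where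
  field
    half-turn : HalfTurn F
    rule      : SideRule F f p m q u
    rule′     : SideRule F f q u p m

swapRule : ∀ {F f p m q u} → FlipRule F f p m q u → FlipRule F f q u p m
swapRule r = record { half-turn = half-turn ; rule = rule′ ; rule′ = rule }
  where open FlipRule r

-- The darts whose left triangle is created by the flip: the four sides with the quadrilateral on
-- their left, and both directions of the new diagonal.
data Special (p m q u x y : ℕ) : Set where
  pm : x ≡ p → y ≡ m → Special p m q u x y
  mq : x ≡ m → y ≡ q → Special p m q u x y
  qu : x ≡ q → y ≡ u → Special p m q u x y
  up : x ≡ u → y ≡ p → Special p m q u x y
  mu : x ≡ m → y ≡ u → Special p m q u x y
  um : x ≡ u → y ≡ m → Special p m q u x y

swapSpecial : ∀ {p m q u x y} → Special p m q u x y → Special q u p m x y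
swapSpecial (pm a b) = qu a b
swapSpecial (mq a b) = up a b
swapSpecial (qu a b) = pm a b
swapSpecial (up a b) = mq a b
swapSpecial (mu a b) = um a b
swapSpecial (um a b) = mu a b

-- A x y is the third vertex of the triangle to the left of the dart x → y.  Exchanging the
-- diagonal pq of the quadrilateral p m q u for mu turns A into A′.
record Flipped (A A′ : ℕ → ℕ → ℕ) (p m q u : ℕ) : Set where
  field
    quad : Cyc₄ p m q u
    pq≡ : A p q ≡ u
    qp≡ : A q p ≡ m
    pm≡ : A p m ≡ q
    mq≡ : A m q ≡ p
    qu≡ : A q u ≡ p
    up≡ : A u p ≡ q
    pm′ : A′ p m ≡ u
    mq′ : A′ m q ≡ u
    qu′ : A′ q u ≡ m
    up′ : A′ u p ≡ m
    mu′ : A′ m u ≡ p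
    um′ : A′ u m ≡ q
    view : ∀ x y → Special p m q u x y ⊎ (¬ Special p m q u x y × A′ x y ≡ A x y)

  open Distinct quad public

swapFlipped : ∀ {A A′ p m q u} → Flipped A A′ p m q u → Flipped A A′ q u p m
swapFlipped Fl = record
  { quad = rot₄ (rot₄ quad)
  ; pq≡ = qp≡ ; qp≡ = pq≡ ; pm≡ = qu≡ ; mq≡ = up≡ ; qu≡ = pm≡ ; up≡ = mq≡
  ; pm′ = qu′ ; mq′ = up′ ; qu′ = pm′ ; up′ = mq′ ; mu′ = um′ ; um′ = mu′
  ; view = λ x y → [ inj₁ ∘ swapSpecial , (λ { (ns , eq) → inj₂ (ns ∘ swapSpecial , eq) }) ] (view x y)
  }
  where open Flipped Fl

record ProperDart (A : ℕ → ℕ → ℕ) (p m q u x y : ℕ) : Set where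
  field
    cyc    : Cyc₃ x y (A x y)
    link₁  : A y (A x y) ≡ x
    link₂  : A (A x y) x ≡ y
    ≢mu    : ¬ Same m u x y
    side₁≢ : ¬ Same m u y (A x y)
    side₂≢ : ¬ Same m u (A x y) x

swapProper : ∀ {A p m q u x y} → ProperDart A p m q u x y → ProperDart A q u p m x y
swapProper d = record
  { cyc = cyc ; link₁ = link₁ ; link₂ = link₂
  ; ≢mu = ≢mu ∘ swap-Same ; side₁≢ = side₁≢ ∘ swap-Same ; side₂≢ = side₂≢ ∘ swap-Same }
  where open ProperDart d

-- `b` is the adjacency entry between the flipped diagonal and the dart, and `change` the mutation
-- term that this entry produces. Quantifying `rows` over `F` and `f` lets one geometric analysis
-- serve the rows of B and the rows of C alike.
record Effect (A A′ : ℕ → ℕ → ℕ) (p m q u x y : ℕ) (b : ℤ) (change : ℤ → ℤ) : Set where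
  constructor effect
  field
    old  : aroundDart adjacency (position p q) A x y ≡ b
    new  : aroundDart adjacency (position m u) A′ x y ≡ - b
    rows : ∀ {F f} → FlipRule F f p m q u →
      aroundDart F f A′ x y ≡ aroundDart F f A x y + change (onQuad F f p m q u)

data Result (A A′ : ℕ → ℕ → ℕ) (p m q u x y : ℕ) : Set where
  negative  : Effect A A′ p m q u x y -1ℤ (λ c → - pos (- c)) → Result A A′ p m q u x y
  positive  : Effect A A′ p m q u x y 1ℤ pos → Result A A′ p m q u x y
  unchanged : Effect A A′ p m q u x y 0ℤ (λ _ → 0ℤ) → Result A A′ p m q u x y

onQuad-cong : ∀ F {f g} → (∀ x → f x ≡ g x) → ∀ p m q u → onQuad F f p m q u ≡ onQuad F g p m q u
onQuad-cong F {f} {g} h p m q u = trans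
  (cong₂ (λ P M → F P M (f q) (f u)) (h p) (h m)) (cong₂ (F (g p) (g m)) (h q) (h u))

module _ {A A′ : ℕ → ℕ → ℕ} {p m q u x y : ℕ} where

  half-turn-effect : ∀ {b φ} → Effect A A′ p m q u x y b φ → Effect A A′ p m q u y x b φ
  half-turn-effect {φ = φ} (effect o n r) = effect
    (trans (around-half-turn adjacency-half-turn (position p q) A y x) o)
    (trans (around-half-turn adjacency-half-turn (position m u) A′ y x) n)
    λ {F} {f} fr → trans (around-half-turn (FlipRule.half-turn fr) f A′ y x)
      (trans (r fr) (cong (_+ φ (onQuad F f p m q u)) (around-half-turn (FlipRule.half-turn fr) f A x y)))

  half-turn-result : Result A A′ p m q u x y → Result A A′ p m q u y x
  half-turn-result (negative e) = negative (half-turn-effect e)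
  half-turn-result (positive e) = positive (half-turn-effect e)
  half-turn-result (unchanged e) = unchanged (half-turn-effect e)

  swap-effect : ∀ {b φ} → Effect A A′ q u p m x y b φ → Effect A A′ p m q u x y b φ
  swap-effect {φ = φ} (effect o n r) = effect
    (trans (onQuad-cong adjacency (position-comm p q) x (A y x) y (A x y)) o)
    (trans (onQuad-cong adjacency (position-comm m u) x (A′ y x) y (A′ x y)) n)
    λ {F} {f} fr → trans (r (swapRule fr))
      (cong (λ c → aroundDart F f A x y + φ c) (FlipRule.half-turn fr (f q) (f u) (f p) (f m)))

  swap-result : Result A A′ q u p m x y → Result A A′ p m q u x y
  swap-result (negative e) = negative (swap-effect e)
  swap-result (positive e) = positive (swap-effect e)
  swap-result (unchanged e) = unchanged (swap-effect e)

adjacency-value : ∀ s t {p m q u a b c d} → same s t p m ≡ a → same s t m q ≡ b → same s t q u ≡ c → same s t u p ≡ d →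
  onQuad adjacency (position s t) p m q u ≡ a - b + c - d
adjacency-value s t refl refl refl refl = refl

module _ {A A′ : ℕ → ℕ → ℕ} {p m q u : ℕ} (Fl : Flipped A A′ p m q u) where
  open Flipped Fl

  -- The apex `R` beyond pm lies on an arc free of the other corners, so it differs from all of them
  -- and survives the flip. The entry is -1 because the old quadrilateral p R m q has pq as its last
  -- side; afterwards mu is the third side of p R m u.
  effect-pm : ProperDart A p m q u m p → Result A A′ p m q u p m
  effect-pm d = negative (effect old new rows)
    where
    open ProperDart d
    R : ℕ
    R = A m p
    cycR : Cyc₃ p R m
    cycR = rot₃ cyc
    R≢p : R ≢ p
    R≢p = distinct₃ cycR ∘ sym
    R≢q : R ≢ q
    R≢q = apart cycR (split₁ quad)
    R≢m : R ≢ m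
    R≢m = distinct₃ (rot₃ cycR)
    R≢u : R ≢ u
    R≢u = apart cycR (rot₃ (rot₃ (split₂ (rot₄ quad))))
    R′≡ : A′ m p ≡ R
    R′≡ with view m p
    ... | inj₂ (_ , eq) = eq
    ... | inj₁ (pm e _) = contradiction (sym e) p≢m
    ... | inj₁ (mq _ e) = contradiction e p≢q
    ... | inj₁ (qu e _) = contradiction e m≢q
    ... | inj₁ (up e _) = contradiction e m≢u
    ... | inj₁ (mu _ e) = contradiction (sym e) u≢p
    ... | inj₁ (um e _) = contradiction e m≢u
    old : aroundDart adjacency (position p q) A p m ≡ -1ℤ
    old = trans (cong (onQuad adjacency (position p q) p R m) pm≡)
      (adjacency-value p q (same-second p≢q R≢p R≢q) (same-first p≢q R≢p R≢q)
        (same-first p≢q (p≢m ∘ sym) m≢q) (same-≡ p≢q (inj₂ (refl , refl))))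
    new : aroundDart adjacency (position m u) A′ p m ≡ 1ℤ
    new = trans (cong₂ (λ r l → onQuad adjacency (position m u) p r m l) R′≡ pm′)
      (adjacency-value m u (same-second m≢u R≢m R≢u) (same-first m≢u R≢m R≢u)
        (same-≡ m≢u (inj₁ (refl , refl))) (same-second m≢u p≢m (u≢p ∘ sym)))
    rows : ∀ {F f} → FlipRule F f p m q u →
      aroundDart F f A′ p m ≡ aroundDart F f A p m + - pos (- onQuad F f p m q u)
    rows {F} {f} fr = trans (cong₂ (λ r l → onQuad F f p r m l) R′≡ pm′)
      (trans (proj₁ (FlipRule.rule fr) R cycR)
        (cong (λ l → onQuad F f p R m l - pos (- onQuad F f p m q u)) (sym pm≡)))

  effect-mq : ProperDart A p m q u q m → Result A A′ p m q u m q
  effect-mq d = positive (effect old new rows)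
    where
    open ProperDart d
    R : ℕ
    R = A q m
    cycR : Cyc₃ m R q
    cycR = rot₃ cyc
    R≢m : R ≢ m
    R≢m = distinct₃ cycR ∘ sym
    R≢p : R ≢ p
    R≢p = apart cycR (rot₃ (split₁ quad))
    R≢q : R ≢ q
    R≢q = distinct₃ (rot₃ cycR)
    R≢u : R ≢ u
    R≢u = apart cycR (split₁ (rot₄ quad))
    R′≡ : A′ q m ≡ R
    R′≡ with view q m
    ... | inj₂ (_ , eq) = eq
    ... | inj₁ (pm e _) = contradiction (sym e) p≢q
    ... | inj₁ (mq e _) = contradiction (sym e) m≢q
    ... | inj₁ (qu _ e) = contradiction e m≢u
    ... | inj₁ (up e _) = contradiction e q≢u
    ... | inj₁ (mu _ e) = contradiction e m≢u
    ... | inj₁ (um e _) = contradiction e q≢u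
    old : aroundDart adjacency (position p q) A m q ≡ 1ℤ
    old = trans (cong (onQuad adjacency (position p q) m R q) mq≡)
      (adjacency-value p q (same-second p≢q R≢p R≢q) (same-first p≢q R≢p R≢q)
        (same-≡ p≢q (inj₂ (refl , refl))) (same-second p≢q (p≢m ∘ sym) m≢q))
    new : aroundDart adjacency (position m u) A′ m q ≡ -1ℤ
    new = trans (cong₂ (λ r l → onQuad adjacency (position m u) m r q l) R′≡ mq′)
      (adjacency-value m u (same-second m≢u R≢m R≢u) (same-first m≢u R≢m R≢u)
        (same-first m≢u (m≢q ∘ sym) q≢u) (same-≡ m≢u (inj₂ (refl , refl))))
    rows : ∀ {F f} → FlipRule F f p m q u →
      aroundDart F f A′ m q ≡ aroundDart F f A m q + pos (onQuad F f p m q u)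
    rows {F} {f} fr = trans (cong₂ (λ r l → onQuad F f m r q l) R′≡ mq′)
      (trans (proj₂ (FlipRule.rule fr) R cycR)
        (cong (λ l → onQuad F f m R q l + pos (onQuad F f p m q u)) (sym mq≡)))

  -- If the triangle to the left of x → y had pq as another side, it would be one of the two halves
  -- of the quadrilateral, and the links would turn x → y into one of its four sides.
  side-≢pq : ∀ {x y} → ProperDart A p m q u x y → ¬ Special p m q u x y →
    ¬ Same p q y (A x y) × ¬ Same p q (A x y) x
  side-≢pq {x} {y} d ns = side₁ , side₂
    where
    open ProperDart d
    side₁ : ¬ Same p q y (A x y)
    side₁ (inj₁ (e , e′)) = ns (up (trans (sym link₁) (trans (cong₂ A e e′) pq≡)) e)
    side₁ (inj₂ (e , e′)) = ns (mq (trans (sym link₁) (trans (cong₂ A e e′) qp≡)) e)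
    side₂ : ¬ Same p q (A x y) x
    side₂ (inj₁ (e , e′)) = ns (qu e′ (trans (sym link₂) (trans (cong₂ A e e′) pq≡)))
    side₂ (inj₂ (e , e′)) = ns (pm e′ (trans (sym link₂) (trans (cong₂ A e e′) qp≡)))

  effect-other : ∀ {x y} → ProperDart A p m q u x y → ProperDart A p m q u y x →
    ¬ Special p m q u x y → ¬ Special p m q u y x → A′ x y ≡ A x y → A′ y x ≡ A y x → Result A A′ p m q u x y
  effect-other {x} {y} d d′ ns ns′ eq eq′ = unchanged (effect
    (adjacency-value p q (same-≢ p≢q (proj₁ (side-≢pq d′ ns′))) (same-≢ p≢q (proj₂ (side-≢pq d′ ns′)))
      (same-≢ p≢q (proj₁ (side-≢pq d ns))) (same-≢ p≢q (proj₂ (side-≢pq d ns))))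
    (trans (cong₂ (λ r l → onQuad adjacency (position m u) x r y l) eq′ eq)
      (adjacency-value m u (same-≢ m≢u (ProperDart.side₁≢ d′)) (same-≢ m≢u (ProperDart.side₂≢ d′))
        (same-≢ m≢u (ProperDart.side₁≢ d)) (same-≢ m≢u (ProperDart.side₂≢ d))))
    λ {F} {f} _ → trans (cong₂ (λ r l → onQuad F f x r y l) eq′ eq) (sym (ℤₚ.+-identityʳ _)))

module _ {A A′ : ℕ → ℕ → ℕ} {p m q u : ℕ} (Fl : Flipped A A′ p m q u) where
  open Flipped Fl

  special-effect : ∀ {x y} → ProperDart A p m q u y x → ¬ Same m u x y → Special p m q u x y → Result A A′ p m q u x y
  special-effect d _ (pm refl refl) = effect-pm Fl d
  special-effect d _ (mq refl refl) = effect-mq Fl d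
  special-effect d _ (qu refl refl) = swap-result (effect-pm (swapFlipped Fl) (swapProper d))
  special-effect d _ (up refl refl) = swap-result (effect-mq (swapFlipped Fl) (swapProper d))
  special-effect d ≢mu (mu e e′) = contradiction (inj₁ (e , e′)) ≢mu
  special-effect d ≢mu (um e e′) = contradiction (inj₂ (e , e′)) ≢mu

  dart-effect : ∀ {x y} → ProperDart A p m q u x y → ProperDart A p m q u y x → Result A A′ p m q u x y
  dart-effect {x} {y} d d′ with view x y | view y x
  ... | inj₁ s | _ = special-effect d′ (ProperDart.≢mu d) s
  ... | inj₂ _ | inj₁ s = half-turn-result (special-effect d (ProperDart.≢mu d′) s)
  ... | inj₂ (ns , eq) | inj₂ (ns′ , eq′) = effect-other Fl d d′ ns ns′ eq eq′

module _ (s t : ℕ) {p m q u : ℕ} (quad : Cyc₄ p m q u) where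

  private
    f : ℕ → Position
    f = position s t

  shear-side : ∀ {p m q u} → Cyc₄ p m q u → SideRule shear f p m q u
  shear-side {p} {m} {q} {u} quad =
    (λ x c → shear-side₁ (f p) (f x) (f m) (f q) (f u) (position₅ s t (insert c quad))) ,
    (λ x c → shear-side₂ (f m) (f x) (f q) (f u) (f p) (position₅ s t (insert c (rot₄ quad))))

  shear-rule : FlipRule shear f p m q u
  shear-rule = record
    { half-turn = λ P M Q U → eq (bank P) (bank M) (bank Q) (bank U)
    ; rule = shear-side quad
    ; rule′ = shear-side (rot₄ (rot₄ quad)) }
    where
    eq : ∀ a b c d → shearBits a b c d ≡ shearBits c d a b
    eq true  true  true  true  = refl
    eq true  true  true  false = refl
    eq true  true  false true  = refl
    eq true  true  false false = refl
    eq true  false true  true  = refl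
    eq true  false true  false = refl
    eq true  false false true  = refl
    eq true  false false false = refl
    eq false true  true  true  = refl
    eq false true  true  false = refl
    eq false true  false true  = refl
    eq false true  false false = refl
    eq false false true  true  = refl
    eq false false true  false = refl
    eq false false false true  = refl
    eq false false false false = refl

  adjacency-side : ∀ {p m q u} → Cyc₄ p m q u → same s t p q ≡ 0ℤ → same s t m u ≡ 0ℤ → SideRule adjacency f p m q u
  adjacency-side {p} {m} {q} {u} quad pq≡0 mu≡0 =
    (λ x c → adjacency-side₁ (f p) (f x) (f m) (f q) (f u) (position₅ s t (insert c quad)) pq≡0 mu≡0) ,
    (λ x c → adjacency-side₂ (f m) (f x) (f q) (f u) (f p) (position₅ s t (insert c (rot₄ quad))) pq≡0 mu≡0)

  adjacency-rule : same s t p q ≡ 0ℤ → same s t m u ≡ 0ℤ → FlipRule adjacency f p m q u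
  adjacency-rule pq≡0 mu≡0 = record
    { half-turn = adjacency-half-turn
    ; rule = adjacency-side quad pq≡0 mu≡0
    ; rule′ = adjacency-side (rot₄ (rot₄ quad)) (trans (coincidence-comm (f q) (f p)) pq≡0) (trans (coincidence-comm (f u) (f m)) mu≡0) }

update₂ : (ℕ → ℕ → ℕ) → (a b c : ℕ) → ℕ → ℕ → ℕ
update₂ A a b c x y = if does (x ℕ.≟ a) ∧ does (y ℕ.≟ b) then c else A x y

update₂-≡ : ∀ A a b c → update₂ A a b c a b ≡ c
update₂-≡ A a b c rewrite dec-true (a ℕ.≟ a) refl | dec-true (b ℕ.≟ b) refl = refl

update₂-≢ : ∀ A {a b c x y} → ¬ (x ≡ a × y ≡ b) → update₂ A a b c x y ≡ A x y
update₂-≢ A {a} {b} {c} {x} {y} h with x ℕ.≟ a | y ℕ.≟ b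
... | yes e | yes e′ = contradiction (e , e′) h
... | yes _ | no y≢b rewrite dec-false (y ℕ.≟ b) y≢b | ∧-zeroʳ (does (x ℕ.≟ a)) = refl
... | no x≢a | _ rewrite dec-false (x ℕ.≟ a) x≢a = refl

special? : ∀ p m q u x y → Dec (Special p m q u x y)
special? p m q u x y with both? x y p m | both? x y m q | both? x y q u | both? x y u p | both? x y m u | both? x y u m
  where
  both? : ∀ x y a b → Dec (x ≡ a × y ≡ b)
  both? x y a b = (x ℕ.≟ a) ×-dec (y ℕ.≟ b)
... | yes (e , e′) | _ | _ | _ | _ | _ = yes (pm e e′)
... | no _ | yes (e , e′) | _ | _ | _ | _ = yes (mq e e′)
... | no _ | no _ | yes (e , e′) | _ | _ | _ = yes (qu e e′)
... | no _ | no _ | no _ | yes (e , e′) | _ | _ = yes (up e e′)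
... | no _ | no _ | no _ | no _ | yes (e , e′) | _ = yes (mu e e′)
... | no _ | no _ | no _ | no _ | no _ | yes (e , e′) = yes (um e e′)
... | no a | no b | no c | no d | no e | no f = no λ
  { (pm x y) → a (x , y) ; (mq x y) → b (x , y) ; (qu x y) → c (x , y)
  ; (up x y) → d (x , y) ; (mu x y) → e (x , y) ; (um x y) → f (x , y) }

-- The darts of the removed diagonal keep their old apexes, which become junk values.
flipApex : (ℕ → ℕ → ℕ) → (p m q u : ℕ) → ℕ → ℕ → ℕ
flipApex A p m q u = update₂ (update₂ (update₂ (update₂ (update₂ (update₂ A u m q) m u p) u p m) q u m) m q u) p m u

flipped : ∀ {A p m q u} → Cyc₄ p m q u → A p q ≡ u → A q p ≡ m → A p m ≡ q → A m q ≡ p → A q u ≡ p → A u p ≡ q →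
  Flipped A (flipApex A p m q u) p m q u
flipped {A} {p} {m} {q} {u} quad e₁ e₂ e₃ e₄ e₅ e₆ = record
  { quad = quad
  ; pq≡ = e₁ ; qp≡ = e₂ ; pm≡ = e₃ ; mq≡ = e₄ ; qu≡ = e₅ ; up≡ = e₆
  ; pm′ = update₂-≡ A₅ p m u
  ; mq′ = trans (update₂-≢ A₅ (p≢m ∘ sym ∘ proj₁)) (update₂-≡ A₄ m q u)
  ; qu′ = trans (update₂-≢ A₅ (p≢q ∘ sym ∘ proj₁)) (trans (update₂-≢ A₄ (m≢q ∘ sym ∘ proj₁)) (update₂-≡ A₃ q u m))
  ; up′ = trans (update₂-≢ A₅ (u≢p ∘ proj₁)) (trans (update₂-≢ A₄ (m≢u ∘ sym ∘ proj₁))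
      (trans (update₂-≢ A₃ (q≢u ∘ sym ∘ proj₁)) (update₂-≡ A₂ u p m)))
  ; mu′ = trans (update₂-≢ A₅ (p≢m ∘ sym ∘ proj₁)) (trans (update₂-≢ A₄ {x = m} (q≢u ∘ sym ∘ proj₂))
      (trans (update₂-≢ A₃ (m≢q ∘ proj₁)) (trans (update₂-≢ A₂ (m≢u ∘ proj₁)) (update₂-≡ A₁ m u p))))
  ; um′ = trans (update₂-≢ A₅ (u≢p ∘ proj₁)) (trans (update₂-≢ A₄ (m≢u ∘ sym ∘ proj₁))
      (trans (update₂-≢ A₃ (q≢u ∘ sym ∘ proj₁)) (trans (update₂-≢ A₂ {x = u} (p≢m ∘ sym ∘ proj₂))
        (trans (update₂-≢ A₁ (m≢u ∘ sym ∘ proj₁)) (update₂-≡ A u m q)))))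
  ; view = view
  }
  where
  A₁ A₂ A₃ A₄ A₅ : ℕ → ℕ → ℕ
  A₁ = update₂ A u m q
  A₂ = update₂ A₁ m u p
  A₃ = update₂ A₂ u p m
  A₄ = update₂ A₃ q u m
  A₅ = update₂ A₄ m q u
  open Distinct quad
  view : ∀ x y → Special p m q u x y ⊎ (¬ Special p m q u x y × flipApex A p m q u x y ≡ A x y)
  view x y with special? p m q u x y
  ... | yes s = inj₁ s
  ... | no ns = inj₂ (ns , trans (update₂-≢ A₅ (λ { (e , e′) → ns (pm e e′) })) (trans (update₂-≢ A₄ (λ { (e , e′) → ns (mq e e′) }))
      (trans (update₂-≢ A₃ (λ { (e , e′) → ns (qu e e′) })) (trans (update₂-≢ A₂ (λ { (e , e′) → ns (up e e′) }))
        (trans (update₂-≢ A₁ (λ { (e , e′) → ns (mu e e′) })) (update₂-≢ A (λ { (e , e′) → ns (um e e′) })))))))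

-- A triangulation of a polygon with vertices in ℕ: the i-th diagonal joins src i to tgt i,
-- and apex x y is the third vertex of the triangle to the left of the dart x → y
-- (a junk value if there is none).
record Triangulation (n : ℕ) : Set where
  field
    src tgt : Fin n → ℕ
    apex    : ℕ → ℕ → ℕ

  Dart : Fin n → ℕ → ℕ → Set
  Dart i = Same (src i) (tgt i)

  along : Quaternary → (ℕ → Position) → Fin n → ℤ
  along F f k = aroundDart F f apex (src k) (tgt k)

  chord : Fin n → ℕ → Position
  chord i = position (src i) (tgt i)

  signedAdjacency : Matrix n
  signedAdjacency i k = along adjacency (chord i) k

  crossings : (s t : ℕ) → Fin n → ℤ
  crossings s t i = cross s t (src i) (tgt i)

record Valid (N : ℕ) (𝒯 : Triangulation n) : Set where
  open Triangulation 𝒯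

  -- Accounts for the boundary edges of the polygon on the vertices below `N` without arithmetic
  -- modulo `N`: all that matters is that no chord crosses them. Maximality is expressed by `sides`,
  -- as each triangle at a diagonal is closed up by diagonals or such edges.
  Uncrossed : ℕ → ℕ → Set
  Uncrossed x y = ∀ s t → s < N → t < N → cross s t x y ≡ 0ℤ

  Edge : ℕ → ℕ → Set
  Edge x y = (∃[ i ] Dart i x y) ⊎ Uncrossed x y

  field
    cyclic      : ∀ {i x y} → Dart i x y → Cyc₃ x y (apex x y)
    bounded     : ∀ {i x y} → Dart i x y → x < N × apex x y < N
    linked      : ∀ {i x y} → Dart i x y → apex y (apex x y) ≡ x × apex (apex x y) x ≡ y
    sides       : ∀ {i x y} → Dart i x y → Edge y (apex x y) × Edge (apex x y) x
    noncrossing : ∀ i j → cross (src i) (tgt i) (src j) (tgt j) ≡ 0ℤ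
    injective   : ∀ {i j x y} → Dart i x y → Dart j x y → i ≡ j

  dart : ∀ i → Dart i (src i) (tgt i)
  dart i = inj₁ (refl , refl)

  dart⁻¹ : ∀ i → Dart i (tgt i) (src i)
  dart⁻¹ i = inj₂ (refl , refl)

  src≢tgt : ∀ i → src i ≢ tgt i
  src≢tgt i = distinct₃ (cyclic (dart i))

  edge-noncrossing : ∀ i {x y} → Edge x y → cross (src i) (tgt i) x y ≡ 0ℤ
  edge-noncrossing i (inj₁ (j , d)) = trans (cross-Same {src i} {tgt i} d) (noncrossing i j)
  edge-noncrossing i (inj₂ h) = h (src i) (tgt i) (proj₁ (bounded (dart i))) (proj₁ (bounded (dart⁻¹ i)))

-- The flip of a valid triangulation.

module Quadrilateral {N : ℕ} {𝒯 : Triangulation n} (V : Valid N 𝒯) (k : Fin n) where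
  open Triangulation 𝒯
  open Valid V

  p m q u : ℕ
  p = src k
  q = tgt k
  u = apex p q
  m = apex q p

  quad : Cyc₄ p m q u
  quad = glue (rot₃ (cyclic (dart⁻¹ k))) (cyclic (dart k))

  edge-pm : Edge p m
  edge-pm = proj₁ (sides (dart⁻¹ k))
  edge-mq : Edge m q
  edge-mq = proj₂ (sides (dart⁻¹ k))
  edge-qu : Edge q u
  edge-qu = proj₁ (sides (dart k))
  edge-up : Edge u p
  edge-up = proj₂ (sides (dart k))

  apex′ : ℕ → ℕ → ℕ
  apex′ = flipApex apex p m q u

  flip : Flipped apex apex′ p m q u
  flip = flipped quad refl refl (proj₁ (linked (dart⁻¹ k))) (proj₂ (linked (dart⁻¹ k)))
    (proj₁ (linked (dart k))) (proj₂ (linked (dart k)))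

  open Flipped flip hiding (quad) public

  pq-crosses-mu : cross p q m u ≡ 1ℤ
  pq-crosses-mu = cross-separated (inj₁ quad)

  -- Edges of the old triangulation cross none of its diagonals, whereas mu crosses pq.
  edge-≢mu : ∀ {x y} → Edge x y → ¬ Same m u x y
  edge-≢mu e s = contradiction
    (trans (sym pq-crosses-mu) (trans (sym (cross-Same {p} {q} s)) (edge-noncrossing k e))) λ ()

  dart-≢mu : ∀ {i x y} → Dart i x y → ¬ Same m u x y
  dart-≢mu d = edge-≢mu (inj₁ (_ , d))

  dart-≢pq : ∀ {i x y} → i ≢ k → Dart i x y → ¬ Same p q x y
  dart-≢pq i≢k d s = i≢k (injective d s)

  properDart : ∀ {i x y} → Dart i x y → ProperDart apex p m q u x y
  properDart d = record
    { cyc = cyclic d ; link₁ = proj₁ (linked d) ; link₂ = proj₂ (linked d)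
    ; ≢mu = dart-≢mu d ; side₁≢ = edge-≢mu (proj₁ (sides d)) ; side₂≢ = edge-≢mu (proj₂ (sides d)) }

  𝒯′ : Triangulation n
  𝒯′ = record
    { src = λ i → if does (i Fin.≟ k) then m else src i
    ; tgt = λ i → if does (i Fin.≟ k) then u else tgt i
    ; apex = apex′ }

  module T′ = Triangulation 𝒯′

  src′-k : T′.src k ≡ m
  src′-k rewrite dec-true (k Fin.≟ k) refl = refl

  tgt′-k : T′.tgt k ≡ u
  tgt′-k rewrite dec-true (k Fin.≟ k) refl = refl

  src′-≢ : ∀ {i} → i ≢ k → T′.src i ≡ src i
  src′-≢ {i} i≢k rewrite dec-false (i Fin.≟ k) i≢k = refl

  tgt′-≢ : ∀ {i} → i ≢ k → T′.tgt i ≡ tgt i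
  tgt′-≢ {i} i≢k rewrite dec-false (i Fin.≟ k) i≢k = refl

  data DartView (i : Fin n) (x y : ℕ) : Set where
    new : i ≡ k → Same m u x y → DartView i x y
    old : i ≢ k → Dart i x y → DartView i x y

  dartView : ∀ {i x y} → T′.Dart i x y → DartView i x y
  dartView {i} {x} {y} d = by-cases (i Fin.≟ k)
    where
    by-cases : Dec (i ≡ k) → DartView i x y
    by-cases (yes refl) = new refl (subst₂ (λ s t → Same s t x y) src′-k tgt′-k d)
    by-cases (no i≢k) = old i≢k (subst₂ (λ s t → Same s t x y) (src′-≢ i≢k) (tgt′-≢ i≢k) d)

  newDart : ∀ {x y} → Same m u x y → T′.Dart k x y
  newDart {x} {y} = subst₂ (λ s t → Same s t x y) (sym src′-k) (sym tgt′-k)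

  oldDart : ∀ {i x y} → i ≢ k → Dart i x y → T′.Dart i x y
  oldDart {x = x} {y} i≢k = subst₂ (λ s t → Same s t x y) (sym (src′-≢ i≢k)) (sym (tgt′-≢ i≢k))

  Edge′ : ℕ → ℕ → Set
  Edge′ x y = (∃[ i ] T′.Dart i x y) ⊎ Uncrossed x y

  edge′ : ∀ {x y} → ¬ Same p q x y → Edge x y → Edge′ x y
  edge′ ≢pq (inj₂ h) = inj₂ h
  edge′ {x} {y} ≢pq (inj₁ (i , d)) = inj₁ (i , oldDart (λ { refl → ≢pq d }) d)

  -- The vertex `z` is kept apart from `apex′ x y`, so that the remaining fields can be given for a
  -- known vertex and transported once.
  record Triangle′ (x y : ℕ) : Set where
    constructor triangle′
    field
      {z}   : ℕ
      z≡    : apex′ x y ≡ z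
      cyc   : Cyc₃ x y z
      link₁ : apex′ y z ≡ x
      link₂ : apex′ z x ≡ y
      side₁ : Edge′ y z
      side₂ : Edge′ z x
      z<N   : z < N

  not-pq : ∀ {x y} → (x ≢ p × x ≢ q) ⊎ (y ≢ p × y ≢ q) → ¬ Same p q x y
  not-pq (inj₁ (a , b)) (inj₁ (e , _)) = a e
  not-pq (inj₁ (a , b)) (inj₂ (e , _)) = b e
  not-pq (inj₂ (a , b)) (inj₁ (_ , e)) = b e
  not-pq (inj₂ (a , b)) (inj₂ (_ , e)) = a e

  m-out : m ≢ p × m ≢ q
  m-out = p≢m ∘ sym , m≢q
  u-out : u ≢ p × u ≢ q
  u-out = u≢p , q≢u ∘ sym

  e-pm : Edge′ p m
  e-pm = edge′ (not-pq (inj₂ m-out)) edge-pm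
  e-mq : Edge′ m q
  e-mq = edge′ (not-pq (inj₁ m-out)) edge-mq
  e-qu : Edge′ q u
  e-qu = edge′ (not-pq (inj₂ u-out)) edge-qu
  e-up : Edge′ u p
  e-up = edge′ (not-pq (inj₁ u-out)) edge-up
  e-mu : Edge′ m u
  e-mu = inj₁ (k , newDart (inj₁ (refl , refl)))
  e-um : Edge′ u m
  e-um = inj₁ (k , newDart (inj₂ (refl , refl)))

  p<N : p < N
  p<N = proj₁ (bounded (dart k))
  q<N : q < N
  q<N = proj₁ (bounded (dart⁻¹ k))
  m<N : m < N
  m<N = proj₂ (bounded (dart⁻¹ k))
  u<N : u < N
  u<N = proj₂ (bounded (dart k))

  pmu : Cyc₃ p m u
  pmu = rot₃ (rot₃ (split₂ (rot₄ quad)))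
  mqu : Cyc₃ m q u
  mqu = split₁ (rot₄ quad)

  special-triangle : ∀ {x y} → Special p m q u x y → Triangle′ x y
  special-triangle (pm refl refl) = triangle′ pm′ pmu mu′ up′ e-mu e-up u<N
  special-triangle (mq refl refl) = triangle′ mq′ mqu qu′ um′ e-qu e-um u<N
  special-triangle (qu refl refl) = triangle′ qu′ (rot₃ mqu) um′ mq′ e-um e-mq m<N
  special-triangle (up refl refl) = triangle′ up′ (rot₃ (rot₃ pmu)) pm′ mu′ e-pm e-mu m<N
  special-triangle (mu refl refl) = triangle′ mu′ (rot₃ pmu) up′ pm′ e-up e-pm p<N
  special-triangle (um refl refl) = triangle′ um′ (rot₃ (rot₃ mqu)) mq′ qu′ e-mq e-qu q<N

  -- Were the apex at one of the two further sides altered, that side would be special: either it is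
  -- mu, which no old edge is, or its old triangle makes x → y special or equal to pq.
  old-triangle : ∀ {i x y} → i ≢ k → Dart i x y → ¬ Special p m q u x y → apex′ x y ≡ apex x y → Triangle′ x y
  old-triangle {i} {x} {y} i≢k d ns eq = triangle′ eq (cyclic d)
    (trans same₁ l₁) (trans same₂ l₂)
    (edge′ (proj₁ sides≢) (proj₁ (sides d))) (edge′ (proj₂ sides≢) (proj₂ (sides d))) (proj₂ (bounded d))
    where
    z : ℕ
    z = apex x y
    l₁ : apex y z ≡ x
    l₁ = proj₁ (linked d)
    l₂ : apex z x ≡ y
    l₂ = proj₂ (linked d)
    sides≢ : ¬ Same p q y z × ¬ Same p q z x
    sides≢ = side-≢pq flip (properDart d) ns
    x≡ : ∀ {a b c} → y ≡ a → z ≡ b → apex a b ≡ c → x ≡ c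
    x≡ e e′ e″ = trans (sym l₁) (trans (cong₂ apex e e′) e″)
    y≡ : ∀ {a b c} → z ≡ a → x ≡ b → apex a b ≡ c → y ≡ c
    y≡ e e′ e″ = trans (sym l₂) (trans (cong₂ apex e e′) e″)
    same₁ : apex′ y z ≡ apex y z
    same₁ with view y z
    ... | inj₂ (_ , e) = e
    ... | inj₁ (pm e e′) = contradiction (inj₂ (x≡ e e′ pm≡ , e)) (dart-≢pq i≢k d)
    ... | inj₁ (mq e e′) = contradiction (pm (x≡ e e′ mq≡) e) ns
    ... | inj₁ (qu e e′) = contradiction (inj₁ (x≡ e e′ qu≡ , e)) (dart-≢pq i≢k d)
    ... | inj₁ (up e e′) = contradiction (qu (x≡ e e′ up≡) e) ns
    ... | inj₁ (mu e e′) = contradiction (inj₁ (e , e′)) (edge-≢mu (proj₁ (sides d)))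
    ... | inj₁ (um e e′) = contradiction (inj₂ (e , e′)) (edge-≢mu (proj₁ (sides d)))
    same₂ : apex′ z x ≡ apex z x
    same₂ with view z x
    ... | inj₂ (_ , e) = e
    ... | inj₁ (pm e e′) = contradiction (mq e′ (y≡ e e′ pm≡)) ns
    ... | inj₁ (mq e e′) = contradiction (inj₂ (e′ , y≡ e e′ mq≡)) (dart-≢pq i≢k d)
    ... | inj₁ (qu e e′) = contradiction (up e′ (y≡ e e′ qu≡)) ns
    ... | inj₁ (up e e′) = contradiction (inj₁ (e′ , y≡ e e′ up≡)) (dart-≢pq i≢k d)
    ... | inj₁ (mu e e′) = contradiction (inj₁ (e , e′)) (edge-≢mu (proj₂ (sides d)))
    ... | inj₁ (um e e′) = contradiction (inj₂ (e , e′)) (edge-≢mu (proj₂ (sides d)))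

  triangle : ∀ {i x y} → T′.Dart i x y → Triangle′ x y
  triangle {i} {x} {y} d with dartView d
  ... | new _ (inj₁ (e , e′)) = special-triangle (mu e e′)
  ... | new _ (inj₂ (e , e′)) = special-triangle (um e e′)
  ... | old i≢k d₀ with view x y
  ...   | inj₁ s = special-triangle s
  ...   | inj₂ (ns , eq) = old-triangle i≢k d₀ ns eq

  cross-mu : ∀ {i} → i ≢ k → cross (src i) (tgt i) m u ≡ 0ℤ
  cross-mu {i} i≢k = crossing-flip (f p) (f m) (f q) (f u) (position₄ (src i) (tgt i) quad)
    (edge-noncrossing i edge-pm) (edge-noncrossing i edge-mq) (edge-noncrossing i edge-qu) (edge-noncrossing i edge-up)
    (same-≢ (src≢tgt i) λ s → i≢k (injective s (dart k)))
    where
    f : ℕ → Position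
    f = chord i

  noncrossing′ : ∀ i j → cross (T′.src i) (T′.tgt i) (T′.src j) (T′.tgt j) ≡ 0ℤ
  noncrossing′ i j = by-cases (i Fin.≟ k) (j Fin.≟ k)
    where
    resp : ∀ {s t x y s′ t′ x′ y′} → s ≡ s′ → t ≡ t′ → x ≡ x′ → y ≡ y′ → cross s′ t′ x′ y′ ≡ 0ℤ → cross s t x y ≡ 0ℤ
    resp refl refl refl refl z = z
    by-cases : Dec (i ≡ k) → Dec (j ≡ k) → cross (T′.src i) (T′.tgt i) (T′.src j) (T′.tgt j) ≡ 0ℤ
    by-cases (yes refl) (yes refl) = resp src′-k tgt′-k src′-k tgt′-k (cross-unseparated common-end-unseparated)
    by-cases (yes refl) (no j≢k) = resp src′-k tgt′-k (src′-≢ j≢k) (tgt′-≢ j≢k) (cross-symmetric (cross-mu j≢k))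
    by-cases (no i≢k) (yes refl) = resp (src′-≢ i≢k) (tgt′-≢ i≢k) src′-k tgt′-k (cross-mu i≢k)
    by-cases (no i≢k) (no j≢k) = resp (src′-≢ i≢k) (tgt′-≢ i≢k) (src′-≢ j≢k) (tgt′-≢ j≢k) (noncrossing i j)

  valid′ : Valid N 𝒯′
  valid′ = record
    { cyclic = λ d → let t = triangle d in subst (Cyc₃ _ _) (sym (Triangle′.z≡ t)) (Triangle′.cyc t)
    ; bounded = λ d → let t = triangle d in
        dart-bounded (dartView d) , subst (_< N) (sym (Triangle′.z≡ t)) (Triangle′.z<N t)
    ; linked = λ {_} {x} {y} d → let t = triangle d in
        subst (λ z → apex′ y z ≡ x × apex′ z x ≡ y) (sym (Triangle′.z≡ t)) (Triangle′.link₁ t , Triangle′.link₂ t)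
    ; sides = λ {_} {x} {y} d → let t = triangle d in
        subst (λ z → Edge′ y z × Edge′ z x) (sym (Triangle′.z≡ t)) (Triangle′.side₁ t , Triangle′.side₂ t)
    ; noncrossing = noncrossing′
    ; injective = λ d d′ → inject (dartView d) (dartView d′)
    }
    where
    dart-bounded : ∀ {i x y} → DartView i x y → x < N
    dart-bounded (new _ (inj₁ (refl , _))) = m<N
    dart-bounded (new _ (inj₂ (refl , _))) = u<N
    dart-bounded (old _ d) = proj₁ (bounded d)
    inject : ∀ {i j x y} → DartView i x y → DartView j x y → i ≡ j
    inject (new e _) (new e′ _) = trans e (sym e′)
    inject (new _ s) (old _ d) = contradiction s (dart-≢mu d)
    inject (old _ d) (new _ s) = contradiction s (dart-≢mu d)
    inject (old _ d) (old _ d′) = injective d d′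

-- Matrix mutation realised by flips.

shear-quarter-turn : ∀ P M Q U → shear M Q U P ≡ - shear P M Q U
shear-quarter-turn P M Q U = eq (bank P) (bank M) (bank Q) (bank U)
  where
  eq : ∀ a b c d → shearBits b c d a ≡ - shearBits a b c d
  eq true  true  true  true  = refl
  eq true  true  true  false = refl
  eq true  true  false true  = refl
  eq true  true  false false = refl
  eq true  false true  true  = refl
  eq true  false true  false = refl
  eq true  false false true  = refl
  eq true  false false false = refl
  eq false true  true  true  = refl
  eq false true  true  false = refl
  eq false true  false true  = refl
  eq false true  false false = refl
  eq false false true  true  = refl
  eq false false true  false = refl
  eq false false false true  = refl
  eq false false false false = refl

-- The new diagonal mu lies in the same quadrilateral, read from m instead of p. This is why
-- mutation negates column k.
adjacency-quarter-turn : ∀ P M Q U → adjacency M Q U P ≡ - adjacency P M Q U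
adjacency-quarter-turn P M Q U = eq (coincidence P M) (coincidence M Q) (coincidence Q U) (coincidence U P)
  where
  eq : ∀ a b c d → b - c + d - a ≡ - (a - b + c - d)
  eq = solve-∀

Realises : Triangulation n → Matrix n → Set
Realises 𝒯 B = ∀ i j → B i j ≡ Triangulation.signedAdjacency 𝒯 i j

diagonal-zero : ∀ {N} {𝒯 : Triangulation n} → Valid N 𝒯 → ∀ k → Triangulation.signedAdjacency 𝒯 k k ≡ 0ℤ
diagonal-zero V k = adjacency-value p q
  (avoid (inj₂ m-out)) (avoid (inj₁ m-out)) (avoid (inj₂ u-out)) (avoid (inj₁ u-out))
  where
  open Quadrilateral V k
  avoid : ∀ {x y} → (x ≢ p × x ≢ q) ⊎ (y ≢ p × y ≢ q) → same p q x y ≡ 0ℤ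
  avoid h = same-≢ p≢q (not-pq h)

module Mutation {N : ℕ} {𝒯 : Triangulation n} (V : Valid N 𝒯) (k : Fin n) where
  open Triangulation 𝒯
  open Valid V
  open Quadrilateral V k

  along′-k : ∀ F f → T′.along F f k ≡ onQuad F f m q u p
  along′-k F f = trans (cong₂ (aroundDart F f apex′) src′-k tgt′-k)
    (cong₂ (λ r l → onQuad F f m r u l) um′ mu′)

  along′-≢ : ∀ F f {j} → j ≢ k → T′.along F f j ≡ aroundDart F f apex′ (src j) (tgt j)
  along′-≢ F f j≢k = cong₂ (aroundDart F f apex′) (src′-≢ j≢k) (tgt′-≢ j≢k)

  result : ∀ j → Result apex apex′ p m q u (src j) (tgt j)
  result j = dart-effect flip (properDart (dart j)) (properDart (dart⁻¹ j))

  row-mutation : ∀ {F f} → FlipRule F f p m q u → ∀ {j} → j ≢ k →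
    T′.along F f j ≡ along F f j + pos (along F f k) * pos (signedAdjacency k j)
      - pos (- along F f k) * pos (- signedAdjacency k j)
  row-mutation {F} {f} fr {j} j≢k = trans (along′-≢ F f j≢k) (go (result j))
    where
    X c : ℤ
    X = along F f j
    -- The three identities below write out the mutation formula for the entry -1, 1 and 0.
    c = along F f k
    eq₁ : ∀ X a b → X + - b ≡ X + a * 0ℤ - b * 1ℤ
    eq₁ = solve-∀
    eq₂ : ∀ X a b → X + a ≡ X + a * 1ℤ - b * 0ℤ
    eq₂ = solve-∀
    eq₃ : ∀ X a b → X + 0ℤ ≡ X + a * 0ℤ - b * 0ℤ
    eq₃ = solve-∀
    go : Result apex apex′ p m q u (src j) (tgt j) → aroundDart F f apex′ (src j) (tgt j) ≡
      X + pos c * pos (signedAdjacency k j) - pos (- c) * pos (- signedAdjacency k j)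
    go (negative (effect b≡ _ rows)) = trans (rows fr)
      (trans (eq₁ X (pos c) (pos (- c))) (cong (λ b → X + pos c * pos b - pos (- c) * pos (- b)) (sym b≡)))
    go (positive (effect b≡ _ rows)) = trans (rows fr)
      (trans (eq₂ X (pos c) (pos (- c))) (cong (λ b → X + pos c * pos b - pos (- c) * pos (- b)) (sym b≡)))
    go (unchanged (effect b≡ _ rows)) = trans (rows fr)
      (trans (eq₃ X (pos c) (pos (- c))) (cong (λ b → X + pos c * pos b - pos (- c) * pos (- b)) (sym b≡)))

  new-row : ∀ {j} → j ≢ k → T′.signedAdjacency k j ≡ - signedAdjacency k j
  new-row {j} j≢k = trans
    (onQuad-cong adjacency (λ x → cong₂ (λ s t → position s t x) src′-k tgt′-k) _ _ _ _)
    (trans (along′-≢ adjacency (position m u) j≢k) (go (result j)))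
    where
    go : Result apex apex′ p m q u (src j) (tgt j) →
      aroundDart adjacency (position m u) apex′ (src j) (tgt j) ≡ - signedAdjacency k j
    go (negative (effect b≡ b′≡ _)) = trans b′≡ (cong (-_) (sym b≡))
    go (positive (effect b≡ b′≡ _)) = trans b′≡ (cong (-_) (sym b≡))
    go (unchanged (effect b≡ b′≡ _)) = trans b′≡ (cong (-_) (sym b≡))

  chord′-≢ : ∀ {i} → i ≢ k → ∀ j → T′.signedAdjacency i j ≡ T′.along adjacency (chord i) j
  chord′-≢ i≢k j = onQuad-cong adjacency (λ x → cong₂ (λ s t → position s t x) (src′-≢ i≢k) (tgt′-≢ i≢k)) _ _ _ _

  adjacency-flip-rule : ∀ {i} → i ≢ k → FlipRule adjacency (chord i) p m q u
  adjacency-flip-rule {i} i≢k = adjacency-rule (src i) (tgt i) quad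
    (same-≢ (src≢tgt i) λ s → i≢k (injective s (dart k)))
    (same-≢ (src≢tgt i) λ s → edge-≢mu (inj₁ (i , s)) (inj₁ (refl , refl)))

  realises-mutB : ∀ {B} → Realises 𝒯 B → Realises 𝒯′ (mutB k B)
  realises-mutB {B} h i j = by-cases (i Fin.≟ k) (j Fin.≟ k)
    where
    by-cases : Dec (i ≡ k) → Dec (j ≡ k) → mutB k B i j ≡ T′.signedAdjacency i j
    by-cases (yes refl) (yes refl) = trans (mutB-row k B k)
      (trans (cong (-_) (trans (h k k) (diagonal-zero V k))) (sym (diagonal-zero valid′ k)))
    by-cases (yes refl) (no j≢k) = trans (mutB-row k B j) (trans (cong (-_) (h k j)) (sym (new-row j≢k)))
    by-cases (no i≢k) (yes refl) = trans (mutB-column k B i) (trans (cong (-_) (h i k))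
      (sym (trans (chord′-≢ i≢k k) (trans (along′-k adjacency (chord i))
        (adjacency-quarter-turn (chord i p) (chord i m) (chord i q) (chord i u))))))
    by-cases (no i≢k) (no j≢k) = trans (mutB-else k B i≢k j≢k) (trans
      (cong₂ _-_ (cong₂ _+_ (h i j) (cong₂ (λ a b → pos a * pos b) (h i k) (h k j)))
        (cong₂ (λ a b → pos (- a) * pos (- b)) (h i k) (h k j)))
      (sym (trans (chord′-≢ i≢k j) (row-mutation (adjacency-flip-rule i≢k) j≢k))))

  shear-mutC : ∀ {B C} s t i → Realises 𝒯 B → (∀ j → C i j ≡ along shear (position s t) j) →
    ∀ j → mutC k B C i j ≡ T′.along shear (position s t) j
  shear-mutC {B} {C} s t i hB hC j = by-cases (j Fin.≟ k)
    where
    f : ℕ → Position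
    f = position s t
    by-cases : Dec (j ≡ k) → mutC k B C i j ≡ T′.along shear f j
    by-cases (yes refl) = trans (mutC-column k B C i) (trans (cong (-_) (hC k))
      (sym (trans (along′-k shear f) (shear-quarter-turn (f p) (f m) (f q) (f u)))))
    by-cases (no j≢k) = trans (mutC-else k B C i j≢k) (trans
      (cong₂ _-_ (cong₂ _+_ (hC j) (cong₂ (λ a b → pos a * pos b) (hC k) (hB k j)))
        (cong₂ (λ a b → pos (- a) * pos (- b)) (hC k) (hB k j)))
      (sym (row-mutation (shear-rule s t quad) j≢k)))

  -- The sum selects the diagonal that coincides with xy, if there is one. A boundary edge carries
  -- no variable, consistently with its crossing number 0.
  sum-edge : ∀ {s t} → s < N → t < N → ∀ {x y} → Edge x y →
    sum (λ i → same (src i) (tgt i) x y * crossings s t i) ≡ cross s t x y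
  sum-edge {s} {t} _ _ {x} {y} (inj₁ (j , d)) = trans
    (sum-single j _ λ i i≢j → cong (_* crossings s t i) (same-≢ (src≢tgt i) λ s → i≢j (injective s d)))
    (trans (cong (_* crossings s t j) (same-≡ (src≢tgt j) d))
      (trans (ℤₚ.*-identityˡ _) (sym (cross-Same {s} {t} d))))
  sum-edge {s} {t} s<N t<N {x} {y} (inj₂ h) = trans (sum-zero _ zero-term) (sym (h s t s<N t<N))
    where
    same? : ∀ i → Dec (Dart i x y)
    same? i = ((x ℕ.≟ src i) ×-dec (y ℕ.≟ tgt i)) ⊎-dec ((x ℕ.≟ tgt i) ×-dec (y ℕ.≟ src i))
    zero-term : ∀ i → same (src i) (tgt i) x y * crossings s t i ≡ 0ℤ
    zero-term i with same? i
    ... | yes d = trans (cong (same (src i) (tgt i) x y *_) (trans (sym (cross-Same {s} {t} d)) (h s t s<N t<N)))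
      (ℤₚ.*-zeroʳ (same (src i) (tgt i) x y))
    ... | no nd = cong (_* crossings s t i) (same-≢ (src≢tgt i) nd)

  sum-edges : ∀ {s t} → s < N → t < N → ∀ {x y x′ y′} → Edge x y → Edge x′ y′ → (b : Fin n → ℤ) →
    (∀ i → b i ≡ same (src i) (tgt i) x y + same (src i) (tgt i) x′ y′) →
    sum (λ i → b i * crossings s t i) ≡ cross s t x y + cross s t x′ y′
  sum-edges {s} {t} s<N t<N {x} {y} {x′} {y′} e e′ b hb = trans
    (sum-cong-≗ λ i → trans (cong (_* crossings s t i) (hb i)) (ℤₚ.*-distribʳ-+ (crossings s t i) (same (src i) (tgt i) x y) _))
    (trans (∑-distrib-+ (λ i → same (src i) (tgt i) x y * crossings s t i) (λ i → same (src i) (tgt i) x′ y′ * crossings s t i))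
      (cong₂ _+_ (sum-edge s<N t<N e) (sum-edge s<N t<N e′)))

  open Tropical n

  -- The positive entries of column k mark the sides pm and qu, the negative ones mq and up, so the
  -- two monomials become the two sides of the maximum in `tropicalPtolemy`.
  tropical-crossings : ∀ {B C s t} → s < N → t < N → ∀ j → Realises 𝒯 B → (∀ i → C j i ≡ along shear (position s t) i) →
    tropicalMutate (yE j) (crossings s t) B C k ≡ cross s t m u
  tropical-crossings {B} {C} {s} {t} s<N t<N j hB hC = trans
    (cong₂ (λ a b → a ⊔ b - crossings s t k) term⁺ term⁻)
    (tropicalPtolemy (f p) (f m) (f q) (f u) (position₄ s t quad))
    where
    f : ℕ → Position
    f = position s t
    g : Fin n → ℕ → Position
    g = chord
    term⁺ : tropicalTerm (yE j) (crossings s t) (λ i → B i k) (λ i → C i k)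
      ≡ (cross s t p m + cross s t q u) + pos (onQuad shear f p m q u)
    term⁺ = cong₂ _+_
      (sum-edges s<N t<N edge-pm edge-qu (λ i → pos (B i k))
        λ i → trans (cong pos (hB i k)) (pos-adjacency (g i p) (g i m) (g i q) (g i u) (position₄ (src i) (tgt i) quad)))
      (trans (sum-yE j (λ i → pos (C i k))) (cong pos (hC k)))
    term⁻ : tropicalTerm (yE j) (crossings s t) (λ i → - B i k) (λ i → - C i k)
      ≡ (cross s t m q + cross s t u p) + pos (- onQuad shear f p m q u)
    term⁻ = cong₂ _+_
      (sum-edges s<N t<N edge-mq edge-up (λ i → pos (- B i k))
        λ i → trans (cong (pos ∘ -_) (hB i k)) (neg-adjacency (g i p) (g i m) (g i q) (g i u) (position₄ (src i) (tgt i) quad)))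
      (trans (sum-yE j (λ i → pos (- C i k))) (cong (pos ∘ -_) (hC k)))

  crossings′-k : ∀ s t → T′.crossings s t k ≡ cross s t m u
  crossings′-k s t = cong₂ (cross s t) src′-k tgt′-k

  crossings′-≢ : ∀ s t {i} → i ≢ k → T′.crossings s t i ≡ crossings s t i
  crossings′-≢ s t i≢k = cong₂ (cross s t) (src′-≢ i≢k) (tgt′-≢ i≢k)

-- The fan triangulation.

fan : (n : ℕ) → Triangulation n
-- All diagonals start at 0. Their other ends begin at 2 because 0 and 1 span a boundary edge.
fan n = record { src = λ _ → 0 ; tgt = λ i → 2 ℕ.+ toℕ i ; apex = fanApex }
  where
  -- The triangles are 0, y, y + 1: to the left of 0 → y the apex is y + 1, to the left of x + 1 → 0
  -- it is x, and to the left of y → y + 1 it is 0.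
  fanApex : ℕ → ℕ → ℕ
  fanApex zero y = suc y
  fanApex (suc x) zero = x
  fanApex (suc x) (suc y) = 0

module _ (n : ℕ) where
  open Triangulation (fan n)

  private
    N : ℕ
    N = 3 ℕ.+ n

    Uncrossed : ℕ → ℕ → Set
    Uncrossed x y = ∀ s t → s < N → t < N → cross s t x y ≡ 0ℤ

    Edge : ℕ → ℕ → Set
    Edge x y = (∃[ i ] Dart i x y) ⊎ Uncrossed x y

    consecutive : ∀ x → Uncrossed x (suc x)
    consecutive x s t _ _ = cross-unseparated λ
      { (inj₁ (inj₁ (_ , p , q))) → gap p q
      ; (inj₁ (inj₂ (inj₁ (p , q , _)))) → gap p q
      ; (inj₁ (inj₂ (inj₂ (inj₁ (_ , p , q))))) → back (ℕₚ.<-trans p q)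
      ; (inj₁ (inj₂ (inj₂ (inj₂ (p , q , _))))) → back (ℕₚ.<-trans p q)
      ; (inj₂ (inj₁ (_ , p , q))) → back (ℕₚ.<-trans p q)
      ; (inj₂ (inj₂ (inj₁ (p , q , _)))) → back (ℕₚ.<-trans p q)
      ; (inj₂ (inj₂ (inj₂ (inj₁ (_ , p , q))))) → gap p q
      ; (inj₂ (inj₂ (inj₂ (inj₂ (p , q , _))))) → gap p q }
      where
      gap : ∀ {t} → x < t → ¬ t < suc x
      gap p (s≤s q) = ℕₚ.<⇒≱ p q
      back : ¬ suc x < x
      back p = ℕₚ.<-asym p (ℕₚ.n<1+n x)

    closing : Uncrossed 0 (2 ℕ.+ n)
    closing s t s<N t<N = cross-unseparated λ
      { (inj₁ (inj₁ (() , _)))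
      ; (inj₁ (inj₂ (inj₁ (_ , _ , p)))) → last p s<N
      ; (inj₁ (inj₂ (inj₂ (inj₁ (_ , p , _))))) → last p s<N
      ; (inj₁ (inj₂ (inj₂ (inj₂ (p , _))))) → last p s<N
      ; (inj₂ (inj₁ (_ , p , _))) → last p t<N
      ; (inj₂ (inj₂ (inj₁ (p , _)))) → last p t<N
      ; (inj₂ (inj₂ (inj₂ (inj₁ (() , _)))))
      ; (inj₂ (inj₂ (inj₂ (inj₂ (_ , _ , p))))) → last p t<N }
      where
      last : ∀ {s} → 2 ℕ.+ n < s → ¬ s < N
      last p (s≤s q) = ℕₚ.<⇒≱ p q

    spoke : ∀ v → suc v < N → Edge 0 (suc v)
    spoke zero _ = inj₂ (consecutive 0)
    spoke (suc w) (s≤s (s≤s (s≤s w≤n))) with w ℕ.<? n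
    ... | yes w<n = inj₁ (Fin.fromℕ< w<n , inj₁ (refl , cong (2 ℕ.+_) (sym (Finₚ.toℕ-fromℕ< w<n))))
    ... | no w≮n rewrite ℕₚ.≤-antisym w≤n (ℕₚ.≮⇒≥ w≮n) = inj₂ closing

    reverse : ∀ {x y} → Edge x y → Edge y x
    reverse (inj₁ (i , d)) = inj₁ (i , reverse-Same d)
    reverse {x} {y} (inj₂ h) = inj₂ λ s t s<N t<N → trans (cross-comm s t y x) (h s t s<N t<N)

    below-N : ∀ (i : Fin n) → 2 ℕ.+ toℕ i < 2 ℕ.+ n
    below-N i = s≤s (s≤s (Finₚ.toℕ<n i))

  fan-valid : Valid N (fan n)
  fan-valid = record
    { cyclic = λ { {i} (inj₁ (refl , refl)) → inj₁ (s≤s z≤n , ℕₚ.n<1+n _)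
                 ; {i} (inj₂ (refl , refl)) → inj₂ (inj₁ (s≤s z≤n , ℕₚ.n<1+n _)) }
    ; bounded = λ { {i} (inj₁ (refl , refl)) → s≤s z≤n , s≤s (below-N i)
                  ; {i} (inj₂ (refl , refl)) → ℕₚ.m<n⇒m<1+n (below-N i)
                                             , ℕₚ.<-trans (ℕₚ.n<1+n _) (ℕₚ.m<n⇒m<1+n (below-N i)) }
    ; linked = λ { (inj₁ (refl , refl)) → refl , refl ; (inj₂ (refl , refl)) → refl , refl }
    ; sides = λ { {i} (inj₁ (refl , refl)) → inj₂ (consecutive (2 ℕ.+ toℕ i)) , reverse (spoke (2 ℕ.+ toℕ i) (s≤s (below-N i)))
                ; {i} (inj₂ (refl , refl)) → spoke (toℕ i) (ℕₚ.<-trans (ℕₚ.n<1+n _) (ℕₚ.m<n⇒m<1+n (below-N i)))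
                                           , inj₂ (consecutive (suc (toℕ i))) }
    ; noncrossing = λ i j → cross-unseparated common-end-unseparated
    ; injective = λ { (inj₁ (_ , e)) (inj₁ (_ , e′)) → toℕ-inj (trans (sym e) e′)
                    ; (inj₁ (refl , _)) (inj₂ (() , _))
                    ; (inj₂ (refl , _)) (inj₁ (() , _))
                    ; (inj₂ (e , _)) (inj₂ (e′ , _)) → toℕ-inj (trans (sym e) e′) }
    }
    where
    toℕ-inj : ∀ {i j : Fin n} → 2 ℕ.+ toℕ i ≡ 2 ℕ.+ toℕ j → i ≡ j
    toℕ-inj e = Finₚ.toℕ-injective (ℕₚ.suc-injective (ℕₚ.suc-injective e))

  -- The quadrilateral around diagonal k is 0, k + 1, k + 2, k + 3. Its sides at 0 are the
  -- neighbouring diagonals k - 1, with sign +, and k + 1, with sign -, as far as these exist; the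
  -- other two sides lie on the boundary.
  fan-realises : Realises (fan n) (linA n)
  fan-realises i k = by-cases (toℕ k ℕ.≟ suc (toℕ i)) (toℕ i ℕ.≟ suc (toℕ k))
    where
    I K : ℕ
    I = toℕ i
    K = toℕ k
    outer : ∀ {x y} → x ≢ 0 → y ≢ 0 → same 0 (2 ℕ.+ I) x y ≡ 0ℤ
    outer x≢0 y≢0 = same-≢ (λ ()) λ { (inj₁ (e , _)) → x≢0 e ; (inj₂ (_ , e)) → y≢0 e }
    value : ∀ {a d} → same 0 (2 ℕ.+ I) 0 (1 ℕ.+ K) ≡ a → same 0 (2 ℕ.+ I) (3 ℕ.+ K) 0 ≡ d →
      signedAdjacency i k ≡ a - 0ℤ + 0ℤ - d
    value ea ed = adjacency-value 0 (2 ℕ.+ I) ea (outer (λ ()) (λ ())) (outer (λ ()) (λ ())) ed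
    first-≢ : K ≢ suc I → same 0 (2 ℕ.+ I) 0 (1 ℕ.+ K) ≡ 0ℤ
    first-≢ ne = same-≢ {0} {2 ℕ.+ I} (λ ()) λ { (inj₁ (_ , e)) → ne (ℕₚ.suc-injective e) ; (inj₂ (() , _)) }
    second-≢ : I ≢ suc K → same 0 (2 ℕ.+ I) (3 ℕ.+ K) 0 ≡ 0ℤ
    second-≢ ne = same-≢ {0} {2 ℕ.+ I} (λ ()) λ
      { (inj₁ (() , _)) ; (inj₂ (e , _)) → ne (sym (ℕₚ.suc-injective (ℕₚ.suc-injective e))) }
    by-cases : Dec (K ≡ suc I) → Dec (I ≡ suc K) → linA n i k ≡ signedAdjacency i k
    by-cases (yes e) _ rewrite dec-true (K ℕ.≟ suc I) e = sym (value
      (same-≡ {0} {2 ℕ.+ I} (λ ()) (inj₁ (refl , cong suc e)))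
      (second-≢ λ e′ → ℕₚ.<-asym (ℕₚ.≤-reflexive (sym e)) (ℕₚ.≤-reflexive (sym e′))))
    by-cases (no ne) (yes e) rewrite dec-false (K ℕ.≟ suc I) ne | dec-true (I ℕ.≟ suc K) e =
      sym (value (first-≢ ne) (same-≡ {0} {2 ℕ.+ I} (λ ()) (inj₂ (cong (2 ℕ.+_) (sym e) , refl))))
    by-cases (no ne) (no ne′) rewrite dec-false (K ℕ.≟ suc I) ne | dec-false (I ℕ.≟ suc K) ne′ =
      sym (value (first-≢ ne) (second-≢ ne′))

-- Seeds modelled by triangulations.

realise-mutSeq : ∀ {N} ks {B : Matrix n} {𝒯 : Triangulation n} → Valid N 𝒯 → Realises 𝒯 B →
  ∃[ 𝒯′ ] (Valid N 𝒯′ × Realises 𝒯′ (mutSeq ks B))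
realise-mutSeq [] {𝒯 = 𝒯} V R = 𝒯 , V , R
realise-mutSeq (k ∷ ks) V R =
  realise-mutSeq ks (Quadrilateral.valid′ V k) (Mutation.realises-mutB V k R)

module Seeds {N : ℕ} {𝒯₀ : Triangulation n} (V₀ : Valid N 𝒯₀) {B₀ : Matrix n} (R₀ : Realises 𝒯₀ B₀) where
  open Triangulation 𝒯₀
  open Valid V₀
  open Tropical n
  open Leading using (Lead)

  -- `src`, `tgt` and `chord` refer to the initial triangulation and stay fixed while `𝒯` is
  -- flipped: row j of `C` and the degree in yⱼ are both measured against the initial diagonal j.
  record Seed (x : Cluster n) (B C : Matrix n) : Set where
    field
      𝒯        : Triangulation n
      valid    : Valid N 𝒯
      realises : Realises 𝒯 B
      shears   : ∀ j i → C j i ≡ Triangulation.along 𝒯 shear (chord j) i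
      degrees  : ∀ j i → Lead (yE j) (x i) (Triangulation.crossings 𝒯 (src j) (tgt j) i)
      graded   : ∀ r → Grading.Graded B₀ r x B C

  initial-seed : Seed wVar B₀ idMatrix
  initial-seed = record
    { 𝒯 = 𝒯₀ ; valid = V₀ ; realises = R₀ ; shears = shears ; degrees = degrees
    ; graded = Grading.graded-initial B₀ }
    where
    identity : ∀ j i → Dec (j ≡ i) → idMatrix j i ≡ same (src j) (tgt j) (src i) (tgt i)
    identity j i (yes refl) = trans (idMatrix-≡ j) (sym (same-≡ (src≢tgt j) (dart j)))
    identity j i (no j≢i) = trans (idMatrix-≢ j≢i) (sym (same-≢ (src≢tgt j) λ s → j≢i (injective s (dart i))))
    shears : ∀ j i → idMatrix j i ≡ along shear (chord j) i
    shears j i = trans (identity j i (j Fin.≟ i)) (sym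
      (shear-initial (chord j p) (chord j m) (chord j q) (chord j u) (position₄ (src j) (tgt j) quad)
        (edge-noncrossing j edge-pm) (edge-noncrossing j edge-mq) (edge-noncrossing j edge-qu) (edge-noncrossing j edge-up)
        (noncrossing j i)))
      where open Quadrilateral V₀ i
    degrees : ∀ j i → Lead (yE j) (wVar i) (crossings (src j) (tgt j) i)
    degrees j i = subst (Lead (yE j) (wVar i))
      (trans (lookup-unitE-≢ (↑ˡ≢↑ʳ i j)) (sym (noncrossing j i))) (lead-wVar (yE j) i)

  mutate-seed : ∀ {x B C} → Seed x B C → ∀ k z → (z *L x k) ≈L exchRHS x B C k →
    Seed (update x k z) (mutB k B) (mutC k B C)
  mutate-seed {x} {B} {C} S k z eq = record
    { 𝒯 = Quadrilateral.𝒯′ valid k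
    ; valid = Quadrilateral.valid′ valid k
    ; realises = realises-mutB {B} realises
    ; shears = λ j → shear-mutC {B} {C} (src j) (tgt j) j realises (shears j)
    ; degrees = λ j → update-elim {x} {k} {z} (λ i f → Lead (yE j) f (Triangulation.crossings (Quadrilateral.𝒯′ valid k) (src j) (tgt j) i))
        (subst (Lead (yE j) z)
          (trans (tropical-crossings {B} {C} (src<N j) (tgt<N j) j realises (shears j)) (sym (crossings′-k (src j) (tgt j))))
          (lead-mutate (yE j) {x} {_} {B} {C} (degrees j) k z eq))
        λ i i≢k → subst (Lead (yE j) (x i)) (sym (crossings′-≢ (src j) (tgt j) i≢k)) (degrees j i)
    ; graded = λ r → Grading.graded-mutate B₀ r (graded r) k (trans (realises k k) (diagonal-zero valid k)) z eq
    }
    where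
    open Seed S
    open Mutation valid k
    src<N : ∀ j → src j < N
    src<N j = proj₁ (bounded (dart j))
    tgt<N : ∀ j → tgt j < N
    tgt<N j = proj₁ (bounded (dart⁻¹ j))

  seed : ∀ {x B C} → Reachable B₀ x B C → Seed x B C
  seed initial = initial-seed
  seed (mutate r k z eq) = mutate-seed (seed r) k z eq

  cluster-variable : ∀ f → IsClusterVariable B₀ f → Saturated f × EmptyPolytope f
  cluster-variable f (x , B , C , r , i , x≈f) = saturated admissible , emptyPolytope admissible
    where
    open Seed (seed r)
    open Grading B₀ using (gradE)
    -- The degrees in all coordinates together form the g-vector of `f`.
    g : Fin n → ℤ
    g r = proj₁ (graded r) i
    open Polytope B₀ f g
    bound : ∀ v {M} → Lead v (x i) M → ∀ e → Support f e → ⟨ v , e ⟩ ℤ.≤ M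
    bound v l = Leading.lead-bound v (Leading.lead-cong v {x i} {f} x≈f l)
    admissible : ∀ e → Support f e → Admissible e
    admissible e s = record
      { y-lower = λ j → bound (negate (yE j)) (lead-y-lower r j i) e s
      ; y-upper = λ j → ℤₚ.≤-trans (bound (yE j) (degrees j i) e s) (crossing-≤1 (chord j (Triangulation.src 𝒯 i)) (chord j (Triangulation.tgt 𝒯 i)))
      ; g-upper = λ r → bound (gradE r) (proj₁ (proj₂ (graded r)) i) e s
      ; g-lower = λ r → bound (negate (gradE r)) (proj₁ (proj₂ (proj₂ (graded r))) i) e s
      }

theorem4p7 : (n : ℕ) → n ℕ.≥ 1 → (B₀ : Matrix n) → IsTypeA n B₀ →
    (f : Laurent (n ℕ.+ n)) → IsClusterVariable B₀ f →
    Saturated f × EmptyPolytope f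
theorem4p7 n _ B₀ (ks , B₀≡) f with realise-mutSeq ks (fan-valid n) (fan-realises n)
... | 𝒯 , V , R = Seeds.cluster-variable V (λ i j → trans (B₀≡ i j) (R i j)) f
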